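{- Fix $\alpha,\beta>0$. For $n\ge3$ let $S$ be a random $\alpha/\beta$-staircase tableau of size $n$ with law $\mathbb{P}_{n,\alpha,\beta}$, and let $X_n^{(3)}$ be the number of non-empty boxes among the boxes $(n-j-1,j)$, $1\le j\le n-2$ (the third main diagonal). Then, as $n\to\infty$, $X_n^{(3)}$ converges in distribution to a Poisson random variable with parameter $1$.
   Context: A staircase tableau of size $n$ has boxes $(i,j)$ with $i,j\ge1$ and $i+j\le n+1$, rows numbered from the top and columns from the left. An $\alpha/\beta$-staircase tableau of size $n$ is a filling in which each box is empty or contains $\alpha$ or $\beta$, such that: all boxes in the same column and above an $\alpha$ are empty; all boxes in the same row and to the left of a $\beta$ are empty; every main-diagonal box (with $i+j=n+1$) contains a symbol. $\overline{\mathcal{S}}_n$ is the set of these. The weight is $wt(S)=\alpha^{N_\alpha}\beta^{N_\beta}$ ($N_\alpha,N_\beta$ the numbers of $\alpha$'s, $\beta$'s), and $\mathbb{P}_{n,\alpha,\beta}(S)=wt(S)/\sum_{T\in\overline{\mathcal{S}}_n}wt(T)$. -}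

module Defs where

open import Data.Empty using (⊥-elim)
open import Data.Fin as Fin using (Fin; zero; suc; toℕ)
import Data.Fin.Properties as Finₚ
open import Data.Integer as ℤ using (+_; -[1+_]; -1ℤ)
import Data.Integer.Properties as ℤₚ
open import Data.List as List using (List; []; _∷_; concatMap; cartesianProductWith; allFin; filter; length; upTo)
open import Data.List.Membership.Propositional using (_∈_)
open import Data.List.Membership.Propositional.Properties using (∈-filter⁺; ∈-cartesianProductWith⁺)
open import Data.List.Relation.Unary.All using ([]; _∷_)
open import Data.List.Relation.Unary.Any using (here; there)
open import Data.List.Relation.Unary.AllPairs using ([]; _∷_)
open import Data.List.Relation.Unary.Unique.Propositional using (Unique)
import Data.List.Relation.Unary.Unique.Propositional.Properties as Uniqueₚ
open import Data.Nat as ℕ using (ℕ; zero; suc; _≤_; _<_; _!; z≤n; s≤s)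
import Data.Nat.Solver as ℕSolver
import Data.Nat.Properties as ℕₚ
open import Data.Product using (Σ; ∃; _×_; _,_)
open import Data.Rational as ℚ using (ℚ; 0ℚ; 1ℚ; ½; mkℚ)
import Data.Rational.Properties as ℚₚ
import Data.Rational.Unnormalised as ℚᵘ
import Data.Rational.Unnormalised.Properties as ℚᵘₚ
open import Data.Rational.Solver using (module +-*-Solver)
open import Data.Sum using (inj₁; inj₂)
open import Data.Vec as Vec using (Vec; []; _∷_)
open import Relation.Binary.PropositionalEquality
open import Relation.Nullary using (Dec; yes; no)
open import Relation.Nullary.Decidable using (map′; ¬?; _×-dec_; _→-dec_)

------------------------------------------------------------------------
-- Rational estimates

open +-*-Solver using (solve; _:=_; _:+_; _:-_; _:*_; :-_; con)

*-pos : ∀ {p q} → 0ℚ ℚ.< p → 0ℚ ℚ.< q → 0ℚ ℚ.< p ℚ.* q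
*-pos {p} {q} 0<p 0<q =
  ℚₚ.positive⁻¹ (p ℚ.* q) {{ℚₚ.pos*pos⇒pos p {{ℚ.positive 0<p}} q {{ℚ.positive 0<q}}}}

½+½ : ∀ ε → ½ ℚ.* ε ℚ.+ ½ ℚ.* ε ≡ ε
½+½ = solve 1 (λ e → con ½ :* e :+ con ½ :* e := e) refl

halve : ∀ ε → 0ℚ ℚ.< ε → ∃ λ η → 0ℚ ℚ.< η × η ℚ.+ η ≡ ε
halve ε 0<ε = ½ ℚ.* ε , *-pos (ℚₚ.positive⁻¹ ½) 0<ε , ½+½ ε

*-mono-≤-nonNeg : ∀ {p q r s} → 0ℚ ℚ.≤ r → 0ℚ ℚ.≤ q → p ℚ.≤ q → r ℚ.≤ s → p ℚ.* r ℚ.≤ q ℚ.* s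
*-mono-≤-nonNeg {p} {q} {r} {s} 0≤r 0≤q p≤q r≤s = ℚₚ.≤-trans
  (ℚₚ.*-monoʳ-≤-nonNeg r {{ℚ.nonNegative 0≤r}} p≤q)
  (ℚₚ.*-monoˡ-≤-nonNeg q {{ℚ.nonNegative 0≤q}} r≤s)

p≤∣p∣ : ∀ p → p ℚ.≤ ℚ.∣ p ∣
p≤∣p∣ p with ℚₚ.≤-total 0ℚ p
... | inj₁ 0≤p = ℚₚ.≤-reflexive (sym (ℚₚ.0≤p⇒∣p∣≡p 0≤p))
... | inj₂ p≤0 = ℚₚ.≤-trans p≤0 (ℚₚ.0≤∣p∣ p)

∣p-q∣-sym : ∀ p q → ℚ.∣ p ℚ.- q ∣ ≡ ℚ.∣ q ℚ.- p ∣
∣p-q∣-sym p q = trans (sym (ℚₚ.∣-p∣≡∣p∣ (p ℚ.- q)))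
  (cong ℚ.∣_∣ (solve 2 (λ p q → :- (p :- q) := q :- p) refl p q))

∣p∣-∣q∣≤∣p-q∣ : ∀ p q → ℚ.∣ p ∣ ℚ.- ℚ.∣ q ∣ ℚ.≤ ℚ.∣ p ℚ.- q ∣
∣p∣-∣q∣≤∣p-q∣ p q = begin
  ℚ.∣ p ∣ ℚ.- ℚ.∣ q ∣
    ≡⟨ cong (λ r → ℚ.∣ r ∣ ℚ.- ℚ.∣ q ∣) (solve 2 (λ p q → p := (p :- q) :+ q) refl p q) ⟩
  ℚ.∣ (p ℚ.- q) ℚ.+ q ∣ ℚ.- ℚ.∣ q ∣
    ≤⟨ ℚₚ.+-monoˡ-≤ (ℚ.- ℚ.∣ q ∣) (ℚₚ.∣p+q∣≤∣p∣+∣q∣ (p ℚ.- q) q) ⟩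
  (ℚ.∣ p ℚ.- q ∣ ℚ.+ ℚ.∣ q ∣) ℚ.- ℚ.∣ q ∣
    ≡⟨ solve 2 (λ d q → (d :+ q) :- q := d) refl ℚ.∣ p ℚ.- q ∣ ℚ.∣ q ∣ ⟩
  ℚ.∣ p ℚ.- q ∣ ∎
  where open ℚₚ.≤-Reasoning

∣∣p∣-∣q∣∣≤∣p-q∣ : ∀ p q → ℚ.∣ ℚ.∣ p ∣ ℚ.- ℚ.∣ q ∣ ∣ ℚ.≤ ℚ.∣ p ℚ.- q ∣
∣∣p∣-∣q∣∣≤∣p-q∣ p q with ℚₚ.∣p∣≡p∨∣p∣≡-p (ℚ.∣ p ∣ ℚ.- ℚ.∣ q ∣)
... | inj₁ e = ℚₚ.≤-trans (ℚₚ.≤-reflexive e) (∣p∣-∣q∣≤∣p-q∣ p q)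
... | inj₂ e = begin
  ℚ.∣ ℚ.∣ p ∣ ℚ.- ℚ.∣ q ∣ ∣ ≡⟨ e ⟩
  ℚ.- (ℚ.∣ p ∣ ℚ.- ℚ.∣ q ∣) ≡⟨ solve 2 (λ p q → :- (p :- q) := q :- p) refl ℚ.∣ p ∣ ℚ.∣ q ∣ ⟩
  ℚ.∣ q ∣ ℚ.- ℚ.∣ p ∣       ≤⟨ ∣p∣-∣q∣≤∣p-q∣ q p ⟩
  ℚ.∣ q ℚ.- p ∣             ≡⟨ ∣p-q∣-sym q p ⟩
  ℚ.∣ p ℚ.- q ∣             ∎
  where open ℚₚ.≤-Reasoning

-- Total inverse: the junk value at 0 only ever affects finitely many terms
-- of a sequence that is eventually bounded away from 0.
inv : ℚ → ℚ
inv p with p ℚ.≟ 0ℚ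
... | yes _  = 0ℚ
... | no p≢0 = ℚ.1/_ p {{ℚ.≢-nonZero p≢0}}

*-inv : ∀ {p} → 0ℚ ℚ.< p → p ℚ.* inv p ≡ 1ℚ
*-inv {p} 0<p with p ℚ.≟ 0ℚ
... | yes p≡0 = ⊥-elim (ℚₚ.<⇒≢ 0<p (sym p≡0))
... | no  p≢0 = ℚₚ.*-inverseʳ p {{ℚ.≢-nonZero p≢0}}

inv-pos : ∀ {p} → 0ℚ ℚ.< p → 0ℚ ℚ.< inv p
inv-pos {p} 0<p with p ℚ.≟ 0ℚ
... | yes p≡0 = ⊥-elim (ℚₚ.<⇒≢ 0<p (sym p≡0))
... | no  p≢0 = ℚₚ.positive⁻¹ _ {{ℚₚ.1/pos⇒pos p {{ℚ.positive 0<p}}}}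

inv-antimono : ∀ {p q} → 0ℚ ℚ.< p → p ℚ.≤ q → inv q ℚ.≤ inv p
inv-antimono {p} {q} 0<p p≤q = begin
  inv q                     ≡⟨ sym (ℚₚ.*-identityˡ (inv q)) ⟩
  1ℚ ℚ.* inv q              ≡⟨ cong (ℚ._* inv q) (sym (*-inv 0<p)) ⟩
  (p ℚ.* inv p) ℚ.* inv q   ≡⟨ solve 3 (λ a b c → (a :* b) :* c := a :* (b :* c)) refl p (inv p) (inv q) ⟩
  p ℚ.* (inv p ℚ.* inv q)   ≤⟨ ℚₚ.*-monoʳ-≤-nonNeg _ {{ℚ.nonNegative (ℚₚ.<⇒≤ (*-pos (inv-pos 0<p) (inv-pos 0<q)))}} p≤q ⟩
  q ℚ.* (inv p ℚ.* inv q)   ≡⟨ solve 3 (λ a b c → a :* (b :* c) := (a :* c) :* b) refl q (inv p) (inv q) ⟩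
  (q ℚ.* inv q) ℚ.* inv p   ≡⟨ cong (ℚ._* inv p) (*-inv 0<q) ⟩
  1ℚ ℚ.* inv p              ≡⟨ ℚₚ.*-identityˡ (inv p) ⟩
  inv p                     ∎
  where
  open ℚₚ.≤-Reasoning
  0<q = ℚₚ.<-≤-trans 0<p p≤q

------------------------------------------------------------------------
-- Real numbers, as Cauchy sequences of rationals with termwise operations

record ℝ : Set where
  field
    seq    : ℕ → ℚ
    cauchy : ∀ ε → 0ℚ ℚ.< ε → ∃ λ N → ∀ m n → N ≤ m → N ≤ n → ℚ.∣ seq m ℚ.- seq n ∣ ℚ.< ε
open ℝ public

infix 4 _<ᴿ_
_<ᴿ_ : ℝ → ℝ → Set
x <ᴿ y = ∃ λ δ → 0ℚ ℚ.< δ × ∃ λ N → ∀ n → N ≤ n → δ ℚ.< seq y n ℚ.- seq x n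

ι : ℚ → ℝ
seq    (ι q) _ = q
cauchy (ι q) ε 0<ε = 0 , λ _ _ _ _ → subst (ℚ._< ε) (sym (cong ℚ.∣_∣ (ℚₚ.+-inverseʳ q))) 0<ε

fromℕ : ℕ → ℝ
fromℕ k = ι (+ k ℚ./ 1)

0ᴿ 1ᴿ : ℝ
0ᴿ = ι 0ℚ
1ᴿ = ι 1ℚ

infixl 6 _+ᴿ_ _-ᴿ_
infixl 7 _*ᴿ_
infixr 8 _^ᴿ_

+-close : ∀ {η} a b c d → ℚ.∣ a ℚ.- c ∣ ℚ.< η → ℚ.∣ b ℚ.- d ∣ ℚ.< η →
          ℚ.∣ (a ℚ.+ b) ℚ.- (c ℚ.+ d) ∣ ℚ.< η ℚ.+ η
+-close {η} a b c d ac bd = begin-strict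
  ℚ.∣ (a ℚ.+ b) ℚ.- (c ℚ.+ d) ∣
    ≡⟨ cong ℚ.∣_∣ (solve 4 (λ a b c d → (a :+ b) :- (c :+ d) := (a :- c) :+ (b :- d)) refl a b c d) ⟩
  ℚ.∣ (a ℚ.- c) ℚ.+ (b ℚ.- d) ∣     ≤⟨ ℚₚ.∣p+q∣≤∣p∣+∣q∣ (a ℚ.- c) (b ℚ.- d) ⟩
  ℚ.∣ a ℚ.- c ∣ ℚ.+ ℚ.∣ b ℚ.- d ∣   <⟨ ℚₚ.+-mono-< ac bd ⟩
  η ℚ.+ η                           ∎
  where open ℚₚ.≤-Reasoning

_+ᴿ_ : ℝ → ℝ → ℝ
seq    (x +ᴿ y) n = seq x n ℚ.+ seq y n
cauchy (x +ᴿ y) ε 0<ε =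
  let η , 0<η , η+η≡ε = halve ε 0<ε
      M , p = cauchy x η 0<η
      N , q = cauchy y η 0<η
  in M ℕ.⊔ N , λ m n h k → subst (_ ℚ.<_) η+η≡ε
       (+-close {η} (seq x m) (seq y m) (seq x n) (seq y n)
         (p m n (ℕₚ.m⊔n≤o⇒m≤o M N h) (ℕₚ.m⊔n≤o⇒m≤o M N k))
         (q m n (ℕₚ.m⊔n≤o⇒n≤o M N h) (ℕₚ.m⊔n≤o⇒n≤o M N k)))

-ᴿ_ : ℝ → ℝ
seq    (-ᴿ x) n = ℚ.- seq x n
cauchy (-ᴿ x) ε 0<ε = let N , p = cauchy x ε 0<ε in N , λ m n h k → subst (ℚ._< ε)
  (trans (∣p-q∣-sym (seq x m) (seq x n))
    (cong ℚ.∣_∣ (solve 2 (λ a b → b :- a := (:- a) :- (:- b)) refl (seq x m) (seq x n))))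
  (p m n h k)

_-ᴿ_ : ℝ → ℝ → ℝ
x -ᴿ y = x +ᴿ (-ᴿ y)

∣_∣ᴿ : ℝ → ℝ
seq    ∣ x ∣ᴿ n = ℚ.∣ seq x n ∣
cauchy ∣ x ∣ᴿ ε 0<ε = let N , p = cauchy x ε 0<ε in N , λ m n h k → ℚₚ.≤-<-trans (∣∣p∣-∣q∣∣≤∣p-q∣ (seq x m) (seq x n)) (p m n h k)

eventually-bounded : (x : ℝ) → ∃ λ B → 0ℚ ℚ.< B × ∃ λ N → ∀ n → N ≤ n → ℚ.∣ seq x n ∣ ℚ.≤ B
eventually-bounded x with cauchy x 1ℚ (ℚₚ.positive⁻¹ 1ℚ)
... | N , p = B , 0<B , N , λ n h → begin
  ℚ.∣ seq x n ∣
    ≡⟨ solve 2 (λ a b → a := (a :- b) :+ b) refl ℚ.∣ seq x n ∣ ℚ.∣ seq x N ∣ ⟩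
  (ℚ.∣ seq x n ∣ ℚ.- ℚ.∣ seq x N ∣) ℚ.+ ℚ.∣ seq x N ∣
    ≤⟨ ℚₚ.+-monoˡ-≤ ℚ.∣ seq x N ∣ (ℚₚ.≤-trans (∣p∣-∣q∣≤∣p-q∣ (seq x n) (seq x N)) (ℚₚ.<⇒≤ (p n N h ℕₚ.≤-refl))) ⟩
  B ∎
  where
  open ℚₚ.≤-Reasoning
  B = 1ℚ ℚ.+ ℚ.∣ seq x N ∣
  0<B : 0ℚ ℚ.< B
  0<B = ℚₚ.+-mono-<-≤ (ℚₚ.positive⁻¹ 1ℚ) (ℚₚ.0≤∣p∣ (seq x N))

*-close : ∀ {η A B} a b c d → 0ℚ ℚ.< A → 0ℚ ℚ.< B → ℚ.∣ a ∣ ℚ.≤ A → ℚ.∣ d ∣ ℚ.≤ B →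
          ℚ.∣ a ℚ.- c ∣ ℚ.< η ℚ.* inv B → ℚ.∣ b ℚ.- d ∣ ℚ.< η ℚ.* inv A →
          ℚ.∣ a ℚ.* b ℚ.- c ℚ.* d ∣ ℚ.< η ℚ.+ η
*-close {η} {A} {B} a b c d 0<A 0<B ∣a∣≤A ∣d∣≤B ac bd = begin-strict
  ℚ.∣ a ℚ.* b ℚ.- c ℚ.* d ∣
    ≡⟨ cong ℚ.∣_∣ split ⟩
  ℚ.∣ a ℚ.* (b ℚ.- d) ℚ.+ (a ℚ.- c) ℚ.* d ∣
    ≤⟨ ℚₚ.∣p+q∣≤∣p∣+∣q∣ (a ℚ.* (b ℚ.- d)) ((a ℚ.- c) ℚ.* d) ⟩
  ℚ.∣ a ℚ.* (b ℚ.- d) ∣ ℚ.+ ℚ.∣ (a ℚ.- c) ℚ.* d ∣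
    ≡⟨ cong₂ ℚ._+_ (ℚₚ.∣p*q∣≡∣p∣*∣q∣ a (b ℚ.- d)) (ℚₚ.∣p*q∣≡∣p∣*∣q∣ (a ℚ.- c) d) ⟩
  ℚ.∣ a ∣ ℚ.* ℚ.∣ b ℚ.- d ∣ ℚ.+ ℚ.∣ a ℚ.- c ∣ ℚ.* ℚ.∣ d ∣
    ≤⟨ ℚₚ.+-mono-≤
         (ℚₚ.*-monoʳ-≤-nonNeg ℚ.∣ b ℚ.- d ∣ {{ℚₚ.∣-∣-nonNeg (b ℚ.- d)}} ∣a∣≤A)
         (ℚₚ.*-monoˡ-≤-nonNeg ℚ.∣ a ℚ.- c ∣ {{ℚₚ.∣-∣-nonNeg (a ℚ.- c)}} ∣d∣≤B) ⟩
  A ℚ.* ℚ.∣ b ℚ.- d ∣ ℚ.+ ℚ.∣ a ℚ.- c ∣ ℚ.* B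
    <⟨ ℚₚ.+-mono-<
         (ℚₚ.*-monoʳ-<-pos A {{ℚ.positive 0<A}} bd)
         (ℚₚ.*-monoˡ-<-pos B {{ℚ.positive 0<B}} ac) ⟩
  A ℚ.* (η ℚ.* inv A) ℚ.+ (η ℚ.* inv B) ℚ.* B
    ≡⟨ combine ⟩
  η ℚ.+ η ∎
  where
  open ℚₚ.≤-Reasoning
  split : a ℚ.* b ℚ.- c ℚ.* d ≡ a ℚ.* (b ℚ.- d) ℚ.+ (a ℚ.- c) ℚ.* d
  split = solve 4 (λ a b c d → (a :* b) :- (c :* d) := (a :* (b :- d)) :+ ((a :- c) :* d)) refl a b c d
  cancel : ∀ C → 0ℚ ℚ.< C → C ℚ.* (η ℚ.* inv C) ≡ η
  cancel C 0<C = trans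
    (solve 3 (λ c e i → c :* (e :* i) := (c :* i) :* e) refl C η (inv C))
    (trans (cong (ℚ._* η) (*-inv 0<C)) (ℚₚ.*-identityˡ η))
  combine : A ℚ.* (η ℚ.* inv A) ℚ.+ (η ℚ.* inv B) ℚ.* B ≡ η ℚ.+ η
  combine = cong₂ ℚ._+_ (cancel A 0<A) (trans (ℚₚ.*-comm (η ℚ.* inv B) B) (cancel B 0<B))

_*ᴿ_ : ℝ → ℝ → ℝ
seq    (x *ᴿ y) n = seq x n ℚ.* seq y n
cauchy (x *ᴿ y) ε 0<ε =
  let η , 0<η , η+η≡ε = halve ε 0<ε
      A , 0<A , K , bx = eventually-bounded x
      B , 0<B , L , by = eventually-bounded y
      M , p = cauchy x (η ℚ.* inv B) (*-pos 0<η (inv-pos 0<B))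
      N , q = cauchy y (η ℚ.* inv A) (*-pos 0<η (inv-pos 0<A))
  in (K ℕ.⊔ L) ℕ.⊔ (M ℕ.⊔ N) , λ m n h k →
  let h₁ = ℕₚ.m⊔n≤o⇒m≤o (K ℕ.⊔ L) (M ℕ.⊔ N) h ; h₂ = ℕₚ.m⊔n≤o⇒n≤o (K ℕ.⊔ L) (M ℕ.⊔ N) h
      k₁ = ℕₚ.m⊔n≤o⇒m≤o (K ℕ.⊔ L) (M ℕ.⊔ N) k ; k₂ = ℕₚ.m⊔n≤o⇒n≤o (K ℕ.⊔ L) (M ℕ.⊔ N) k
  in subst (_ ℚ.<_) η+η≡ε (*-close {η} (seq x m) (seq y m) (seq x n) (seq y n) 0<A 0<B
       (bx m (ℕₚ.m⊔n≤o⇒m≤o K L h₁)) (by n (ℕₚ.m⊔n≤o⇒n≤o K L k₁))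
       (p m n (ℕₚ.m⊔n≤o⇒m≤o M N h₂) (ℕₚ.m⊔n≤o⇒m≤o M N k₂))
       (q m n (ℕₚ.m⊔n≤o⇒n≤o M N h₂) (ℕₚ.m⊔n≤o⇒n≤o M N k₂)))

_^ᴿ_ : ℝ → ℕ → ℝ
x ^ᴿ zero  = 1ᴿ
x ^ᴿ suc k = x *ᴿ x ^ᴿ k

0<-bound : ∀ p {d} → d ℚ.< p ℚ.- 0ℚ → d ℚ.< p
0<-bound p {d} = subst (d ℚ.<_) (ℚₚ.+-identityʳ p)

inv-close : ∀ {ε δ} a b → 0ℚ ℚ.< ε → 0ℚ ℚ.< δ → δ ℚ.< a → δ ℚ.< b →
            ℚ.∣ a ℚ.- b ∣ ℚ.< ε ℚ.* (δ ℚ.* δ) → ℚ.∣ inv a ℚ.- inv b ∣ ℚ.< ε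
inv-close {ε} {δ} a b 0<ε 0<δ δ<a δ<b ab = begin-strict
  ℚ.∣ inv a ℚ.- inv b ∣
    ≡⟨ cong ℚ.∣_∣ difference ⟩
  ℚ.∣ (b ℚ.- a) ℚ.* (inv a ℚ.* inv b) ∣
    ≡⟨ ℚₚ.∣p*q∣≡∣p∣*∣q∣ (b ℚ.- a) (inv a ℚ.* inv b) ⟩
  ℚ.∣ b ℚ.- a ∣ ℚ.* ℚ.∣ inv a ℚ.* inv b ∣
    ≡⟨ cong₂ ℚ._*_ (∣p-q∣-sym b a) (ℚₚ.0≤p⇒∣p∣≡p (ℚₚ.<⇒≤ ij>0)) ⟩
  ℚ.∣ a ℚ.- b ∣ ℚ.* (inv a ℚ.* inv b)
    <⟨ ℚₚ.*-monoˡ-<-pos (inv a ℚ.* inv b) {{ℚ.positive ij>0}} ab ⟩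
  (ε ℚ.* (δ ℚ.* δ)) ℚ.* (inv a ℚ.* inv b)
    ≤⟨ ℚₚ.*-monoˡ-≤-nonNeg (ε ℚ.* (δ ℚ.* δ)) {{ℚ.nonNegative (ℚₚ.<⇒≤ (*-pos 0<ε (*-pos 0<δ 0<δ)))}}
         (*-mono-≤-nonNeg (ℚₚ.<⇒≤ (inv-pos 0<b)) (ℚₚ.<⇒≤ (inv-pos 0<δ))
            (inv-antimono 0<δ (ℚₚ.<⇒≤ δ<a)) (inv-antimono 0<δ (ℚₚ.<⇒≤ δ<b))) ⟩
  (ε ℚ.* (δ ℚ.* δ)) ℚ.* (inv δ ℚ.* inv δ)
    ≡⟨ solve 3 (λ e d i → (e :* (d :* d)) :* (i :* i) := e :* ((d :* i) :* (d :* i))) refl ε δ (inv δ) ⟩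
  ε ℚ.* ((δ ℚ.* inv δ) ℚ.* (δ ℚ.* inv δ))
    ≡⟨ cong (λ u → ε ℚ.* (u ℚ.* u)) (*-inv 0<δ) ⟩
  ε ℚ.* 1ℚ
    ≡⟨ ℚₚ.*-identityʳ ε ⟩
  ε ∎
  where
  open ℚₚ.≤-Reasoning
  0<a = ℚₚ.<-trans 0<δ δ<a
  0<b = ℚₚ.<-trans 0<δ δ<b
  ij>0 = *-pos (inv-pos 0<a) (inv-pos 0<b)
  difference : inv a ℚ.- inv b ≡ (b ℚ.- a) ℚ.* (inv a ℚ.* inv b)
  difference = sym (trans
    (solve 4 (λ a b i j → (b :- a) :* (i :* j) := i :* (b :* j) :- (a :* i) :* j) refl a b (inv a) (inv b))
    (trans (cong₂ (λ u v → inv a ℚ.* u ℚ.- v ℚ.* inv b) (*-inv 0<b) (*-inv 0<a))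
      (cong₂ ℚ._-_ (ℚₚ.*-identityʳ (inv a)) (ℚₚ.*-identityˡ (inv b)))))

recip : (x : ℝ) → 0ᴿ <ᴿ x → ℝ
seq    (recip x _) n = inv (seq x n)
cauchy (recip x (δ , 0<δ , K , δ<x)) ε 0<ε =
  let N , p = cauchy x (ε ℚ.* (δ ℚ.* δ)) (*-pos 0<ε (*-pos 0<δ 0<δ)) in
  K ℕ.⊔ N , λ m n h k →
  inv-close (seq x m) (seq x n) 0<ε 0<δ
    (0<-bound (seq x m) (δ<x m (ℕₚ.m⊔n≤o⇒m≤o K N h))) (0<-bound (seq x n) (δ<x n (ℕₚ.m⊔n≤o⇒m≤o K N k)))
    (p m n (ℕₚ.m⊔n≤o⇒n≤o K N h) (ℕₚ.m⊔n≤o⇒n≤o K N k))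

1>0 : 0ᴿ <ᴿ 1ᴿ
1>0 = ½ , ℚₚ.positive⁻¹ ½ , 0 , λ _ _ → ℚ.*<* (ℤ.+<+ (s≤s (s≤s z≤n)))

+-posᴿ : ∀ {x y} → 0ᴿ <ᴿ x → 0ᴿ <ᴿ y → 0ᴿ <ᴿ x +ᴿ y
+-posᴿ {x} {y} (δ , 0<δ , M , p) (η , 0<η , N , q) =
  δ ℚ.+ η , ℚₚ.+-mono-< 0<δ 0<η , M ℕ.⊔ N , λ n h →
  subst (δ ℚ.+ η ℚ.<_) (sym (ℚₚ.+-identityʳ (seq x n ℚ.+ seq y n)))
    (ℚₚ.+-mono-< (0<-bound (seq x n) (p n (ℕₚ.m⊔n≤o⇒m≤o M N h))) (0<-bound (seq y n) (q n (ℕₚ.m⊔n≤o⇒n≤o M N h))))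

*-posᴿ : ∀ {x y} → 0ᴿ <ᴿ x → 0ᴿ <ᴿ y → 0ᴿ <ᴿ x *ᴿ y
*-posᴿ {x} {y} (δ , 0<δ , M , p) (η , 0<η , N , q) =
  δ ℚ.* η , *-pos 0<δ 0<η , M ℕ.⊔ N , λ n h →
  let δ<a = 0<-bound (seq x n) (p n (ℕₚ.m⊔n≤o⇒m≤o M N h))
      η<b = 0<-bound (seq y n) (q n (ℕₚ.m⊔n≤o⇒n≤o M N h))
  in subst (δ ℚ.* η ℚ.<_) (sym (ℚₚ.+-identityʳ (seq x n ℚ.* seq y n)))
    (ℚₚ.<-trans {j = seq x n ℚ.* η} (ℚₚ.*-monoˡ-<-pos η {{ℚ.positive 0<η}} δ<a)
                (ℚₚ.*-monoʳ-<-pos (seq x n) {{ℚ.positive (ℚₚ.<-trans 0<δ δ<a)}} η<b))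

^-posᴿ : ∀ {x} → 0ᴿ <ᴿ x → ∀ k → 0ᴿ <ᴿ x ^ᴿ k
^-posᴿ 0<x zero = 1>0
^-posᴿ {x} 0<x (suc k) = *-posᴿ {x} {x ^ᴿ k} 0<x (^-posᴿ 0<x k)

sumᴿ : List ℝ → ℝ
sumᴿ = List.foldr _+ᴿ_ 0ᴿ

infix 4 _⟶_
_⟶_ : (ℕ → ℝ) → ℝ → Set
s ⟶ L = ∀ ε → 0ℚ ℚ.< ε → ∃ λ N → ∀ n → N ≤ n → ∣ s n -ᴿ L ∣ᴿ <ᴿ ι ε

-- ℝ carries no quotient: x and y represent the same real when ∣ y -ᴿ x ∣ᴿ is
-- below every ι δ, so continuity also forces f to respect equality of reals.
Continuous : (ℝ → ℝ) → Set
Continuous f = ∀ x ε → 0ℚ ℚ.< ε →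
  ∃ λ δ → 0ℚ ℚ.< δ × (∀ y → ∣ y -ᴿ x ∣ᴿ <ᴿ ι δ → ∣ f y -ᴿ f x ∣ᴿ <ᴿ ι ε)

Bounded : (ℝ → ℝ) → Set
Bounded f = ∃ λ M → ∀ x → ∣ f x ∣ᴿ <ᴿ ι M

------------------------------------------------------------------------
-- The Poisson law with parameter 1

expTerm : ℕ → ℚ
expTerm i = ℚ._/_ (-1ℤ ℤ.^ i) (i !) {{i ℕₚ.!≢0}}

expSum : ℕ → ℚ
expSum zero    = 0ℚ
expSum (suc m) = expSum m ℚ.+ expTerm m

unit/≤ : ∀ p q r .{{_ : ℕ.NonZero q}} .{{_ : ℕ.NonZero r}} →
         ℤ.∣ p ∣ ≡ 1 → r ≤ q → ℚ.∣ p ℚ./ q ∣ ℚ.≤ + 1 ℚ./ r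
unit/≤ p q@(suc q-1) r@(suc r-1) ∣p∣≡1 r≤q = ℚₚ.toℚᵘ-cancel-≤ (begin
  ℚ.toℚᵘ ℚ.∣ p ℚ./ q ∣       ≃⟨ ℚₚ.toℚᵘ-homo-∣-∣ (p ℚ./ q) ⟩
  ℚᵘ.∣ ℚ.toℚᵘ (p ℚ./ q) ∣    ≃⟨ ℚᵘₚ.∣-∣-cong (ℚₚ.toℚᵘ-fromℚᵘ (ℚᵘ.mkℚᵘ p q-1)) ⟩
  ℚᵘ.mkℚᵘ (+ ℤ.∣ p ∣) q-1    ≡⟨ cong (λ k → ℚᵘ.mkℚᵘ (+ k) q-1) ∣p∣≡1 ⟩
  ℚᵘ.mkℚᵘ (+ 1) q-1          ≤⟨ ℚᵘ.*≤* (subst₂ ℤ._≤_ (sym (ℤₚ.*-identityˡ (+ r))) (sym (ℤₚ.*-identityˡ (+ q))) (ℤ.+≤+ r≤q)) ⟩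
  ℚᵘ.mkℚᵘ (+ 1) r-1          ≃⟨ ℚᵘₚ.≃-sym (ℚₚ.toℚᵘ-fromℚᵘ (ℚᵘ.mkℚᵘ (+ 1) r-1)) ⟩
  ℚ.toℚᵘ (+ 1 ℚ./ r)         ∎)
  where open ℚᵘₚ.≤-Reasoning

1/-double : ∀ q .{{_ : ℕ.NonZero q}} .{{_ : ℕ.NonZero (2 ℕ.* q)}} →
            + 1 ℚ./ (2 ℕ.* q) ℚ.+ + 1 ℚ./ (2 ℕ.* q) ≡ + 1 ℚ./ q
1/-double q@(suc q-1) = ℚₚ.toℚᵘ-injective (begin-equality
  ℚ.toℚᵘ (+ 1 ℚ./ 2q ℚ.+ + 1 ℚ./ 2q)
    ≃⟨ ℚₚ.toℚᵘ-homo-+ (+ 1 ℚ./ 2q) (+ 1 ℚ./ 2q) ⟩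
  ℚ.toℚᵘ (+ 1 ℚ./ 2q) ℚᵘ.+ ℚ.toℚᵘ (+ 1 ℚ./ 2q)
    ≃⟨ ℚᵘₚ.+-cong half half ⟩
  + 1 ℚᵘ./ 2q ℚᵘ.+ + 1 ℚᵘ./ 2q
    ≃⟨ ℚᵘ.*≡* (cong +_ (ℕ-identity q)) ⟩
  + 1 ℚᵘ./ q
    ≃⟨ ℚᵘₚ.≃-sym (ℚₚ.toℚᵘ-fromℚᵘ (ℚᵘ.mkℚᵘ (+ 1) q-1)) ⟩
  ℚ.toℚᵘ (+ 1 ℚ./ q) ∎)
  where
  open ℚᵘₚ.≤-Reasoning
  open ℕSolver.+-*-Solver using () renaming (solve to solveℕ; _:=_ to _:≡_; _:+_ to _⊞_; _:*_ to _⊠_; con to conℕ)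
  2q = 2 ℕ.* q
  half : ℚ.toℚᵘ (+ 1 ℚ./ 2q) ℚᵘ.≃ + 1 ℚᵘ./ 2q
  half = ℚₚ.toℚᵘ-fromℚᵘ (+ 1 ℚᵘ./ 2q)
  ℕ-identity : ∀ q → (1 ℕ.* (2 ℕ.* q) ℕ.+ 1 ℕ.* (2 ℕ.* q)) ℕ.* q ≡ 1 ℕ.* ((2 ℕ.* q) ℕ.* (2 ℕ.* q))
  ℕ-identity = solveℕ 1 (λ q → (conℕ 1 ⊠ (conℕ 2 ⊠ q) ⊞ conℕ 1 ⊠ (conℕ 2 ⊠ q)) ⊠ q
                            :≡ conℕ 1 ⊠ ((conℕ 2 ⊠ q) ⊠ (conℕ 2 ⊠ q))) refl

2⁻ : ℕ → ℚ
2⁻ i = ℚ._/_ (+ 1) (2 ℕ.^ i) {{ℕₚ.m^n≢0 2 i}}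

2⁻-double : ∀ i → 2⁻ (suc i) ℚ.+ 2⁻ (suc i) ≡ 2⁻ i
2⁻-double i = 1/-double (2 ℕ.^ i) {{ℕₚ.m^n≢0 2 i}} {{ℕₚ.m^n≢0 2 (suc i)}}

2⁻-pos : ∀ i → 0ℚ ℚ.< 2⁻ i
2⁻-pos i = ℚₚ.positive⁻¹ (2⁻ i) {{ℚₚ.normalize-pos 1 (2 ℕ.^ i) {{ℕₚ.m^n≢0 2 i}}}}

n<2^n : ∀ n → n < 2 ℕ.^ n
n<2^n zero    = s≤s z≤n
n<2^n (suc n) = ℕₚ.≤-trans (ℕₚ.+-mono-≤ (ℕₚ.m^n>0 2 n) (n<2^n n))
  (ℕₚ.≤-reflexive (cong (2 ℕ.^ n ℕ.+_) (sym (ℕₚ.+-identityʳ (2 ℕ.^ n)))))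

2⁻-small : ∀ ε → 0ℚ ℚ.< ε → ∃ λ e → 2⁻ e ℚ.≤ ε
2⁻-small (mkℚ (+ zero) d-1 c) 0<ε = ⊥-elim (ℚₚ.<⇒≢ 0<ε (sym (ℚₚ.↥p≡0⇒p≡0 (mkℚ (+ zero) d-1 c) refl)))
2⁻-small (mkℚ -[1+ k ] d-1 c) 0<ε = ⊥-elim (ℚₚ.<-asym 0<ε (ℚₚ.negative⁻¹ (mkℚ -[1+ k ] d-1 c)))
2⁻-small (mkℚ (+ suc k) d-1 c) _ =
  suc d-1 , cross (2 ℕ.^ suc d-1) {{ℕₚ.m^n≢0 2 (suc d-1)}} (ℕₚ.<⇒≤ (n<2^n (suc d-1)))
  where
  open ℚᵘₚ.≤-Reasoning
  cross : ∀ q .{{_ : ℕ.NonZero q}} → suc d-1 ≤ q → + 1 ℚ./ q ℚ.≤ mkℚ (+ suc k) d-1 c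
  cross q@(suc q-1) d≤q = ℚₚ.toℚᵘ-cancel-≤ (begin
    ℚ.toℚᵘ (+ 1 ℚ./ q)      ≃⟨ ℚₚ.toℚᵘ-fromℚᵘ (ℚᵘ.mkℚᵘ (+ 1) q-1) ⟩
    ℚᵘ.mkℚᵘ (+ 1) q-1       ≤⟨ ℚᵘ.*≤* (ℤ.+≤+ (ℕₚ.≤-trans
      (ℕₚ.≤-trans (ℕₚ.≤-reflexive (ℕₚ.*-identityˡ (suc d-1))) d≤q) (ℕₚ.m≤m+n q (k ℕ.* q)))) ⟩
    ℚᵘ.mkℚᵘ (+ suc k) d-1   ∎)

∣-1^i∣ : ∀ i → ℤ.∣ -1ℤ ℤ.^ i ∣ ≡ 1
∣-1^i∣ zero    = refl
∣-1^i∣ (suc i) = trans (ℤₚ.abs-* -1ℤ (-1ℤ ℤ.^ i)) (trans (ℕₚ.+-identityʳ _) (∣-1^i∣ i))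

2^i≤[1+i]! : ∀ i → 2 ℕ.^ i ≤ suc i !
2^i≤[1+i]! zero    = s≤s z≤n
2^i≤[1+i]! (suc i) = ℕₚ.*-mono-≤ {2} {suc (suc i)} (s≤s (s≤s z≤n)) (2^i≤[1+i]! i)

expTerm-bound : ∀ i → ℚ.∣ expTerm (suc i) ∣ ℚ.≤ 2⁻ i
expTerm-bound i = unit/≤ (-1ℤ ℤ.^ suc i) (suc i !) (2 ℕ.^ i) {{suc i ℕₚ.!≢0}} {{ℕₚ.m^n≢0 2 i}}
  (∣-1^i∣ (suc i)) (2^i≤[1+i]! i)

expTail : ∀ m k → ℚ.∣ expSum (suc (k ℕ.+ m)) ℚ.- expSum (suc m) ∣ ℚ.+ (2⁻ (k ℕ.+ m) ℚ.+ 2⁻ (k ℕ.+ m))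
             ℚ.≤ 2⁻ m ℚ.+ 2⁻ m
expTail m zero = ℚₚ.≤-reflexive (trans
  (cong (λ r → ℚ.∣ r ∣ ℚ.+ (2⁻ m ℚ.+ 2⁻ m)) (ℚₚ.+-inverseʳ (expSum (suc m))))
  (ℚₚ.+-identityˡ (2⁻ m ℚ.+ 2⁻ m)))
expTail m (suc k) = ℚₚ.≤-trans (step (expSum (suc (k ℕ.+ m))) (expTerm (suc (k ℕ.+ m))) (expSum (suc m))
    (2⁻ (k ℕ.+ m)) _ (expTerm-bound (k ℕ.+ m)) (2⁻-double (k ℕ.+ m))) (expTail m k)
  where
  step : ∀ s t u h g → ℚ.∣ t ∣ ℚ.≤ h → g ≡ h →
         ℚ.∣ (s ℚ.+ t) ℚ.- u ∣ ℚ.+ g ℚ.≤ ℚ.∣ s ℚ.- u ∣ ℚ.+ (h ℚ.+ h)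
  step s t u h g t≤h refl = begin
    ℚ.∣ (s ℚ.+ t) ℚ.- u ∣ ℚ.+ h
      ≡⟨ cong (λ r → ℚ.∣ r ∣ ℚ.+ h) (solve 3 (λ s t u → (s :+ t) :- u := (s :- u) :+ t) refl s t u) ⟩
    ℚ.∣ (s ℚ.- u) ℚ.+ t ∣ ℚ.+ h
      ≤⟨ ℚₚ.+-monoˡ-≤ h (ℚₚ.≤-trans (ℚₚ.∣p+q∣≤∣p∣+∣q∣ (s ℚ.- u) t) (ℚₚ.+-monoʳ-≤ ℚ.∣ s ℚ.- u ∣ t≤h)) ⟩
    (ℚ.∣ s ℚ.- u ∣ ℚ.+ h) ℚ.+ h
      ≡⟨ ℚₚ.+-assoc ℚ.∣ s ℚ.- u ∣ h h ⟩
    ℚ.∣ s ℚ.- u ∣ ℚ.+ (h ℚ.+ h) ∎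
    where open ℚₚ.≤-Reasoning

expTail< : ∀ d n → suc (suc d) ≤ n → ℚ.∣ expSum n ℚ.- expSum (suc (suc d)) ∣ ℚ.< 2⁻ d
expTail< d (suc n) (s≤s d<n) = subst (λ k → ℚ.∣ expSum (suc k) ℚ.- expSum (suc (suc d)) ∣ ℚ.< 2⁻ d)
  (ℕₚ.m∸n+n≡m d<n)
  (strict (n ℕ.∸ suc d))
  where
  add-pos : ∀ p {q} → 0ℚ ℚ.< q → p ℚ.< p ℚ.+ q
  add-pos p {q} 0<q = subst (ℚ._< p ℚ.+ q) (ℚₚ.+-identityʳ p) (ℚₚ.+-monoʳ-< p 0<q)
  strict : ∀ k → ℚ.∣ expSum (suc (k ℕ.+ suc d)) ℚ.- expSum (suc (suc d)) ∣ ℚ.< 2⁻ d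
  strict k = ℚₚ.<-≤-trans
    (add-pos _ (ℚₚ.+-mono-< (2⁻-pos (k ℕ.+ suc d)) (2⁻-pos (k ℕ.+ suc d))))
    (ℚₚ.≤-trans (expTail (suc d) k) (ℚₚ.≤-reflexive (2⁻-double d)))

close-via : ∀ {η} a b c → ℚ.∣ a ℚ.- c ∣ ℚ.< η → ℚ.∣ b ℚ.- c ∣ ℚ.< η → ℚ.∣ a ℚ.- b ∣ ℚ.< η ℚ.+ η
close-via {η} a b c ac bc = begin-strict
  ℚ.∣ a ℚ.- b ∣
    ≡⟨ cong ℚ.∣_∣ (solve 3 (λ a b c → a :- b := (a :- c) :- (b :- c)) refl a b c) ⟩
  ℚ.∣ (a ℚ.- c) ℚ.- (b ℚ.- c) ∣    ≤⟨ ℚₚ.∣p-q∣≤∣p∣+∣q∣ (a ℚ.- c) (b ℚ.- c) ⟩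
  ℚ.∣ a ℚ.- c ∣ ℚ.+ ℚ.∣ b ℚ.- c ∣  <⟨ ℚₚ.+-mono-< ac bc ⟩
  η ℚ.+ η                          ∎
  where open ℚₚ.≤-Reasoning

-- Σ (-1)ⁱ/i!
e⁻¹ : ℝ
seq    e⁻¹ = expSum
cauchy e⁻¹ ε 0<ε =
  let e , small = 2⁻-small ε 0<ε
      N = suc (suc (suc e))
  in N , λ m n h k → ℚₚ.<-≤-trans
       (close-via {2⁻ (suc e)} (expSum m) (expSum n) (expSum N) (expTail< (suc e) m h) (expTail< (suc e) n k))
       (ℚₚ.≤-trans (ℚₚ.≤-reflexive (2⁻-double e)) small)

-- e^{-λ} λᵏ / k! at λ = 1
poisson₁ : ℕ → ℝ
poisson₁ k = e⁻¹ *ᴿ ι (ℚ._/_ (+ 1) (k !) {{k ℕₚ.!≢0}})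

------------------------------------------------------------------------
-- Convergence in distribution

-- Outcomes are to be listed without repetition; ℙ is the probability
-- proportional to weight.
record FiniteSpace : Set₁ where
  field
    Ω        : Set
    outcomes : List Ω
    weight   : Ω → ℝ

  total : ℝ
  total = sumᴿ (List.map weight outcomes)

  field
    total>0 : 0ᴿ <ᴿ total

  ℙ : Ω → ℝ
  ℙ ω = weight ω *ᴿ recip total total>0

  𝔼 : (Ω → ℝ) → ℝ
  𝔼 Y = sumᴿ (List.map (λ ω → ℙ ω *ᴿ Y ω) outcomes)
open FiniteSpace public using (Ω; 𝔼)

-- For p the mass function of a law on ℕ: 𝔼 f(Xₙ) → Σₖ p(k) f(k) for every
-- bounded continuous f : ℝ → ℝ, where L is the sum of the series.
ConvergesInDistribution : (space : ℕ → FiniteSpace) → (∀ n → Ω (space n) → ℝ) → (ℕ → ℝ) → Set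
ConvergesInDistribution space X p =
  ∀ f → Continuous f → Bounded f →
  ∃ λ L → ((λ K → sumᴿ (List.map (λ k → p k *ᴿ f (fromℕ k)) (upTo K))) ⟶ L)
        × ((λ n → 𝔼 (space n) (λ ω → f (X n ω))) ⟶ L)

------------------------------------------------------------------------
-- α/β-staircase tableaux

data Cell : Set where
  empty alpha beta : Cell

_≟ᶜ_ : (x y : Cell) → Dec (x ≡ y)
empty ≟ᶜ empty = yes refl
empty ≟ᶜ alpha = no λ ()
empty ≟ᶜ beta  = no λ ()
alpha ≟ᶜ empty = no λ ()
alpha ≟ᶜ alpha = yes refl
alpha ≟ᶜ beta  = no λ ()
beta  ≟ᶜ empty = no λ ()
beta  ≟ᶜ alpha = no λ ()
beta  ≟ᶜ beta  = yes refl

-- Row i (counted from 0) of the staircase of size n has n - i boxes.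
Box : ℕ → Set
Box n = Σ (Fin n) λ i → Fin (n ℕ.∸ toℕ i)

-- Coordinates are 1-based.
row col : ∀ {n} → Box n → ℕ
row (i , _) = suc (toℕ i)
col (_ , j) = suc (toℕ j)

boxes : ∀ n → List (Box n)
boxes n = concatMap (λ i → List.map (i ,_) (allFin (n ℕ.∸ toℕ i))) (allFin n)

-- A filling, as its first row followed by the staircase of remaining rows.
data Filling : ℕ → Set where
  []  : Filling 0
  _∷_ : ∀ {n} → Vec Cell (suc n) → Filling n → Filling (suc n)

at : ∀ {n} → Filling n → Box n → Cell
at (r ∷ S) (zero  , j) = Vec.lookup r j
at (r ∷ S) (suc i , j) = at S (i , j)

record IsTableau {n} (S : Filling n) : Set where
  field
    above-α   : ∀ b c → at S b ≡ alpha → col c ≡ col b → row c < row b → at S c ≡ empty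
    left-of-β : ∀ b c → at S b ≡ beta → row c ≡ row b → col c < col b → at S c ≡ empty
    diagonal  : ∀ b → row b ℕ.+ col b ≡ suc n → at S b ≢ empty

allBox? : ∀ {n} {P : Box n → Set} → (∀ b → Dec (P b)) → Dec (∀ b → P b)
allBox? P? = map′ (λ f (i , j) → f i j) (λ f i j → f (i , j))
  (Finₚ.all? λ i → Finₚ.all? λ j → P? (i , j))

isTableau? : ∀ {n} (S : Filling n) → Dec (IsTableau S)
isTableau? {n} S = map′
  (λ (p , q , r) → record { above-α = p ; left-of-β = q ; diagonal = r })
  (λ t → IsTableau.above-α t , IsTableau.left-of-β t , IsTableau.diagonal t)
  (      (allBox? λ b → allBox? λ c → (at S b ≟ᶜ alpha) →-dec (col c ℕ.≟ col b)
            →-dec (row c ℕ.<? row b) →-dec (at S c ≟ᶜ empty))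
   ×-dec (allBox? λ b → allBox? λ c → (at S b ≟ᶜ beta) →-dec (row c ℕ.≟ row b)
            →-dec (col c ℕ.<? col b) →-dec (at S c ≟ᶜ empty))
   ×-dec (allBox? λ b → (row b ℕ.+ col b ℕ.≟ suc n) →-dec ¬? (at S b ≟ᶜ empty)))

cells : List Cell
cells = empty ∷ alpha ∷ beta ∷ []

rows : ∀ m → List (Vec Cell m)
rows zero    = [] ∷ []
rows (suc m) = cartesianProductWith _∷_ cells (rows m)

fillings : ∀ n → List (Filling n)
fillings zero    = [] ∷ []
fillings (suc n) = cartesianProductWith _∷_ (rows (suc n)) (fillings n)

tableaux : ∀ n → List (Filling n)
tableaux n = filter isTableau? (fillings n)

cells-complete : ∀ x → x ∈ cells
cells-complete empty = here refl
cells-complete alpha = there (here refl)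
cells-complete beta  = there (there (here refl))

rows-complete : ∀ {m} (r : Vec Cell m) → r ∈ rows m
rows-complete []      = here refl
rows-complete (x ∷ r) = ∈-cartesianProductWith⁺ _∷_ (cells-complete x) (rows-complete r)

fillings-complete : ∀ {n} (S : Filling n) → S ∈ fillings n
fillings-complete []      = here refl
fillings-complete (r ∷ S) = ∈-cartesianProductWith⁺ _∷_ (rows-complete r) (fillings-complete S)

rows-unique : ∀ m → Unique (rows m)
rows-unique zero    = [] ∷ []
rows-unique (suc m) = Uniqueₚ.cartesianProductWith⁺ _∷_ (λ { refl → refl , refl }) cells-unique (rows-unique m)
  where
  cells-unique : Unique cells
  cells-unique = ((λ ()) ∷ (λ ()) ∷ []) ∷ ((λ ()) ∷ []) ∷ [] ∷ []

fillings-unique : ∀ n → Unique (fillings n)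
fillings-unique zero    = [] ∷ []
fillings-unique (suc n) =
  Uniqueₚ.cartesianProductWith⁺ _∷_ (λ { refl → refl , refl }) (rows-unique (suc n)) (fillings-unique n)

tableaux-complete : ∀ {n} (S : Filling n) → IsTableau S → S ∈ tableaux n
tableaux-complete S t = ∈-filter⁺ isTableau? (fillings-complete S) t

tableaux-unique : ∀ n → Unique (tableaux n)
tableaux-unique n = Uniqueₚ.filter⁺ isTableau? (fillings-unique n)

count : ∀ {n} {P : Box n → Set} → (∀ b → Dec (P b)) → ℕ
count {n} P? = length (filter P? (boxes n))

Nα Nβ : ∀ {n} → Filling n → ℕ
Nα S = count λ b → at S b ≟ᶜ alpha
Nβ S = count λ b → at S b ≟ᶜ beta

wt : ∀ {n} → ℝ → ℝ → Filling n → ℝ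
wt α β S = α ^ᴿ Nα S *ᴿ β ^ᴿ Nβ S

-- Non-empty boxes among the (n-j-1, j), i.e. those with row + col = n - 1;
-- there are none when n < 3.
X³ : ∀ {n} → Filling n → ℕ
X³ {n} S = count λ b → (suc (row b ℕ.+ col b) ℕ.≟ n) ×-dec ¬? (at S b ≟ᶜ empty)

αRow : ∀ n → Vec Cell (suc n)
αRow zero    = alpha ∷ []
αRow (suc n) = empty ∷ αRow n

αDiagonal : ∀ n → Filling n
αDiagonal zero    = []
αDiagonal (suc n) = αRow n ∷ αDiagonal n

data OnDiagonal (x : Cell) (i n : ℕ) : Set where
  on  : x ≡ alpha → i ≡ n → OnDiagonal x i n
  off : x ≡ empty → i ≢ n → OnDiagonal x i n

shift : ∀ {x i n} → OnDiagonal x i n → OnDiagonal x (suc i) (suc n)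
shift (on p q)  = on p (cong suc q)
shift (off p q) = off p (λ e → q (ℕₚ.suc-injective e))

αRow-at : ∀ n (j : Fin (suc n)) → OnDiagonal (Vec.lookup (αRow n) j) (toℕ j) n
αRow-at zero    zero    = on refl refl
αRow-at (suc n) zero    = off refl (λ ())
αRow-at (suc n) (suc j) = shift (αRow-at n j)

αDiagonal-at : ∀ n (b : Box n) → OnDiagonal (at (αDiagonal n) b) (row b ℕ.+ col b) (suc n)
αDiagonal-at (suc n) (zero  , j) = shift (shift (αRow-at n j))
αDiagonal-at (suc n) (suc i , j) = shift (αDiagonal-at n (i , j))

αDiagonal-isTableau : ∀ n → IsTableau (αDiagonal n)
αDiagonal-isTableau n = record { above-α = above ; left-of-β = left ; diagonal = diag }
  where
  above : ∀ b c → at (αDiagonal n) b ≡ alpha → col c ≡ col b → row c < row b → at (αDiagonal n) c ≡ empty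
  above b c ≡α cols rows< with αDiagonal-at n b | αDiagonal-at n c
  ... | _        | off ≡∅ _ = ≡∅
  ... | off ≡∅ _ | on _ _   with () ← trans (sym ≡∅) ≡α
  ... | on _ p   | on _ q   = ⊥-elim (ℕₚ.<⇒≢ rows<
    (ℕₚ.+-cancelʳ-≡ (col b) (row c) (row b) (trans (cong (row c ℕ.+_) (sym cols)) (trans q (sym p)))))
  left : ∀ b c → at (αDiagonal n) b ≡ beta → row c ≡ row b → col c < col b → at (αDiagonal n) c ≡ empty
  left b c ≡β _ _ with αDiagonal-at n b
  ... | on ≡α _  with () ← trans (sym ≡α) ≡β
  ... | off ≡∅ _ with () ← trans (sym ≡∅) ≡β
  diag : ∀ b → row b ℕ.+ col b ≡ suc n → at (αDiagonal n) b ≢ empty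
  diag b p ≡∅ with αDiagonal-at n b
  ... | on ≡α _ with () ← trans (sym ≡α) ≡∅
  ... | off _ q = q p

sum-pos : ∀ {A : Set} (w : A → ℝ) → (∀ a → 0ᴿ <ᴿ w a) → ∀ {a} xs → a ∈ xs → 0ᴿ <ᴿ sumᴿ (List.map w xs)
sum-pos w w>0 (x ∷ [])     _ = let δ , 0<δ , N , p = w>0 x in
  δ , 0<δ , N , λ n h → subst (δ ℚ.<_) (cong (ℚ._- 0ℚ) (sym (ℚₚ.+-identityʳ (seq (w x) n)))) (p n h)
sum-pos w w>0 (x ∷ y ∷ xs) _ =
  +-posᴿ {w x} {sumᴿ (List.map w (y ∷ xs))} (w>0 x) (sum-pos w w>0 (y ∷ xs) (here refl))

tableauSpace : (α β : ℝ) → 0ᴿ <ᴿ α → 0ᴿ <ᴿ β → ℕ → FiniteSpace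
tableauSpace α β α>0 β>0 n = record
  { Ω        = Filling n
  ; outcomes = tableaux n
  ; weight   = wt α β
  ; total>0  = sum-pos (wt α β)
      (λ S → *-posᴿ {α ^ᴿ Nα S} {β ^ᴿ Nβ S} (^-posᴿ {α} α>0 (Nα S)) (^-posᴿ {β} β>0 (Nβ S)))
      (tableaux n) (tableaux-complete (αDiagonal n) (αDiagonal-isTableau n))
  }

{-# OPTIONS --safe #-}

-- Build a tableau by adding top rows. A new row is constrained only by the set
-- of columns without α, so give each such column a weight u; with T = α + βu and
-- γ = αβ one more row replaces T by T + γ. Let A n T h be the total weight of h(X)
-- over the tableaux of size n, where X counts the filled boxes of the third
-- diagonal. Peeling off the rows that decide whether such a box is filled gives
--   A (n+3) T h = T (A (n+2) (T+γ) h + γ (T+γ) A n (T+2γ) (Δh) + γ² A n (T+γ) (Δh)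
--                    + γ² (T+γ) A (n-1) (T+2γ) (Δ²h)).
-- For h = C(·,r), with Δ C(·,r) = C(·,r-1), induction bounds the r-th binomial
-- moment of X between C(n-2r,r)/(n+c)^r and C(n+r,r)/(n-2r-2)^r, where c is any
-- integer above 1/α + 1/β, so that it tends to 1/r!. For bounded h the Newton
-- series Σᵣ Δʳh(0) C(X,r) has the remainder bound 2^R ‖h‖ C(X,R), and Σᵣ Δʳh(0)/r!
-- is the Cauchy product of Σ h(k)/k! with the series for e⁻¹. All bounds are
-- uniform in rational parameters bounded away from 0, hence hold at all large
-- indices of the Cauchy sequences α and β.

module Submission where

open import Defs
open import Algebra.Bundles using (CommutativeRing)
import Algebra.Properties.Semiring.Exp as SemiringExp
import Algebra.Properties.Semiring.Mult as SemiringMult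
open import Data.Bool using (Bool; true; false; _∧_; if_then_else_)
open import Data.Empty using (⊥-elim)
open import Data.Fin as Fin using (Fin; zero; suc; toℕ)
import Data.Fin.Properties as Finₚ
open import Data.Integer as ℤ using (-1ℤ) renaming (+_ to pos)
import Data.Integer.Properties as ℤₚ
open import Data.List as List using (List; []; _∷_; _++_; concatMap; cartesianProductWith; allFin; filter; length; upTo; applyUpTo)
import Data.List.Properties as Listₚ
open import Data.Nat as ℕ using (ℕ; zero; suc; z≤n; s≤s; _!)
open import Data.Nat.Combinatorics using (_C_; nCk+nC[k+1]≡[n+1]C[k+1]; nCk≡nC[n∸k]; nCn≡1)
import Data.Nat.Properties as ℕₚ
open import Data.Nat.Solver using () renaming (module +-*-Solver to ℕ-Solver)
open import Data.Product using (∃; _×_; _,_; proj₁; proj₂)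
open import Data.Rational as ℚ using (ℚ; 0ℚ; 1ℚ; ½; _+_; _*_; _-_; -_; _≤_; _<_; ∣_∣)
import Data.Rational.Properties as ℚₚ
import Data.Rational.Unnormalised as ℚᵘ
import Data.Rational.Unnormalised.Properties as ℚᵘₚ
open import Data.Rational.Solver using (module +-*-Solver)
open import Data.Sum using (_⊎_; inj₁; inj₂)
open import Data.Vec using (Vec; []; _∷_; lookup)
open import Function using (_∘_)
open import Relation.Binary.PropositionalEquality
open import Relation.Nullary using (Dec; yes; no; ¬_)
open import Relation.Nullary.Decidable using (¬?; _×-dec_)

open +-*-Solver using (solve; _:=_; _:+_; _:-_; _:*_; :-_; con)
open SemiringExp (CommutativeRing.semiring ℚₚ.+-*-commutativeRing) using (_^_; ^-homo-*)
open SemiringMult (CommutativeRing.semiring ℚₚ.+-*-commutativeRing) using (×-homo-+; ×1-homo-*) renaming (_×_ to _×ℚ_)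


-- A column is free if it holds no α: only free columns may receive a symbol
-- in a new top row.

-- Read a row from right to left. The diagonal box is α or β; each free column further left stays
-- empty, with weight u, or takes an α and is free no longer; a β can only be the leftmost symbol.
-- For f free columns these choices telescope to (α + βu)(u + α)^f, so u becomes u + α and T becomes
-- T + γ. A box of the third diagonal has exactly two boxes below it, the lower one on the main
-- diagonal. It can be filled only if neither is α, so three rows interact, and sums restricted to
-- tableaux whose last columns are free are needed in between. The recursion mixes sizes, orders and
-- values of u. It is not solved; the induction carries inequalities whose shape it preserves. The
-- differences of a bounded function cost a factor 2^R, which is regained because 1/R! is at most
-- 64/4^R. An assumption such as ∣ f ∣ < M holds for the approximating sequence of f(k) only from an
-- index that depends on k. Hence the truncation R is chosen first, then the size n, and the index m
-- last, when only finitely many k matter. The limit itself has to be constructed as a Cauchy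
-- sequence.

isFree : Cell → Bool
isFree alpha = false
isFree _     = true

next : ∀ {n} → Vec Cell (suc n) → Vec Bool n → Vec Bool (suc n)
next (x ∷ _) []      = isFree x ∷ []
next (x ∷ r)  (f ∷ φ) = (f ∧ isFree x) ∷ next r φ

free : ∀ {n} → Filling n → Vec Bool n
free []      = []
free (r ∷ S) = next r (free S)

-- The Boolean says whether everything to the left of the row is still empty,
-- so that a β may be placed.
data Fits : Bool → ∀ {n} → Vec Cell (suc n) → Vec Bool n → Set where
  lastα : ∀ {b} → Fits b (alpha ∷ []) []
  lastβ : Fits true (beta ∷ []) []
  skip  : ∀ {b n f} {r : Vec Cell (suc n)} {φ} → Fits b r φ → Fits b (empty ∷ r) (f ∷ φ)
  putα  : ∀ {b n} {r : Vec Cell (suc n)} {φ} → Fits false r φ → Fits b (alpha ∷ r) (true ∷ φ)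
  putβ  : ∀ {n} {r : Vec Cell (suc n)} {φ} → Fits false r φ → Fits true (beta ∷ r) (true ∷ φ)

data Tableau : ∀ {n} → Filling n → Set where
  []  : Tableau []
  _∷_ : ∀ {n} {r : Vec Cell (suc n)} {S : Filling n} → Fits true r (free S) → Tableau S → Tableau (r ∷ S)

-- Equivalence of the row-by-row and the boxwise description of tableaux.

fits-no-β : ∀ {n} {r : Vec Cell (suc n)} {φ} → Fits false r φ → ∀ j → lookup r j ≢ beta
fits-no-β (skip p) (suc j) = fits-no-β p j
fits-no-β (putα p) (suc j) = fits-no-β p j
fits-no-β lastα    zero    ()
fits-no-β (skip p) zero    ()
fits-no-β (putα p) zero    ()

fits-left : ∀ {b n} {r : Vec Cell (suc n)} {φ} → Fits b r φ →
            ∀ j k → lookup r k ≡ beta → toℕ j ℕ.< toℕ k → lookup r j ≡ empty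
fits-left (skip p) zero    (suc k) _ _       = refl
fits-left (skip p) (suc j) (suc k) e (s≤s l) = fits-left p j k e l
fits-left (putα p) _       (suc k) e _       = ⊥-elim (fits-no-β p k e)
fits-left (putβ p) _       (suc k) e _       = ⊥-elim (fits-no-β p k e)

fits-last : ∀ {b n} {r : Vec Cell (suc n)} {φ} → Fits b r φ → ∀ k → toℕ k ≡ n → lookup r k ≢ empty
fits-last lastα    zero    _ ()
fits-last lastβ    zero    _ ()
fits-last (skip p) (suc k) e = fits-last p k (ℕₚ.suc-injective e)
fits-last (putα p) (suc k) e = fits-last p k (ℕₚ.suc-injective e)
fits-last (putβ p) (suc k) e = fits-last p k (ℕₚ.suc-injective e)

fits-free : ∀ {b n} {r : Vec Cell (suc n)} {φ} → Fits b r φ →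
            ∀ k (j : Fin n) → toℕ k ≡ toℕ j → lookup r k ≢ empty → lookup φ j ≡ true
fits-free (skip p) zero    zero    _ ne = ⊥-elim (ne refl)
fits-free (putα p) zero    zero    _ _  = refl
fits-free (putβ p) zero    zero    _ _  = refl
fits-free (skip p) (suc k) (suc j) e ne = fits-free p k j (ℕₚ.suc-injective e) ne
fits-free (putα p) (suc k) (suc j) e ne = fits-free p k j (ℕₚ.suc-injective e) ne
fits-free (putβ p) (suc k) (suc j) e ne = fits-free p k j (ℕₚ.suc-injective e) ne

α≢∅ : alpha ≢ empty
α≢∅ ()

β≢∅ : beta ≢ empty
β≢∅ ()

-- Converse to `fits-no-β`, `fits-left`, `fits-last` and `fits-free`. The four conditions survive
-- removal of the first box, and a symbol in that box excludes every β to its right, since such a β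
-- would force the box to be empty.
fits : ∀ b {n} (r : Vec Cell (suc n)) (φ : Vec Bool n) →
       (b ≡ false → ∀ j → lookup r j ≢ beta) →
       (∀ j k → lookup r k ≡ beta → toℕ j ℕ.< toℕ k → lookup r j ≡ empty) →
       (∀ k → toℕ k ≡ n → lookup r k ≢ empty) →
       (∀ k (j : Fin n) → toℕ k ≡ toℕ j → lookup r k ≢ empty → lookup φ j ≡ true) →
       Fits b r φ
fits b     (empty ∷ []) []      _   _    last _  = ⊥-elim (last zero refl refl)
fits b     (alpha ∷ []) []      _   _    _    _  = lastα
fits true  (beta ∷ [])  []      _   _    _    _  = lastβ
fits false (beta ∷ [])  []      noβ _    _    _  = ⊥-elim (noβ refl zero refl)
fits b     (empty ∷ r)  (f ∷ φ) noβ left last fr = skip (fits b r φ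
  (λ e j → noβ e (suc j)) (λ j k e l → left (suc j) (suc k) e (s≤s l))
  (λ k e → last (suc k) (cong suc e)) (λ k j e → fr (suc k) (suc j) (cong suc e)))
fits b     (alpha ∷ r)  (f ∷ φ) noβ left last fr with refl ← fr zero zero refl (λ ()) = putα (fits false r φ
  (λ _ k e → α≢∅ (left zero (suc k) e (s≤s z≤n))) (λ j k e l → left (suc j) (suc k) e (s≤s l))
  (λ k e → last (suc k) (cong suc e)) (λ k j e → fr (suc k) (suc j) (cong suc e)))
fits false (beta ∷ r)   (f ∷ φ) noβ left last fr = ⊥-elim (noβ refl zero refl)
fits true  (beta ∷ r)   (f ∷ φ) noβ left last fr with refl ← fr zero zero refl (λ ()) = putβ (fits false r φ
  (λ _ k e → β≢∅ (left zero (suc k) e (s≤s z≤n))) (λ j k e l → left (suc j) (suc k) e (s≤s l))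
  (λ k e → last (suc k) (cong suc e)) (λ k j e → fr (suc k) (suc j) (cong suc e)))

next-free⁻ : ∀ {n} (r : Vec Cell (suc n)) φ j → lookup (next r φ) j ≡ true →
             lookup r j ≢ alpha × (∀ i → toℕ i ≡ toℕ j → lookup φ i ≡ true)
next-free⁻ (empty ∷ []) []         zero    e = (λ ()) , λ ()
next-free⁻ (beta ∷ [])  []         zero    e = (λ ()) , λ ()
next-free⁻ (empty ∷ r)  (true ∷ φ) zero    e = (λ ()) , λ { zero _ → refl }
next-free⁻ (beta ∷ r)   (true ∷ φ) zero    e = (λ ()) , λ { zero _ → refl }
next-free⁻ (alpha ∷ r)  (true ∷ φ) zero    ()
next-free⁻ (x ∷ r)      (f ∷ φ)    (suc j) e =
  let p , q = next-free⁻ r φ j e in p , λ { (suc i) h → q i (ℕₚ.suc-injective h) }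

next-free⁺ : ∀ {n} (r : Vec Cell (suc n)) φ j → lookup r j ≢ alpha →
             (∀ i → toℕ i ≡ toℕ j → lookup φ i ≡ true) → lookup (next r φ) j ≡ true
next-free⁺ (empty ∷ []) []      zero    _ _ = refl
next-free⁺ (beta ∷ [])  []      zero    _ _ = refl
next-free⁺ (alpha ∷ []) []      zero    p _ = ⊥-elim (p refl)
next-free⁺ (empty ∷ r)  (f ∷ φ) zero    _ q with refl ← q zero refl = refl
next-free⁺ (beta ∷ r)   (f ∷ φ) zero    _ q with refl ← q zero refl = refl
next-free⁺ (alpha ∷ r)  (f ∷ φ) zero    p _ = ⊥-elim (p refl)
next-free⁺ (x ∷ r)      (f ∷ φ) (suc j) p q = next-free⁺ r φ j p (λ i h → q (suc i) (cong suc h))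

box-column : ∀ {n} (i : Fin n) (j : Fin (n ℕ.∸ toℕ i)) → toℕ j ℕ.< n
box-column {n} i j = ℕₚ.<-≤-trans (Finₚ.toℕ<n j) (ℕₚ.m∸n≤m n (toℕ i))

free⁻ : ∀ {n} (S : Filling n) j → lookup (free S) j ≡ true → ∀ b → col b ≡ suc (toℕ j) → at S b ≢ alpha
free⁻ (r ∷ S) j e (zero , k) c with refl ← Finₚ.toℕ-injective (ℕₚ.suc-injective c) =
  proj₁ (next-free⁻ r (free S) j e)
free⁻ (r ∷ S) j e (suc i , k) c = free⁻ S (Fin.fromℕ< k<n)
  (proj₂ (next-free⁻ r (free S) j e) _ (trans (Finₚ.toℕ-fromℕ< k<n) (ℕₚ.suc-injective c)))
  (i , k) (cong suc (sym (Finₚ.toℕ-fromℕ< k<n)))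
  where k<n = box-column i k

free⁺ : ∀ {n} (S : Filling n) j → (∀ b → col b ≡ suc (toℕ j) → at S b ≢ alpha) → lookup (free S) j ≡ true
free⁺ (r ∷ S) j p = next-free⁺ r (free S) j (p (zero , j) refl)
  (λ i e → free⁺ S i (λ (k , l) c → p (suc k , l) (trans c (cong suc e))))

-- The column condition is read from the upper box: a filled box of the top row has no α below it,
-- so its column is free.
isTableau⇒tableau : ∀ {n} (S : Filling n) → IsTableau S → Tableau S
isTableau⇒tableau []      t = []
isTableau⇒tableau {suc n} (r ∷ S) t = fits true r (free S) (λ ())
    (λ j k e l → left-of-β (zero , k) (zero , j) e refl (s≤s l))
    (λ k e → diagonal (zero , k) (cong (λ m → suc (suc m)) e))
    (λ k j e ne → free⁺ S j (λ (i , l) c ≡α → ne (above-α (suc i , l) (zero , k) ≡α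
      (trans (cong suc e) (sym c)) (s≤s (s≤s z≤n)))))
  ∷ isTableau⇒tableau S (record
    { above-α   = λ (i , j) (k , l) e c h → above-α (suc i , j) (suc k , l) e c (s≤s h)
    ; left-of-β = λ (i , j) (k , l) e c h → left-of-β (suc i , j) (suc k , l) e (cong suc c) h
    ; diagonal  = λ (i , j) e → diagonal (suc i , j) (cong suc e) })
  where open IsTableau t

tableau⇒isTableau : ∀ {n} {S : Filling n} → Tableau S → IsTableau S
tableau⇒isTableau [] = record { above-α = λ (); left-of-β = λ (); diagonal = λ () }
tableau⇒isTableau {suc n} {r ∷ S} (p ∷ t) = record { above-α = above ; left-of-β = left ; diagonal = diag }
  where
  open IsTableau (tableau⇒isTableau t)
  above : ∀ b c → at (r ∷ S) b ≡ alpha → col c ≡ col b → row c ℕ.< row b → at (r ∷ S) c ≡ empty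
  above (zero , j)  (_ , l)     _ _ (s≤s ())
  above (suc i , j) (suc k , l) e c (s≤s h) = above-α (i , j) (k , l) e c h
  above (suc i , j) (zero , l)  e c _ with lookup r l ≟ᶜ empty
  ... | yes ≡∅ = ≡∅
  ... | no  ≢∅ = ⊥-elim (free⁻ S (Fin.fromℕ< j<n)
    (fits-free p l _ (trans (ℕₚ.suc-injective c) (sym (Finₚ.toℕ-fromℕ< j<n))) ≢∅)
    (i , j) (cong suc (sym (Finₚ.toℕ-fromℕ< j<n))) e)
    where j<n = box-column i j
  left : ∀ b c → at (r ∷ S) b ≡ beta → row c ≡ row b → col c ℕ.< col b → at (r ∷ S) c ≡ empty
  left (zero , j)  (zero , l)  e _ (s≤s h) = fits-left p l j e h
  left (suc i , j) (suc k , l) e c h = left-of-β (i , j) (k , l) e (ℕₚ.suc-injective c) h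
  diag : ∀ b → row b ℕ.+ col b ≡ suc (suc n) → at (r ∷ S) b ≢ empty
  diag (zero , j)  e = fits-last p j (ℕₚ.suc-injective (ℕₚ.suc-injective e))
  diag (suc i , j) e = diagonal (i , j) (ℕₚ.suc-injective e)

-- Counting boxes row by row

module _ {A B : Set} {P : B → Set} (P? : ∀ b → Dec (P b)) (f : A → B) where
  length-filter-map : ∀ xs → length (filter P? (List.map f xs)) ≡ length (filter (P? ∘ f) xs)
  length-filter-map []       = refl
  length-filter-map (x ∷ xs) with P? (f x)
  ... | yes _ = cong suc (length-filter-map xs)
  ... | no  _ = length-filter-map xs

length-filter-cong : ∀ {A : Set} {P Q : A → Set} (P? : ∀ a → Dec (P a)) (Q? : ∀ a → Dec (Q a)) →
                     (∀ a → P a → Q a) → (∀ a → Q a → P a) →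
                     ∀ xs → length (filter P? xs) ≡ length (filter Q? xs)
length-filter-cong P? Q? to from []       = refl
length-filter-cong P? Q? to from (x ∷ xs) with P? x | Q? x
... | yes _ | yes _ = cong suc (length-filter-cong P? Q? to from xs)
... | no  _ | no  _ = length-filter-cong P? Q? to from xs
... | yes p | no ¬q = ⊥-elim (¬q (to x p))
... | no ¬p | yes q = ⊥-elim (¬p (from x q))

countFin : ∀ n {P : Fin n → Set} → (∀ j → Dec (P j)) → ℕ
countFin n P? = length (filter P? (allFin n))

countFin-suc : ∀ {n} {P : Fin (suc n) → Set} (P? : ∀ j → Dec (P j)) →
               countFin (suc n) P? ≡ length (filter P? (zero ∷ [])) ℕ.+ countFin n (P? ∘ suc)
countFin-suc {n} P? = begin
  length (filter P? (zero ∷ List.tabulate suc))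
    ≡⟨ cong (length ∘ filter P? ∘ (zero ∷_)) (sym (Listₚ.map-tabulate (λ j → j) suc)) ⟩
  length (filter P? ((zero ∷ []) ++ List.map suc (allFin n)))
    ≡⟨ cong length (Listₚ.filter-++ P? (zero ∷ []) (List.map suc (allFin n))) ⟩
  length (filter P? (zero ∷ []) ++ filter P? (List.map suc (allFin n)))
    ≡⟨ Listₚ.length-++ (filter P? (zero ∷ [])) ⟩
  length (filter P? (zero ∷ [])) ℕ.+ length (filter P? (List.map suc (allFin n)))
    ≡⟨ cong (length (filter P? (zero ∷ [])) ℕ.+_) (length-filter-map P? suc (allFin n)) ⟩
  length (filter P? (zero ∷ [])) ℕ.+ countFin n (P? ∘ suc) ∎
  where open ≡-Reasoning

below : ∀ {n} → Box n → Box (suc n)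
below (i , j) = suc i , j

boxes-suc : ∀ n → boxes (suc n) ≡ List.map (zero ,_) (allFin (suc n)) ++ List.map below (boxes n)
boxes-suc n = cong (List.map (zero ,_) (allFin (suc n)) ++_) (begin
  concatMap g (List.tabulate suc)
    ≡⟨ cong (concatMap g) (sym (Listₚ.map-tabulate (λ j → j) suc)) ⟩
  concatMap g (List.map suc (allFin n))
    ≡⟨ Listₚ.concatMap-map g suc (allFin n) ⟩
  concatMap (g ∘ suc) (allFin n)
    ≡⟨ Listₚ.concatMap-cong (λ i → Listₚ.map-∘ (allFin (n ℕ.∸ toℕ i))) (allFin n) ⟩
  concatMap (List.map below ∘ λ i → List.map (i ,_) (allFin (n ℕ.∸ toℕ i))) (allFin n)
    ≡⟨ sym (Listₚ.map-concatMap below (λ i → List.map (i ,_) (allFin (n ℕ.∸ toℕ i))) (allFin n)) ⟩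
  List.map below (boxes n) ∎)
  where
  open ≡-Reasoning
  g : Fin (suc n) → List (Box (suc n))
  g i = List.map (i ,_) (allFin (suc n ℕ.∸ toℕ i))

count-suc : ∀ {n} {P : Box (suc n) → Set} (P? : ∀ b → Dec (P b)) →
            count P? ≡ countFin (suc n) (λ j → P? (zero , j)) ℕ.+ count (P? ∘ below)
count-suc {n} P? = begin
  length (filter P? (boxes (suc n)))
    ≡⟨ cong (length ∘ filter P?) (boxes-suc n) ⟩
  length (filter P? (top ++ List.map below (boxes n)))
    ≡⟨ cong length (Listₚ.filter-++ P? top (List.map below (boxes n))) ⟩
  length (filter P? top ++ filter P? (List.map below (boxes n)))
    ≡⟨ Listₚ.length-++ (filter P? top) ⟩
  length (filter P? top) ℕ.+ length (filter P? (List.map below (boxes n)))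
    ≡⟨ cong₂ ℕ._+_ (length-filter-map P? (zero ,_) (allFin (suc n))) (length-filter-map P? below (boxes n)) ⟩
  countFin (suc n) (λ j → P? (zero , j)) ℕ.+ count (P? ∘ below) ∎
  where
  open ≡-Reasoning
  top = List.map (zero ,_) (allFin (suc n))

occurrences : ∀ {n} → Cell → Vec Cell n → ℕ
occurrences {n} x r = countFin n (λ j → lookup r j ≟ᶜ x)

occurrences-∷ : ∀ {n} x y (r : Vec Cell n) →
                occurrences x (y ∷ r) ≡ length (filter (_≟ᶜ x) (y ∷ [])) ℕ.+ occurrences x r
occurrences-∷ x y r = trans (countFin-suc (λ j → lookup (y ∷ r) j ≟ᶜ x))
  (cong (ℕ._+ occurrences x r) (sym (length-filter-map (_≟ᶜ x) (lookup (y ∷ r)) (zero ∷ []))))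

isFilled : Cell → ℕ
isFilled empty = 0
isFilled _     = 1

-- Contribution of a top row to X³
mark : ∀ {n} → Vec Cell n → ℕ
mark []                   = 0
mark (x ∷ [])             = 0
mark (x ∷ y ∷ [])         = 0
mark (x ∷ y ∷ z ∷ [])     = isFilled x
mark (x ∷ y ∷ z ∷ w ∷ r)  = mark (y ∷ z ∷ w ∷ r)

-- The top row of a staircase of size `m` has length `m`, and its box with index j, counted from 0,
-- has row + col = j + 2. The third diagonal is therefore j + 3 = `m`.
third? : ∀ m (r : Vec Cell m) (j : Fin m) → Dec ((suc (suc (suc (toℕ j))) ≡ m) × lookup r j ≢ empty)
third? m r j = (suc (suc (suc (toℕ j))) ℕ.≟ m) ×-dec ¬? (lookup r j ≟ᶜ empty)

third-step : ∀ {n} x (r : Vec Cell n) →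
             countFin (suc n) (third? (suc n) (x ∷ r))
             ≡ length (filter (third? (suc n) (x ∷ r)) (zero ∷ [])) ℕ.+ countFin n (third? n r)
third-step {n} x r = trans (countFin-suc (third? (suc n) (x ∷ r)))
  (cong (length (filter (third? (suc n) (x ∷ r)) (zero ∷ [])) ℕ.+_)
    (length-filter-cong (third? (suc n) (x ∷ r) ∘ suc) (third? n r)
      (λ _ (p , q) → ℕₚ.suc-injective p , q) (λ _ (p , q) → cong suc p , q) (allFin n)))

third-count : ∀ {n} (r : Vec Cell n) → countFin n (third? n r) ≡ mark r
third-count []                  = refl
third-count (x ∷ [])            = refl
third-count (x ∷ y ∷ [])        = refl
third-count (empty ∷ y ∷ z ∷ []) = refl
third-count (alpha ∷ y ∷ z ∷ []) = refl
third-count (beta ∷ y ∷ z ∷ [])  = refl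
third-count (x ∷ y ∷ z ∷ w ∷ r) = trans (third-step x (y ∷ z ∷ w ∷ r)) (third-count (y ∷ z ∷ w ∷ r))

X³-∷ : ∀ {n} (r : Vec Cell (suc n)) (S : Filling n) → X³ (r ∷ S) ≡ mark r ℕ.+ X³ S
X³-∷ {n} r S = trans
  (count-suc (λ b → (suc (row b ℕ.+ col b) ℕ.≟ suc n) ×-dec ¬? (at (r ∷ S) b ≟ᶜ empty)))
  (cong₂ ℕ._+_
    (third-count r)
    (length-filter-cong
      (λ (i , j) → (suc (row {suc n} (suc i , j) ℕ.+ col {suc n} (suc i , j)) ℕ.≟ suc n) ×-dec ¬? (at S (i , j) ≟ᶜ empty))
      (λ b → (suc (row b ℕ.+ col b) ℕ.≟ n) ×-dec ¬? (at S b ≟ᶜ empty))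
      (λ _ (p , q) → ℕₚ.suc-injective p , q) (λ _ (p , q) → cong suc p , q) (boxes n)))

-- Finite sums

Σᴸ : ∀ {A : Set} → List A → (A → ℚ) → ℚ
Σᴸ xs f = List.foldr (λ x s → f x + s) 0ℚ xs

module _ {A : Set} where
  Σᴸ-cong : ∀ (xs : List A) {f g} → (∀ x → f x ≡ g x) → Σᴸ xs f ≡ Σᴸ xs g
  Σᴸ-cong []       h = refl
  Σᴸ-cong (x ∷ xs) h = cong₂ _+_ (h x) (Σᴸ-cong xs h)

  Σᴸ-++ : ∀ (xs ys : List A) f → Σᴸ (xs ++ ys) f ≡ Σᴸ xs f + Σᴸ ys f
  Σᴸ-++ []       ys f = sym (ℚₚ.+-identityˡ (Σᴸ ys f))
  Σᴸ-++ (x ∷ xs) ys f = trans (cong (f x +_) (Σᴸ-++ xs ys f)) (sym (ℚₚ.+-assoc (f x) (Σᴸ xs f) (Σᴸ ys f)))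

  Σᴸ-+ : ∀ (xs : List A) f g → Σᴸ xs (λ x → f x + g x) ≡ Σᴸ xs f + Σᴸ xs g
  Σᴸ-+ []       f g = refl
  Σᴸ-+ (x ∷ xs) f g = trans (cong ((f x + g x) +_) (Σᴸ-+ xs f g))
    (solve 4 (λ a b c d → (a :+ b) :+ (c :+ d) := (a :+ c) :+ (b :+ d)) refl (f x) (g x) (Σᴸ xs f) (Σᴸ xs g))

  Σᴸ-* : ∀ (xs : List A) c f → Σᴸ xs (λ x → c * f x) ≡ c * Σᴸ xs f
  Σᴸ-* []       c f = sym (ℚₚ.*-zeroʳ c)
  Σᴸ-* (x ∷ xs) c f = trans (cong (c * f x +_) (Σᴸ-* xs c f)) (sym (ℚₚ.*-distribˡ-+ c (f x) (Σᴸ xs f)))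

  Σᴸ-0 : ∀ (xs : List A) → Σᴸ xs (λ _ → 0ℚ) ≡ 0ℚ
  Σᴸ-0 []       = refl
  Σᴸ-0 (x ∷ xs) = trans (ℚₚ.+-identityˡ _) (Σᴸ-0 xs)

  Σᴸ-map : ∀ {B : Set} (g : B → A) ys f → Σᴸ (List.map g ys) f ≡ Σᴸ ys (f ∘ g)
  Σᴸ-map g []       f = refl
  Σᴸ-map g (y ∷ ys) f = cong (f (g y) +_) (Σᴸ-map g ys f)

  -- Lets a sum over tableaux become one over all fillings, with a weight that vanishes off the
  -- tableaux. Only the latter factors into sums over rows.
  Σᴸ-filter : ∀ {P : A → Set} (P? : ∀ a → Dec (P a)) f g → (∀ a → P a → f a ≡ g a) → (∀ a → ¬ P a → g a ≡ 0ℚ) →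
              ∀ xs → Σᴸ (filter P? xs) f ≡ Σᴸ xs g
  Σᴸ-filter P? f g agree vanish []       = refl
  Σᴸ-filter P? f g agree vanish (x ∷ xs) with P? x
  ... | yes p = cong₂ _+_ (agree x p) (Σᴸ-filter P? f g agree vanish xs)
  ... | no ¬p = begin
    Σᴸ (filter P? xs) f ≡⟨ Σᴸ-filter P? f g agree vanish xs ⟩
    Σᴸ xs g             ≡⟨ sym (ℚₚ.+-identityˡ (Σᴸ xs g)) ⟩
    0ℚ + Σᴸ xs g        ≡⟨ cong (_+ Σᴸ xs g) (sym (vanish x ¬p)) ⟩
    g x + Σᴸ xs g       ∎
    where open ≡-Reasoning

Σᴸ-swap : ∀ {A B : Set} (xs : List A) (ys : List B) (f : A → B → ℚ) →
          Σᴸ xs (λ x → Σᴸ ys (f x)) ≡ Σᴸ ys (λ y → Σᴸ xs (λ x → f x y))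
Σᴸ-swap []       ys f = sym (Σᴸ-0 ys)
Σᴸ-swap (x ∷ xs) ys f = trans (cong (Σᴸ ys (f x) +_) (Σᴸ-swap xs ys f))
  (sym (Σᴸ-+ ys (f x) (λ y → Σᴸ xs (λ x → f x y))))

Σᴸ-cartesian : ∀ {A B C : Set} (_∙_ : A → B → C) xs ys (f : C → ℚ) →
               Σᴸ (cartesianProductWith _∙_ xs ys) f ≡ Σᴸ xs (λ x → Σᴸ ys (λ y → f (x ∙ y)))
Σᴸ-cartesian _∙_ []       ys f = refl
Σᴸ-cartesian _∙_ (x ∷ xs) ys f = trans (Σᴸ-++ (List.map (x ∙_) ys) _ f)
  (cong₂ _+_ (Σᴸ-map (x ∙_) ys f) (Σᴸ-cartesian _∙_ xs ys f))

Δ : (ℕ → ℚ) → ℕ → ℚ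
Δ h k = h (suc k) - h k

⟦_⟧ : ℕ → ℚ
⟦ n ⟧ = n ×ℚ 1ℚ

-- A row has at most one box on the third diagonal, so `mark r` is 0 or 1 and the expansion in
-- differences stops after one term.
mark-Δ : ∀ (h : ℕ → ℚ) k {n} (r : Vec Cell n) → h (mark r ℕ.+ k) ≡ h k + ⟦ mark r ⟧ * Δ h k
mark-Δ h k = go
  where
  none : h k ≡ h k + 0ℚ * Δ h k
  none = solve 2 (λ a d → a := a :+ con 0ℚ :* d) refl (h k) (Δ h k)
  one : h (suc k) ≡ h k + 1ℚ * Δ h k
  one = solve 2 (λ a b → b := a :+ con 1ℚ :* (b :- a)) refl (h k) (h (suc k))
  go : ∀ {n} (r : Vec Cell n) → h (mark r ℕ.+ k) ≡ h k + ⟦ mark r ⟧ * Δ h k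
  go []                   = none
  go (x ∷ [])             = none
  go (x ∷ y ∷ [])         = none
  go (empty ∷ y ∷ z ∷ []) = none
  go (alpha ∷ y ∷ z ∷ []) = one
  go (beta ∷ y ∷ z ∷ [])  = one
  go (x ∷ y ∷ z ∷ w ∷ r)  = go (y ∷ z ∷ w ∷ r)

-- Weighted enumeration of tableaux with rational parameters.

module Weighted (α β : ℚ) where

  keep : ℚ → Bool → ℚ
  keep p f = if f then p else 0ℚ

  -- `Fits` turned into a weight: a forbidden symbol or an empty diagonal box contributes a factor
  -- 0. After any symbol the flag is `false`, because a β further right would need that box to be
  -- empty.
  ρ : Bool → ∀ {n} → Vec Bool n → Vec Cell (suc n) → ℚ
  ρ b []      (empty ∷ _) = 0ℚ
  ρ b []      (alpha ∷ _) = α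
  ρ b []      (beta ∷ _)  = keep β b
  ρ b (f ∷ φ) (empty ∷ r) = ρ b φ r
  ρ b (f ∷ φ) (alpha ∷ r) = keep α f * ρ false φ r
  ρ b (f ∷ φ) (beta ∷ r)  = keep (keep β f) b * ρ false φ r

  fits⇒ρ : ∀ {b n r} {φ : Vec Bool n} → Fits b r φ → ρ b φ r ≡ α ^ occurrences alpha r * β ^ occurrences beta r
  fits⇒ρ lastα = solve 1 (λ a → a := (a :* con 1ℚ) :* con 1ℚ) refl α
  fits⇒ρ lastβ = solve 1 (λ b → b := con 1ℚ :* (b :* con 1ℚ)) refl β
  fits⇒ρ {r = empty ∷ r} (skip p) = trans (fits⇒ρ p)
    (sym (cong₂ (λ i j → α ^ i * β ^ j) (occurrences-∷ alpha empty r) (occurrences-∷ beta empty r)))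
  fits⇒ρ {r = alpha ∷ r} (putα p) = trans (cong (α *_) (fits⇒ρ p)) (trans
    (sym (ℚₚ.*-assoc α (α ^ occurrences alpha r) (β ^ occurrences beta r)))
    (sym (cong₂ (λ i j → α ^ i * β ^ j) (occurrences-∷ alpha alpha r) (occurrences-∷ beta alpha r))))
  fits⇒ρ {r = beta ∷ r} (putβ p) = trans (cong (β *_) (fits⇒ρ p)) (trans
    (solve 3 (λ b x y → b :* (x :* y) := x :* (b :* y)) refl β (α ^ occurrences alpha r) (β ^ occurrences beta r))
    (sym (cong₂ (λ i j → α ^ i * β ^ j) (occurrences-∷ alpha beta r) (occurrences-∷ beta beta r))))

  *-zero⊎ : ∀ {P Q : Set} p {q} → (P → Q) → q ≡ 0ℚ ⊎ P → p * q ≡ 0ℚ ⊎ Q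
  *-zero⊎ p g (inj₁ refl) = inj₁ (ℚₚ.*-zeroʳ p)
  *-zero⊎ p g (inj₂ x)    = inj₂ (g x)

  -- A disjunction that need not be exclusive: α and β are arbitrary rationals here, so a fitting
  -- row may also have weight 0.
  ρ-zero⊎fits : ∀ b {n} (φ : Vec Bool n) r → ρ b φ r ≡ 0ℚ ⊎ Fits b r φ
  ρ-zero⊎fits b     []          (empty ∷ [])  = inj₁ refl
  ρ-zero⊎fits b     []          (alpha ∷ []) = inj₂ lastα
  ρ-zero⊎fits true  []          (beta ∷ [])  = inj₂ lastβ
  ρ-zero⊎fits false []          (beta ∷ [])  = inj₁ refl
  ρ-zero⊎fits b     (f ∷ φ)     (empty ∷ r) with ρ-zero⊎fits b φ r
  ... | inj₁ e = inj₁ e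
  ... | inj₂ p = inj₂ (skip p)
  ρ-zero⊎fits b     (true ∷ φ)  (alpha ∷ r) = *-zero⊎ α putα (ρ-zero⊎fits false φ r)
  ρ-zero⊎fits b     (false ∷ φ) (alpha ∷ r) = inj₁ (ℚₚ.*-zeroˡ (ρ false φ r))
  ρ-zero⊎fits true  (true ∷ φ)  (beta ∷ r)  = *-zero⊎ β putβ (ρ-zero⊎fits false φ r)
  ρ-zero⊎fits true  (false ∷ φ) (beta ∷ r)  = inj₁ (ℚₚ.*-zeroˡ (ρ false φ r))
  ρ-zero⊎fits false (f ∷ φ)     (beta ∷ r)  = inj₁ (ℚₚ.*-zeroˡ (ρ false φ r))

  W : ∀ {n} → Filling n → ℚ
  W []      = 1ℚ
  W (r ∷ S) = ρ true (free S) r * W S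

  W-zero⊎tableau : ∀ {n} (S : Filling n) → W S ≡ 0ℚ ⊎ Tableau S
  W-zero⊎tableau []      = inj₂ []
  W-zero⊎tableau (r ∷ S) with ρ-zero⊎fits true (free S) r
  ... | inj₁ e = inj₁ (trans (cong (_* W S) e) (ℚₚ.*-zeroˡ (W S)))
  ... | inj₂ p = *-zero⊎ (ρ true (free S) r) (p ∷_) (W-zero⊎tableau S)

  tableau⇒W : ∀ {n} {S : Filling n} → Tableau S → W S ≡ α ^ Nα S * β ^ Nβ S
  tableau⇒W [] = refl
  tableau⇒W {suc n} {r ∷ S} (p ∷ t) = begin
    ρ true (free S) r * W S
      ≡⟨ cong₂ _*_ (fits⇒ρ p) (tableau⇒W t) ⟩
    (α ^ occurrences alpha r * β ^ occurrences beta r) * (α ^ Nα S * β ^ Nβ S)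
      ≡⟨ solve 4 (λ a b c d → (a :* b) :* (c :* d) := (a :* c) :* (b :* d)) refl
           (α ^ occurrences alpha r) (β ^ occurrences beta r) (α ^ Nα S) (β ^ Nβ S) ⟩
    (α ^ occurrences alpha r * α ^ Nα S) * (β ^ occurrences beta r * β ^ Nβ S)
      ≡⟨ sym (cong₂ _*_ (^-homo-* α (occurrences alpha r) (Nα S)) (^-homo-* β (occurrences beta r) (Nβ S))) ⟩
    α ^ (occurrences alpha r ℕ.+ Nα S) * β ^ (occurrences beta r ℕ.+ Nβ S)
      ≡⟨ sym (cong₂ (λ i j → α ^ i * β ^ j)
           (count-suc (λ b → at (r ∷ S) b ≟ᶜ alpha)) (count-suc (λ b → at (r ∷ S) b ≟ᶜ beta))) ⟩
    α ^ Nα (r ∷ S) * β ^ Nβ (r ∷ S) ∎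
    where open ≡-Reasoning

  Σᵀ : ∀ n → (Filling n → ℚ) → ℚ
  Σᵀ n F = Σᴸ (fillings n) (λ S → W S * F S)

  Σ-tableaux : ∀ n (F : Filling n → ℚ) →
               Σᴸ (tableaux n) (λ S → (α ^ Nα S * β ^ Nβ S) * F S) ≡ Σᵀ n F
  Σ-tableaux n F = Σᴸ-filter isTableau? _ _
    (λ S t → cong (_* F S) (sym (tableau⇒W (isTableau⇒tableau S t)))) vanish (fillings n)
    where
    vanish : ∀ S → ¬ IsTableau S → W S * F S ≡ 0ℚ
    vanish S ¬t with W-zero⊎tableau S
    ... | inj₁ e = trans (cong (_* F S) e) (ℚₚ.*-zeroˡ (F S))
    ... | inj₂ t = ⊥-elim (¬t (tableau⇒isTableau t))

  Σᵀ-cong : ∀ n {F G : Filling n → ℚ} → (∀ S → F S ≡ G S) → Σᵀ n F ≡ Σᵀ n G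
  Σᵀ-cong n h = Σᴸ-cong (fillings n) (λ S → cong (W S *_) (h S))

  Σᵀ-+ : ∀ n (F G : Filling n → ℚ) → Σᵀ n (λ S → F S + G S) ≡ Σᵀ n F + Σᵀ n G
  Σᵀ-+ n F G = trans (Σᴸ-cong (fillings n) (λ S → ℚₚ.*-distribˡ-+ (W S) (F S) (G S)))
    (Σᴸ-+ (fillings n) (λ S → W S * F S) (λ S → W S * G S))

  Σᵀ-* : ∀ n c (F : Filling n → ℚ) → Σᵀ n (λ S → c * F S) ≡ c * Σᵀ n F
  Σᵀ-* n c F = trans (Σᴸ-cong (fillings n) (λ S → solve 3 (λ w c f → w :* (c :* f) := c :* (w :* f)) refl (W S) c (F S)))
    (Σᴸ-* (fillings n) c (λ S → W S * F S))

  -- Sums over a single row.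

  R : Bool → ∀ {n} → Vec Bool n → (Vec Cell (suc n) → ℚ) → ℚ
  R b {n} φ F = Σᴸ (rows (suc n)) (λ r → ρ b φ r * F r)

  R-cong : ∀ b {n} (φ : Vec Bool n) {F G} → (∀ r → F r ≡ G r) → R b φ F ≡ R b φ G
  R-cong b {n} φ h = Σᴸ-cong (rows (suc n)) (λ r → cong (ρ b φ r *_) (h r))

  R-+ : ∀ b {n} (φ : Vec Bool n) F G → R b φ (λ r → F r + G r) ≡ R b φ F + R b φ G
  R-+ b {n} φ F G = trans (Σᴸ-cong (rows (suc n)) (λ r → ℚₚ.*-distribˡ-+ (ρ b φ r) (F r) (G r)))
    (Σᴸ-+ (rows (suc n)) (λ r → ρ b φ r * F r) (λ r → ρ b φ r * G r))

  R-* : ∀ b {n} (φ : Vec Bool n) c F → R b φ (λ r → c * F r) ≡ c * R b φ F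
  R-* b {n} φ c F = trans (Σᴸ-cong (rows (suc n)) (λ r → solve 3 (λ w c f → w :* (c :* f) := c :* (w :* f))
        refl (ρ b φ r) c (F r)))
    (Σᴸ-* (rows (suc n)) c (λ r → ρ b φ r * F r))

  R-0 : ∀ b {n} (φ : Vec Bool n) → R b φ (λ _ → 0ℚ) ≡ 0ℚ
  R-0 b {n} φ = trans (Σᴸ-cong (rows (suc n)) (λ r → ℚₚ.*-zeroʳ (ρ b φ r))) (Σᴸ-0 (rows (suc n)))

  Σᵀ-suc : ∀ n (F : Filling (suc n) → ℚ) → Σᵀ (suc n) F ≡ Σᵀ n (λ S → R true (free S) (λ r → F (r ∷ S)))
  Σᵀ-suc n F = begin
    Σᴸ (fillings (suc n)) (λ S → W S * F S)
      ≡⟨ Σᴸ-cartesian _∷_ (rows (suc n)) (fillings n) (λ S → W S * F S) ⟩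
    Σᴸ (rows (suc n)) (λ r → Σᴸ (fillings n) (λ S → (ρ true (free S) r * W S) * F (r ∷ S)))
      ≡⟨ Σᴸ-swap (rows (suc n)) (fillings n) (λ r S → (ρ true (free S) r * W S) * F (r ∷ S)) ⟩
    Σᴸ (fillings n) (λ S → Σᴸ (rows (suc n)) (λ r → (ρ true (free S) r * W S) * F (r ∷ S)))
      ≡⟨ Σᴸ-cong (fillings n) (λ S → trans
           (Σᴸ-cong (rows (suc n)) (λ r →
             solve 3 (λ p w f → (p :* w) :* f := w :* (p :* f)) refl (ρ true (free S) r) (W S) (F (r ∷ S))))
           (Σᴸ-* (rows (suc n)) (W S) (λ r → ρ true (free S) r * F (r ∷ S)))) ⟩
    Σᵀ n (λ S → R true (free S) (λ r → F (r ∷ S))) ∎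
    where open ≡-Reasoning

  R-[] : ∀ b F → R b [] F ≡ α * F (alpha ∷ []) + keep β b * F (beta ∷ [])
  R-[] b F = solve 4 (λ e a k f → con 0ℚ :* e :+ (a :+ (k :* f :+ con 0ℚ)) := a :+ k :* f) refl
    (F (empty ∷ [])) (α * F (alpha ∷ [])) (keep β b) (F (beta ∷ []))

  R-∷ : ∀ b {n} f (φ : Vec Bool n) F →
        R b (f ∷ φ) F ≡ R b φ (F ∘ (empty ∷_))
                      + (keep α f * R false φ (F ∘ (alpha ∷_)) + keep (keep β f) b * R false φ (F ∘ (beta ∷_)))
  R-∷ b {n} f φ F = begin
    Σᴸ (rows (suc (suc n))) G
      ≡⟨ Σᴸ-cartesian _∷_ cells (rows (suc n)) G ⟩
    Σᴸ cells (λ x → Σᴸ (rows (suc n)) (λ r → G (x ∷ r)))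
      ≡⟨ cong (λ z → R b φ (F ∘ (empty ∷_)) + z) (cong₂ _+_ (pull (keep α f) alpha)
           (trans (ℚₚ.+-identityʳ _) (pull (keep (keep β f) b) beta))) ⟩
    R b φ (F ∘ (empty ∷_))
      + (keep α f * R false φ (F ∘ (alpha ∷_)) + keep (keep β f) b * R false φ (F ∘ (beta ∷_))) ∎
    where
    open ≡-Reasoning
    G : Vec Cell (suc (suc n)) → ℚ
    G r = ρ b (f ∷ φ) r * F r
    pull : ∀ c x → Σᴸ (rows (suc n)) (λ r → (c * ρ false φ r) * F (x ∷ r)) ≡ c * R false φ (F ∘ (x ∷_))
    pull c x = trans (Σᴸ-cong (rows (suc n)) (λ r → ℚₚ.*-assoc c (ρ false φ r) (F (x ∷ r))))
      (Σᴸ-* (rows (suc n)) c (λ r → ρ false φ r * F (x ∷ r)))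

  -- Σ over the rows of the weight u^(free columns), possibly restricted: the
  -- sums with and without β have this shape, in which κ picks up u + α and ε
  -- picks up u for every further free column.
  record RowSum (u : ℚ) {n} (φ : Vec Bool n) (F : Vec Cell (suc n) → ℚ) (κ ε : ℚ) : Set where
    constructor rowSum
    field
      withβ : R true φ F ≡ (α + β * u) * κ + ε
      noβ   : R false φ F ≡ α * κ

  fac : ℚ → Bool → ℚ
  fac u f = if f then u else 1ℚ

  -- The telescoping step. A free column on the left is empty, α or β, and a symbol in it forbids β
  -- further right. The total is u((α + βu)κ + ε) + α·ακ + βu·ακ, in which the last two terms make
  -- up (α + βu)ακ.
  RowSum-∷ : ∀ {u n f} {φ : Vec Bool n} {F F′ κ ε} →
             (∀ x r → F′ (x ∷ r) ≡ fac u (f ∧ isFree x) * F r) →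
             RowSum u φ F κ ε → RowSum u (f ∷ φ) F′ (fac (u + α) f * κ) (fac u f * ε)
  RowSum-∷ {u} {f = f} {φ} {F} {F′} {κ} {ε} step (rowSum p q) = rowSum
    (trans (R-∷ true f φ F′) (trans (cong₂ _+_ (fst true p) (cong₂ (λ a b → keep α f * a + keep β f * b) sec thd)) (alg₁ f)))
    (trans (R-∷ false f φ F′) (trans (cong₂ _+_ (fst false q) (cong₂ (λ a b → keep α f * a + 0ℚ * b) sec thd)) (alg₂ f)))
    where
    fst : ∀ b {v} → R b φ F ≡ v → R b φ (F′ ∘ (empty ∷_)) ≡ fac u (f ∧ true) * v
    fst b h = trans (R-cong b φ (step empty)) (trans (R-* b φ (fac u (f ∧ true)) F) (cong (fac u (f ∧ true) *_) h))
    sec : R false φ (F′ ∘ (alpha ∷_)) ≡ fac u (f ∧ false) * (α * κ)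
    sec = trans (R-cong false φ (step alpha)) (trans (R-* false φ (fac u (f ∧ false)) F) (cong (fac u (f ∧ false) *_) q))
    thd : R false φ (F′ ∘ (beta ∷_)) ≡ fac u (f ∧ true) * (α * κ)
    thd = trans (R-cong false φ (step beta)) (trans (R-* false φ (fac u (f ∧ true)) F) (cong (fac u (f ∧ true) *_) q))
    alg₁ : ∀ f → fac u (f ∧ true) * ((α + β * u) * κ + ε)
                 + (keep α f * (fac u (f ∧ false) * (α * κ)) + keep β f * (fac u (f ∧ true) * (α * κ)))
               ≡ (α + β * u) * (fac (u + α) f * κ) + fac u f * ε
    alg₁ true  = solve 5 (λ a b u k z → u :* ((a :+ b :* u) :* k :+ z) :+ (a :* (con 1ℚ :* (a :* k)) :+ b :* (u :* (a :* k)))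
                   := (a :+ b :* u) :* ((u :+ a) :* k) :+ u :* z) refl α β u κ ε
    alg₁ false = solve 5 (λ a b u k z → con 1ℚ :* ((a :+ b :* u) :* k :+ z)
                     :+ (con 0ℚ :* (con 1ℚ :* (a :* k)) :+ con 0ℚ :* (con 1ℚ :* (a :* k)))
                   := (a :+ b :* u) :* (con 1ℚ :* k) :+ con 1ℚ :* z) refl α β u κ ε
    alg₂ : ∀ f → fac u (f ∧ true) * (α * κ)
                 + (keep α f * (fac u (f ∧ false) * (α * κ)) + 0ℚ * (fac u (f ∧ true) * (α * κ)))
               ≡ α * (fac (u + α) f * κ)
    alg₂ true  = solve 3 (λ a u k → u :* (a :* k) :+ (a :* (con 1ℚ :* (a :* k)) :+ con 0ℚ :* (u :* (a :* k)))
                   := a :* ((u :+ a) :* k)) refl α u κ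
    alg₂ false = solve 2 (λ a k → con 1ℚ :* (a :* k)
                     :+ (con 0ℚ :* (con 1ℚ :* (a :* k)) :+ con 0ℚ :* (con 1ℚ :* (a :* k)))
                   := a :* (con 1ℚ :* k)) refl α κ

  -- U u φ is u to the number of free columns. U₁, U₂ and U₁₂ vanish unless the
  -- last, the next to last, or both of these columns are free, and do not
  -- count the columns so required.
  U U₁ U₂ U₁₂ : ℚ → ∀ {n} → Vec Bool n → ℚ
  U u []      = 1ℚ
  U u (f ∷ φ) = fac u f * U u φ

  U₁ u []          = 0ℚ
  U₁ u (f ∷ [])    = keep 1ℚ f
  U₁ u (f ∷ g ∷ φ) = fac u f * U₁ u (g ∷ φ)

  U₂ u []              = 0ℚ
  U₂ u (f ∷ [])        = 0ℚ
  U₂ u (f ∷ g ∷ [])    = keep (fac u g) f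
  U₂ u (f ∷ g ∷ h ∷ φ) = fac u f * U₂ u (g ∷ h ∷ φ)

  U₁₂ u []              = 0ℚ
  U₁₂ u (f ∷ [])        = 0ℚ
  U₁₂ u (f ∷ g ∷ [])    = keep (keep 1ℚ g) f
  U₁₂ u (f ∷ g ∷ h ∷ φ) = fac u f * U₁₂ u (g ∷ h ∷ φ)

  U₁-∷ : ∀ u {n} f (φ : Vec Bool (suc n)) → U₁ u (f ∷ φ) ≡ fac u f * U₁ u φ
  U₁-∷ u f (g ∷ φ) = refl

  U₂-∷ : ∀ u {n} f (φ : Vec Bool (suc (suc n))) → U₂ u (f ∷ φ) ≡ fac u f * U₂ u φ
  U₂-∷ u f (g ∷ h ∷ φ) = refl

  U₁₂-∷ : ∀ u {n} f (φ : Vec Bool (suc (suc n))) → U₁₂ u (f ∷ φ) ≡ fac u f * U₁₂ u φ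
  U₁₂-∷ u f (g ∷ h ∷ φ) = refl

  RowSum-resp : ∀ {u n} {φ : Vec Bool n} {F κ κ′ ε ε′} → κ ≡ κ′ → ε ≡ ε′ → RowSum u φ F κ ε → RowSum u φ F κ′ ε′
  RowSum-resp refl refl s = s

  RowSum-[] : ∀ {u F κ ε} → α * F (alpha ∷ []) + β * F (beta ∷ []) ≡ (α + β * u) * κ + ε →
              α * F (alpha ∷ []) + 0ℚ * F (beta ∷ []) ≡ α * κ → RowSum u [] F κ ε
  RowSum-[] {F = F} p q = rowSum (trans (R-[] true F) p) (trans (R-[] false F) q)

  RowSum-0 : ∀ {u n} {φ : Vec Bool n} {F} → (∀ r → F r ≡ 0ℚ) → RowSum u φ F 0ℚ 0ℚ
  RowSum-0 {u} {φ = φ} z = rowSum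
    (trans (R-cong true φ z) (trans (R-0 true φ) (solve 3 (λ a b u → con 0ℚ := (a :+ b :* u) :* con 0ℚ :+ con 0ℚ) refl α β u)))
    (trans (R-cong false φ z) (trans (R-0 false φ) (sym (ℚₚ.*-zeroʳ α))))

  -- The variant of `RowSum-∷` for the one column whose factor is special, because it is required to
  -- be free or because it carries the counted box. The two polynomial identities are left to the
  -- caller.
  RowSum-w : ∀ {u n f} {φ : Vec Bool n} {F F′ κ ε κ′ ε′} (w : Cell → ℚ) →
             (∀ x r → F′ (x ∷ r) ≡ w x * F r) → RowSum u φ F κ ε →
             w empty * ((α + β * u) * κ + ε) + (keep α f * (w alpha * (α * κ)) + keep β f * (w beta * (α * κ)))
               ≡ (α + β * u) * κ′ + ε′ →
             w empty * (α * κ) + (keep α f * (w alpha * (α * κ)) + 0ℚ * (w beta * (α * κ))) ≡ α * κ′ →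
             RowSum u (f ∷ φ) F′ κ′ ε′
  RowSum-w {u} {f = f} {φ} {F} {F′} {κ} {ε} w step (rowSum p q) alg₁ alg₂ = rowSum
    (trans (R-∷ true f φ F′) (trans (cong₂ _+_ (part true empty p)
      (cong₂ (λ a b → keep α f * a + keep β f * b) (part false alpha q) (part false beta q))) alg₁))
    (trans (R-∷ false f φ F′) (trans (cong₂ _+_ (part false empty q)
      (cong₂ (λ a b → keep α f * a + 0ℚ * b) (part false alpha q) (part false beta q))) alg₂))
    where
    part : ∀ b x {v} → R b φ F ≡ v → R b φ (F′ ∘ (x ∷_)) ≡ w x * v
    part b x h = trans (R-cong b φ (step x)) (trans (R-* b φ (w x) F) (cong (w x *_) h))

  module _ (u : ℚ) where
    rows-U : ∀ {n} (φ : Vec Bool n) → RowSum u φ (λ r → U u (next r φ)) (U (u + α) φ) 0ℚ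
    rows-U [] = RowSum-[] (solve 3 (λ a b u → a :* (con 1ℚ :* con 1ℚ) :+ b :* (u :* con 1ℚ) := (a :+ b :* u) :* con 1ℚ :+ con 0ℚ)
          refl α β u)
      (solve 2 (λ a u → a :* (con 1ℚ :* con 1ℚ) :+ con 0ℚ :* (u :* con 1ℚ) := a :* con 1ℚ) refl α u)
    rows-U (f ∷ φ) = RowSum-resp refl (ℚₚ.*-zeroʳ (fac u f)) (RowSum-∷ (λ x r → refl) (rows-U φ))

    -- The last column of the enlarged tableau consists of the new diagonal box alone. It is free
    -- only if that box is β, and then the rest of the row is empty: there is no κ-part, and all old
    -- free columns stay free.
    rows-U₁ : ∀ {n} (φ : Vec Bool n) → RowSum u φ (λ r → U₁ u (next r φ)) 0ℚ (β * U u φ)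
    rows-U₁ [] = RowSum-[] (solve 3 (λ a b u → a :* con 0ℚ :+ b :* con 1ℚ := (a :+ b :* u) :* con 0ℚ :+ b :* con 1ℚ) refl α β u)
      (solve 1 (λ a → a :* con 0ℚ :+ con 0ℚ :* con 1ℚ := a :* con 0ℚ) refl α)
    rows-U₁ (f ∷ φ) = RowSum-resp (ℚₚ.*-zeroʳ (fac (u + α) f))
      (solve 3 (λ a b c → a :* (b :* c) := b :* (a :* c)) refl (fac u f) β (U u φ))
      (RowSum-∷ (λ x r → U₁-∷ u (f ∧ isFree x) (next r φ)) (rows-U₁ φ))

    -- The required column is the last one of the old tableau and may not receive α. Left empty, it
    -- gives the κ-part. If it receives β, the diagonal box is α and everything else is empty, which
    -- is the ε-part.
    rows-U₂ : ∀ {n} (φ : Vec Bool n) → RowSum u φ (λ r → U₂ u (next r φ)) (U₁ (u + α) φ) (α * β * U₁ u φ)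
    rows-U₂ [] = RowSum-resp refl (sym (ℚₚ.*-zeroʳ (α * β))) (RowSum-0 {F = λ r → U₂ u (next r [])} (λ { (x ∷ []) → refl }))
    rows-U₂ (f ∷ []) = RowSum-w {F = λ r → U u (next r [])} (λ x → keep 1ℚ (f ∧ isFree x))
      (λ { x (y ∷ []) → base (f ∧ isFree x) (isFree y) }) (rows-U []) (alg₁ f) (alg₂ f)
      where
      base : ∀ f g → keep (fac u g) f ≡ keep 1ℚ f * (fac u g * 1ℚ)
      base true  g = solve 1 (λ a → a := con 1ℚ :* (a :* con 1ℚ)) refl (fac u g)
      base false g = solve 1 (λ a → con 0ℚ := con 0ℚ :* (a :* con 1ℚ)) refl (fac u g)
      alg₁ : ∀ f → keep 1ℚ (f ∧ true) * ((α + β * u) * 1ℚ + 0ℚ)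
                   + (keep α f * (keep 1ℚ (f ∧ false) * (α * 1ℚ)) + keep β f * (keep 1ℚ (f ∧ true) * (α * 1ℚ)))
                 ≡ (α + β * u) * keep 1ℚ f + α * β * keep 1ℚ f
      alg₁ true  = solve 3 (λ a b u → con 1ℚ :* ((a :+ b :* u) :* con 1ℚ :+ con 0ℚ)
                       :+ (a :* (con 0ℚ :* (a :* con 1ℚ)) :+ b :* (con 1ℚ :* (a :* con 1ℚ)))
                     := (a :+ b :* u) :* con 1ℚ :+ a :* b :* con 1ℚ) refl α β u
      alg₁ false = solve 3 (λ a b u → con 0ℚ :* ((a :+ b :* u) :* con 1ℚ :+ con 0ℚ)
                       :+ (con 0ℚ :* (con 0ℚ :* (a :* con 1ℚ)) :+ con 0ℚ :* (con 0ℚ :* (a :* con 1ℚ)))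
                     := (a :+ b :* u) :* con 0ℚ :+ a :* b :* con 0ℚ) refl α β u
      alg₂ : ∀ f → keep 1ℚ (f ∧ true) * (α * 1ℚ)
                   + (keep α f * (keep 1ℚ (f ∧ false) * (α * 1ℚ)) + 0ℚ * (keep 1ℚ (f ∧ true) * (α * 1ℚ)))
                 ≡ α * keep 1ℚ f
      alg₂ true  = solve 1 (λ a → con 1ℚ :* (a :* con 1ℚ)
                       :+ (a :* (con 0ℚ :* (a :* con 1ℚ)) :+ con 0ℚ :* (con 1ℚ :* (a :* con 1ℚ)))
                     := a :* con 1ℚ) refl α
      alg₂ false = solve 1 (λ a → con 0ℚ :* (a :* con 1ℚ)
                       :+ (con 0ℚ :* (con 0ℚ :* (a :* con 1ℚ)) :+ con 0ℚ :* (con 0ℚ :* (a :* con 1ℚ)))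
                     := a :* con 0ℚ) refl α
    rows-U₂ (f ∷ φ@(_ ∷ _)) = RowSum-resp (sym (U₁-∷ (u + α) f φ))
      (trans (solve 4 (λ x a b z → x :* (a :* b :* z) := a :* b :* (x :* z)) refl (fac u f) α β (U₁ u φ))
        (cong (α * β *_) (sym (U₁-∷ u f φ))))
      (RowSum-∷ (λ x r → U₂-∷ u (f ∧ isFree x) (next r φ)) (rows-U₂ φ))

    rows-U₁₂ : ∀ {n} (φ : Vec Bool n) → RowSum u φ (λ r → U₁₂ u (next r φ)) 0ℚ (β * U₁ u φ)
    rows-U₁₂ [] = RowSum-resp refl (sym (ℚₚ.*-zeroʳ β)) (RowSum-0 {F = λ r → U₁₂ u (next r [])} (λ { (x ∷ []) → refl }))
    rows-U₁₂ (f ∷ []) = RowSum-w {F = λ r → U₁ u (next r [])} (λ x → keep 1ℚ (f ∧ isFree x))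
      (λ { x (y ∷ []) → base (f ∧ isFree x) (isFree y) }) (rows-U₁ []) (alg₁ f)
      (solve 4 (λ a k l m → k :* (a :* con 0ℚ) :+ (l :* (m :* (a :* con 0ℚ)) :+ con 0ℚ :* (k :* (a :* con 0ℚ))) := a :* con 0ℚ) refl
        α (keep 1ℚ (f ∧ true)) (keep α f) (keep 1ℚ (f ∧ false)))
      where
      base : ∀ f g → keep (keep 1ℚ g) f ≡ keep 1ℚ f * keep 1ℚ g
      base true  g = sym (ℚₚ.*-identityˡ (keep 1ℚ g))
      base false g = sym (ℚₚ.*-zeroˡ (keep 1ℚ g))
      alg₁ : ∀ f → keep 1ℚ (f ∧ true) * ((α + β * u) * 0ℚ + β * 1ℚ)
                   + (keep α f * (keep 1ℚ (f ∧ false) * (α * 0ℚ)) + keep β f * (keep 1ℚ (f ∧ true) * (α * 0ℚ)))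
                 ≡ (α + β * u) * 0ℚ + β * keep 1ℚ f
      alg₁ true  = solve 3 (λ a b u → con 1ℚ :* ((a :+ b :* u) :* con 0ℚ :+ b :* con 1ℚ)
                       :+ (a :* (con 0ℚ :* (a :* con 0ℚ)) :+ b :* (con 1ℚ :* (a :* con 0ℚ)))
                     := (a :+ b :* u) :* con 0ℚ :+ b :* con 1ℚ) refl α β u
      alg₁ false = solve 3 (λ a b u → con 0ℚ :* ((a :+ b :* u) :* con 0ℚ :+ b :* con 1ℚ)
                       :+ (con 0ℚ :* (con 0ℚ :* (a :* con 0ℚ)) :+ con 0ℚ :* (con 0ℚ :* (a :* con 0ℚ)))
                     := (a :+ b :* u) :* con 0ℚ :+ b :* con 0ℚ) refl α β u
    rows-U₁₂ (f ∷ φ@(_ ∷ _)) = RowSum-resp (ℚₚ.*-zeroʳ (fac (u + α) f))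
      (trans (solve 3 (λ a b c → a :* (b :* c) := b :* (a :* c)) refl (fac u f) β (U₁ u φ))
        (cong (β *_) (sym (U₁-∷ u f φ))))
      (RowSum-∷ (λ x r → U₁₂-∷ u (f ∧ isFree x) (next r φ)) (rows-U₁₂ φ))

    -- A filled third diagonal box kills the ε-part of the row sum.
    rows-mark : (K κ ε κ⁺ : ∀ {n} → Vec Bool n → ℚ) →
                (∀ {n} f (φ : Vec Bool (suc (suc n))) → K (f ∷ φ) ≡ fac u f * K φ) →
                (∀ {n} (φ : Vec Bool n) → RowSum u φ (λ r → K (next r φ)) (κ φ) (ε φ)) →
                κ⁺ [] ≡ 0ℚ → (∀ f → κ⁺ (f ∷ []) ≡ 0ℚ) →
                (∀ f g → κ⁺ (f ∷ g ∷ []) ≡ keep (α * κ (g ∷ [])) f) →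
                (∀ {n} f (φ : Vec Bool (suc (suc n))) → κ⁺ (f ∷ φ) ≡ fac (u + α) f * κ⁺ φ) →
                ∀ {n} (φ : Vec Bool n) → RowSum u φ (λ r → ⟦ mark r ⟧ * K (next r φ)) (κ⁺ φ) 0ℚ
    rows-mark K κ ε κ⁺ K-∷ sums κ⁺-0 κ⁺-1 κ⁺-2 κ⁺-∷ = go
      where
      go : ∀ {n} (φ : Vec Bool n) → RowSum u φ (λ r → ⟦ mark r ⟧ * K (next r φ)) (κ⁺ φ) 0ℚ
      go [] = RowSum-resp (sym κ⁺-0) refl (RowSum-0 (λ { (x ∷ []) → ℚₚ.*-zeroˡ (K (next (x ∷ []) [])) }))
      go (f ∷ []) = RowSum-resp (sym (κ⁺-1 f)) refl (RowSum-0 (λ { (x ∷ y ∷ []) → ℚₚ.*-zeroˡ (K (next (x ∷ y ∷ []) (f ∷ []))) }))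
      go (f ∷ g ∷ []) = RowSum-resp (sym (κ⁺-2 f g)) refl
        (RowSum-w {F = λ r → K (next r (g ∷ []))} (λ x → ⟦ isFilled x ⟧ * fac u (f ∧ isFree x)) step (sums (g ∷ [])) (alg₁ f) (alg₂ f))
        where
        k = κ (g ∷ [])
        z = ε (g ∷ [])
        step : ∀ x r → ⟦ mark (x ∷ r) ⟧ * K (next (x ∷ r) (f ∷ g ∷ []))
                     ≡ (⟦ isFilled x ⟧ * fac u (f ∧ isFree x)) * K (next r (g ∷ []))
        step x r@(_ ∷ _ ∷ []) = trans (cong (⟦ isFilled x ⟧ *_) (K-∷ (f ∧ isFree x) (next r (g ∷ []))))
          (sym (ℚₚ.*-assoc ⟦ isFilled x ⟧ (fac u (f ∧ isFree x)) (K (next r (g ∷ [])))))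
        -- A filled box is α, or β with the column still free. The sum α·ακ + βu·ακ has the factor α
        -- + βu and leaves no remainder.
        alg₁ : ∀ f → (0ℚ * fac u (f ∧ true)) * ((α + β * u) * k + z)
                     + (keep α f * ((1ℚ * fac u (f ∧ false)) * (α * k)) + keep β f * ((1ℚ * fac u (f ∧ true)) * (α * k)))
                   ≡ (α + β * u) * keep (α * k) f + 0ℚ
        alg₁ true  = solve 5 (λ a b u k z → (con 0ℚ :* u) :* ((a :+ b :* u) :* k :+ z)
                         :+ (a :* ((con 1ℚ :* con 1ℚ) :* (a :* k)) :+ b :* ((con 1ℚ :* u) :* (a :* k)))
                       := (a :+ b :* u) :* (a :* k) :+ con 0ℚ) refl α β u k z
        alg₁ false = solve 5 (λ a b u k z → (con 0ℚ :* con 1ℚ) :* ((a :+ b :* u) :* k :+ z)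
                         :+ (con 0ℚ :* ((con 1ℚ :* con 1ℚ) :* (a :* k)) :+ con 0ℚ :* ((con 1ℚ :* con 1ℚ) :* (a :* k)))
                       := (a :+ b :* u) :* con 0ℚ :+ con 0ℚ) refl α β u k z
        alg₂ : ∀ f → (0ℚ * fac u (f ∧ true)) * (α * k)
                     + (keep α f * ((1ℚ * fac u (f ∧ false)) * (α * k)) + 0ℚ * ((1ℚ * fac u (f ∧ true)) * (α * k)))
                   ≡ α * keep (α * k) f
        alg₂ true  = solve 3 (λ a u k → (con 0ℚ :* u) :* (a :* k)
                         :+ (a :* ((con 1ℚ :* con 1ℚ) :* (a :* k)) :+ con 0ℚ :* ((con 1ℚ :* u) :* (a :* k)))
                       := a :* (a :* k)) refl α u k
        alg₂ false = solve 2 (λ a k → (con 0ℚ :* con 1ℚ) :* (a :* k)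
                         :+ (con 0ℚ :* ((con 1ℚ :* con 1ℚ) :* (a :* k)) :+ con 0ℚ :* ((con 1ℚ :* con 1ℚ) :* (a :* k)))
                       := a :* con 0ℚ) refl α k
      go (f ∷ φ@(_ ∷ _ ∷ _)) = RowSum-resp (sym (κ⁺-∷ f φ)) (ℚₚ.*-zeroʳ (fac u f)) (RowSum-∷ step (go φ))
        where
        step : ∀ x r → ⟦ mark (x ∷ r) ⟧ * K (next (x ∷ r) (f ∷ φ)) ≡ fac u (f ∧ isFree x) * (⟦ mark r ⟧ * K (next r φ))
        step x r@(_ ∷ _ ∷ _ ∷ _) = trans (cong (⟦ mark r ⟧ *_) (K-∷ (f ∧ isFree x) (next r φ)))
          (solve 3 (λ a b c → a :* (b :* c) := b :* (a :* c)) refl ⟦ mark r ⟧ (fac u (f ∧ isFree x)) (K (next r φ)))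

  -- Recursions for the weighted sums of functions of `X³`.

  𝔸 : (∀ {n} → Vec Bool n → ℚ) → ∀ n → (ℕ → ℚ) → ℚ
  𝔸 K n h = Σᵀ n (λ S → K (free S) * h (X³ S))

  𝔸-* : ∀ c (K : ∀ {n} → Vec Bool n → ℚ) n h → 𝔸 (λ φ → c * K φ) n h ≡ c * 𝔸 K n h
  𝔸-* c K n h = trans (Σᵀ-cong n (λ S → ℚₚ.*-assoc c (K (free S)) (h (X³ S)))) (Σᵀ-* n c (λ S → K (free S) * h (X³ S)))

  𝔸-0 : ∀ n h → 𝔸 (λ _ → 0ℚ) n h ≡ 0ℚ
  𝔸-0 n h = trans (𝔸-* 0ℚ (λ _ → 0ℚ) n h) (ℚₚ.*-zeroˡ (𝔸 (λ _ → 0ℚ) n h))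

  -- By `mark-Δ` two row sums suffice: over all rows, paired with h, and over the rows with a filled
  -- third diagonal box, paired with Δh.
  𝔸-suc : ∀ {u} (K κ ε κ⁺ : ∀ {n} → Vec Bool n → ℚ) →
          (∀ {n} (φ : Vec Bool n) → RowSum u φ (λ r → K (next r φ)) (κ φ) (ε φ)) →
          (∀ {n} (φ : Vec Bool n) → RowSum u φ (λ r → ⟦ mark r ⟧ * K (next r φ)) (κ⁺ φ) 0ℚ) →
          ∀ n h → 𝔸 K (suc n) h ≡ (α + β * u) * (𝔸 κ n h + 𝔸 κ⁺ n (Δ h)) + 𝔸 ε n h
  𝔸-suc {u} K κ ε κ⁺ sums sums⁺ n h = begin
    𝔸 K (suc n) h
      ≡⟨ Σᵀ-suc n (λ S → K (free S) * h (X³ S)) ⟩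
    Σᵀ n (λ S → R true (free S) (λ r → K (next r (free S)) * h (X³ (r ∷ S))))
      ≡⟨ Σᵀ-cong n pointwise ⟩
    Σᵀ n (λ S → (α + β * u) * (κ (free S) * h (X³ S) + κ⁺ (free S) * Δ h (X³ S)) + ε (free S) * h (X³ S))
      ≡⟨ Σᵀ-+ n (λ S → (α + β * u) * (κ (free S) * h (X³ S) + κ⁺ (free S) * Δ h (X³ S))) (λ S → ε (free S) * h (X³ S)) ⟩
    Σᵀ n (λ S → (α + β * u) * (κ (free S) * h (X³ S) + κ⁺ (free S) * Δ h (X³ S))) + 𝔸 ε n h
      ≡⟨ cong (_+ 𝔸 ε n h) (trans
           (Σᵀ-* n (α + β * u) (λ S → κ (free S) * h (X³ S) + κ⁺ (free S) * Δ h (X³ S)))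
           (cong ((α + β * u) *_) (Σᵀ-+ n (λ S → κ (free S) * h (X³ S)) (λ S → κ⁺ (free S) * Δ h (X³ S))))) ⟩
    (α + β * u) * (𝔸 κ n h + 𝔸 κ⁺ n (Δ h)) + 𝔸 ε n h ∎
    where
    open ≡-Reasoning
    pointwise : ∀ S → R true (free S) (λ r → K (next r (free S)) * h (X³ (r ∷ S)))
                    ≡ (α + β * u) * (κ (free S) * h (X³ S) + κ⁺ (free S) * Δ h (X³ S)) + ε (free S) * h (X³ S)
    pointwise S = begin
      R true φ (λ r → K (next r φ) * h (X³ (r ∷ S)))
        ≡⟨ R-cong true φ (λ r → trans
             (cong (K (next r φ) *_) (trans (cong h (X³-∷ r S)) (mark-Δ h k r)))
             (solve 4 (λ a b m d → a :* (b :+ m :* d) := b :* a :+ d :* (m :* a)) refl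
               (K (next r φ)) (h k) ⟦ mark r ⟧ (Δ h k))) ⟩
      R true φ (λ r → h k * K (next r φ) + Δ h k * (⟦ mark r ⟧ * K (next r φ)))
        ≡⟨ R-+ true φ (λ r → h k * K (next r φ)) (λ r → Δ h k * (⟦ mark r ⟧ * K (next r φ))) ⟩
      R true φ (λ r → h k * K (next r φ)) + R true φ (λ r → Δ h k * (⟦ mark r ⟧ * K (next r φ)))
        ≡⟨ cong₂ _+_
             (trans (R-* true φ (h k) (λ r → K (next r φ))) (cong (h k *_) (RowSum.withβ (sums φ))))
             (trans (R-* true φ (Δ h k) (λ r → ⟦ mark r ⟧ * K (next r φ))) (cong (Δ h k *_) (RowSum.withβ (sums⁺ φ)))) ⟩
      h k * ((α + β * u) * κ φ + ε φ) + Δ h k * ((α + β * u) * κ⁺ φ + 0ℚ)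
        ≡⟨ solve 6 (λ t b d k z k′ → b :* (t :* k :+ z) :+ d :* (t :* k′ :+ con 0ℚ)
             := t :* (k :* b :+ k′ :* d) :+ z :* b) refl (α + β * u) (h k) (Δ h k) (κ φ) (ε φ) (κ⁺ φ) ⟩
      (α + β * u) * (κ φ * h k + κ⁺ φ * Δ h k) + ε φ * h k ∎
      where
      φ = free S
      k = X³ S

  A A₁ A₂ A₁₂ : ℕ → ℚ → (ℕ → ℚ) → ℚ
  A   n u = 𝔸 (U u) n
  A₁  n u = 𝔸 (U₁ u) n
  A₂  n u = 𝔸 (U₂ u) n
  A₁₂ n u = 𝔸 (U₁₂ u) n

  keep-* : ∀ f c p → c * keep p f ≡ keep (c * p) f
  keep-* true  c p = refl
  keep-* false c p = ℚₚ.*-zeroʳ c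

  fac-* : ∀ u f c p → c * (fac u f * p) ≡ fac u f * (c * p)
  fac-* u f c p = solve 3 (λ a b c → a :* (b :* c) := b :* (a :* c)) refl c (fac u f) p

  keep-0 : ∀ f → 0ℚ ≡ keep (α * 0ℚ) f
  keep-0 true  = sym (ℚₚ.*-zeroʳ α)
  keep-0 false = refl

  -- The third diagonal box of the new row lies in the next to last column of the old tableau, which
  -- has to be free if the box is filled. This produces `A₂`.
  A-suc : ∀ n u h → A (suc n) u h ≡ (α + β * u) * (A n (u + α) h + α * A₂ n (u + α) (Δ h))
  A-suc n u h = trans
    (𝔸-suc (U u) (U (u + α)) (λ _ → 0ℚ) (λ φ → α * U₂ (u + α) φ) (rows-U u)
      (rows-mark u (U u) (U (u + α)) (λ _ → 0ℚ) (λ φ → α * U₂ (u + α) φ) (λ f φ → refl) (rows-U u)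
        (ℚₚ.*-zeroʳ α) (λ f → ℚₚ.*-zeroʳ α)
        (λ f g → trans (keep-* f α (fac (u + α) g))
          (cong (λ p → keep (α * p) f) (sym (ℚₚ.*-identityʳ (fac (u + α) g)))))
        (λ f φ → trans (cong (α *_) (U₂-∷ (u + α) f φ)) (fac-* (u + α) f α (U₂ (u + α) φ))))
      n h)
    (trans (cong₂ (λ p q → (α + β * u) * (A n (u + α) h + p) + q) (𝔸-* α (U₂ (u + α)) n (Δ h)) (𝔸-0 n h))
      (ℚₚ.+-identityʳ _))

  -- With one row removed, the required column is the last one. If the removed row has a filled
  -- third diagonal box, the next to last column is required as well, which produces `A₁₂`.
  A₂-suc : ∀ n u h → A₂ (suc n) u h ≡ (α + β * u) * (A₁ n (u + α) h + α * A₁₂ n (u + α) (Δ h)) + α * β * A₁ n u h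
  A₂-suc n u h = trans
    (𝔸-suc (U₂ u) (U₁ (u + α)) (λ φ → α * β * U₁ u φ) (λ φ → α * U₁₂ (u + α) φ) (rows-U₂ u)
      (rows-mark u (U₂ u) (U₁ (u + α)) (λ φ → α * β * U₁ u φ) (λ φ → α * U₁₂ (u + α) φ) (U₂-∷ u) (rows-U₂ u)
        (ℚₚ.*-zeroʳ α) (λ f → ℚₚ.*-zeroʳ α)
        (λ f g → keep-* f α (keep 1ℚ g))
        (λ f φ → trans (cong (α *_) (U₁₂-∷ (u + α) f φ)) (fac-* (u + α) f α (U₁₂ (u + α) φ))))
      n h)
    (cong₂ (λ p q → (α + β * u) * (A₁ n (u + α) h + p) + q) (𝔸-* α (U₁₂ (u + α)) n (Δ h)) (𝔸-* (α * β) (U₁ u) n h))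

  collapse : ∀ t b x → t * (0ℚ + 0ℚ) + b * x ≡ b * x
  collapse = solve 3 (λ t b x → t :* (con 0ℚ :+ con 0ℚ) :+ b :* x := b :* x) refl

  A₁-suc : ∀ n u h → A₁ (suc n) u h ≡ β * A n u h
  A₁-suc n u h = trans
    (𝔸-suc (U₁ u) (λ _ → 0ℚ) (λ φ → β * U u φ) (λ _ → 0ℚ) (rows-U₁ u)
      (rows-mark u (U₁ u) (λ _ → 0ℚ) (λ φ → β * U u φ) (λ _ → 0ℚ) (λ f φ → U₁-∷ u f φ) (rows-U₁ u)
        refl (λ f → refl) (λ f g → keep-0 f) (λ f φ → sym (ℚₚ.*-zeroʳ (fac (u + α) f))))
      n h)
    (trans (cong₂ _+_ (cong₂ (λ p q → (α + β * u) * (p + q)) (𝔸-0 n h) (𝔸-0 n (Δ h))) (𝔸-* β (U u) n h))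
      (collapse (α + β * u) β (A n u h)))

  A₁₂-suc : ∀ n u h → A₁₂ (suc n) u h ≡ β * A₁ n u h
  A₁₂-suc n u h = trans
    (𝔸-suc (U₁₂ u) (λ _ → 0ℚ) (λ φ → β * U₁ u φ) (λ _ → 0ℚ) (rows-U₁₂ u)
      (rows-mark u (U₁₂ u) (λ _ → 0ℚ) (λ φ → β * U₁ u φ) (λ _ → 0ℚ) (λ f φ → U₁₂-∷ u f φ) (rows-U₁₂ u)
        refl (λ f → refl) (λ f g → keep-0 f) (λ f φ → sym (ℚₚ.*-zeroʳ (fac (u + α) f))))
      n h)
    (trans (cong₂ _+_ (cong₂ (λ p q → (α + β * u) * (p + q)) (𝔸-0 n h) (𝔸-0 n (Δ h))) (𝔸-* β (U₁ u) n h))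
      (collapse (α + β * u) β (A₁ n u h)))

-- Inequalities between rationals and the embedding of ℕ.

≤-by : ∀ {p q} d → 0ℚ ≤ d → p + d ≡ q → p ≤ q
≤-by {p} d 0≤d e = subst₂ _≤_ (ℚₚ.+-identityʳ p) e (ℚₚ.+-monoʳ-≤ p 0≤d)

0≤-* : ∀ {p q} → 0ℚ ≤ p → 0ℚ ≤ q → 0ℚ ≤ p * q
0≤-* {p} {q} 0≤p 0≤q = ℚₚ.nonNegative⁻¹ (p * q) {{ℚₚ.nonNeg*nonNeg⇒nonNeg p {{ℚ.nonNegative 0≤p}} q {{ℚ.nonNegative 0≤q}}}}

0≤-+ : ∀ {p q} → 0ℚ ≤ p → 0ℚ ≤ q → 0ℚ ≤ p + q
0≤-+ 0≤p 0≤q = ℚₚ.+-mono-≤ 0≤p 0≤q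

0≤-^ : ∀ {p} k → 0ℚ ≤ p → 0ℚ ≤ p ^ k
0≤-^ zero    0≤p = ℚₚ.<⇒≤ (ℚₚ.positive⁻¹ 1ℚ)
0≤-^ (suc k) 0≤p = 0≤-* 0≤p (0≤-^ k 0≤p)

*-monoˡ : ∀ {p q} c → 0ℚ ≤ c → p ≤ q → c * p ≤ c * q
*-monoˡ c 0≤c = ℚₚ.*-monoˡ-≤-nonNeg c {{ℚ.nonNegative 0≤c}}

*-monoʳ : ∀ {p q} c → 0ℚ ≤ c → p ≤ q → p * c ≤ q * c
*-monoʳ c 0≤c = ℚₚ.*-monoʳ-≤-nonNeg c {{ℚ.nonNegative 0≤c}}

0≤1 : 0ℚ ≤ 1ℚ
0≤1 = ℚₚ.<⇒≤ (ℚₚ.positive⁻¹ 1ℚ)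

0≤⟦_⟧ : ∀ n → 0ℚ ≤ ⟦ n ⟧
0≤⟦ zero ⟧  = ℚₚ.≤-refl
0≤⟦ suc n ⟧ = 0≤-+ 0≤1 0≤⟦ n ⟧

⟦⟧-+ : ∀ m n → ⟦ m ℕ.+ n ⟧ ≡ ⟦ m ⟧ + ⟦ n ⟧
⟦⟧-+ m n = ×-homo-+ 1ℚ m n

⟦⟧-* : ∀ m n → ⟦ m ℕ.* n ⟧ ≡ ⟦ m ⟧ * ⟦ n ⟧
⟦⟧-* = ×1-homo-*

⟦⟧-^ : ∀ m k → ⟦ m ℕ.^ k ⟧ ≡ ⟦ m ⟧ ^ k
⟦⟧-^ m zero    = refl
⟦⟧-^ m (suc k) = trans (⟦⟧-* m (m ℕ.^ k)) (cong (⟦ m ⟧ *_) (⟦⟧-^ m k))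

⟦⟧-mono : ∀ {m n} → m ℕ.≤ n → ⟦ m ⟧ ≤ ⟦ n ⟧
⟦⟧-mono {m} {n} m≤n = ≤-by ⟦ n ℕ.∸ m ⟧ 0≤⟦ n ℕ.∸ m ⟧
  (trans (sym (⟦⟧-+ m (n ℕ.∸ m))) (cong ⟦_⟧ (ℕₚ.m+[n∸m]≡n m≤n)))

-- Binomial coefficients

nC0≡1 : ∀ n → n C 0 ≡ 1
nC0≡1 n = trans (nCk≡nC[n∸k] {n = n} z≤n) (nCn≡1 n)

C-mono : ∀ k {m n} → m ℕ.≤ n → m C k ℕ.≤ n C k
C-mono zero {m} {n} _ = ℕₚ.≤-reflexive (trans (nC0≡1 m) (sym (nC0≡1 n)))
C-mono (suc k) {m} {zero}  z≤n = ℕₚ.≤-refl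
C-mono (suc k) {m} {suc n} m≤1+n with ℕₚ.m≤n⇒m<n∨m≡n m≤1+n
... | inj₂ refl      = ℕₚ.≤-refl
... | inj₁ (s≤s m≤n) = ℕₚ.≤-trans (C-mono (suc k) m≤n)
  (ℕₚ.≤-trans (ℕₚ.m≤n+m (n C suc k) (n C k)) (ℕₚ.≤-reflexive (nCk+nC[k+1]≡[n+1]C[k+1] n k)))

choose : ℕ → ℕ → ℚ
choose r k = ⟦ k C r ⟧

Δ-choose : ∀ r k → Δ (choose (suc r)) k ≡ choose r k
Δ-choose r k = begin
  ⟦ suc k C suc r ⟧ - ⟦ k C suc r ⟧               ≡⟨ cong (λ m → ⟦ m ⟧ - ⟦ k C suc r ⟧) (sym (nCk+nC[k+1]≡[n+1]C[k+1] k r)) ⟩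
  ⟦ k C r ℕ.+ k C suc r ⟧ - ⟦ k C suc r ⟧         ≡⟨ cong (_- ⟦ k C suc r ⟧) (⟦⟧-+ (k C r) (k C suc r)) ⟩
  (⟦ k C r ⟧ + ⟦ k C suc r ⟧) - ⟦ k C suc r ⟧     ≡⟨ solve 2 (λ a b → (a :+ b) :- b := a) refl ⟦ k C r ⟧ ⟦ k C suc r ⟧ ⟩
  ⟦ k C r ⟧                                       ∎
  where open ≡-Reasoning

choose-0 : ∀ k → choose 0 k ≡ 1ℚ
choose-0 k = cong ⟦_⟧ (nC0≡1 k)

Δ-choose-0 : ∀ k → Δ (choose 0) k ≡ 0ℚ
Δ-choose-0 k = trans (cong₂ _-_ (choose-0 (suc k)) (choose-0 k)) (ℚₚ.+-inverseʳ 1ℚ)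

-- Binomial moments: recursion and two-sided bounds.

module Positive (α β : ℚ) (0≤α : 0ℚ ≤ α) (0≤β : 0ℚ ≤ β) where
  open Weighted α β

  0≤W : ∀ {n} (S : Filling n) → 0ℚ ≤ W S
  0≤W S with W-zero⊎tableau S
  ... | inj₁ e = ℚₚ.≤-reflexive (sym e)
  ... | inj₂ t = ℚₚ.≤-trans (0≤-* (0≤-^ (Nα S) 0≤α) (0≤-^ (Nβ S) 0≤β)) (ℚₚ.≤-reflexive (sym (tableau⇒W t)))

  Σᵀ-mono : ∀ n {F G : Filling n → ℚ} → (∀ S → F S ≤ G S) → Σᵀ n F ≤ Σᵀ n G
  Σᵀ-mono n {F} {G} h = go (fillings n)
    where
    go : ∀ xs → Σᴸ xs (λ S → W S * F S) ≤ Σᴸ xs (λ S → W S * G S)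
    go []       = ℚₚ.≤-refl
    go (S ∷ xs) = ℚₚ.+-mono-≤ (*-monoˡ (W S) (0≤W S) (h S)) (go xs)

  Σᵀ-nonneg : ∀ n {F : Filling n → ℚ} → (∀ S → 0ℚ ≤ F S) → 0ℚ ≤ Σᵀ n F
  Σᵀ-nonneg n {F} h = subst (_≤ Σᵀ n F) (trans (Σᵀ-* n 0ℚ (λ _ → 0ℚ)) (ℚₚ.*-zeroˡ (Σᵀ n (λ _ → 0ℚ)))) (Σᵀ-mono n h)

  0≤fac : ∀ {u} → 0ℚ ≤ u → ∀ f → 0ℚ ≤ fac u f
  0≤fac 0≤u true  = 0≤u
  0≤fac 0≤u false = 0≤1

  0≤U : ∀ {u} → 0ℚ ≤ u → ∀ {n} (φ : Vec Bool n) → 0ℚ ≤ U u φ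
  0≤U 0≤u []      = 0≤1
  0≤U 0≤u (f ∷ φ) = 0≤-* (0≤fac 0≤u f) (0≤U 0≤u φ)

  0≤A : ∀ n {u h} → 0ℚ ≤ u → (∀ k → 0ℚ ≤ h k) → 0ℚ ≤ A n u h
  0≤A n 0≤u 0≤h = Σᵀ-nonneg n (λ S → 0≤-* (0≤U 0≤u (free S)) (0≤h (X³ S)))

  𝔸-cong : ∀ (K : ∀ {n} → Vec Bool n → ℚ) n {g h} → (∀ k → g k ≡ h k) → 𝔸 K n g ≡ 𝔸 K n h
  𝔸-cong K n e = Σᵀ-cong n (λ S → cong (K (free S) *_) (e (X³ S)))

  𝔸-zero : ∀ (K : ∀ {n} → Vec Bool n → ℚ) n {h} → (∀ k → h k ≡ 0ℚ) → 𝔸 K n h ≡ 0ℚ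
  𝔸-zero K n {h} e = trans (Σᵀ-cong n (λ S → trans (cong (K (free S) *_) (e (X³ S)))
    (trans (ℚₚ.*-zeroʳ (K (free S))) (sym (ℚₚ.*-zeroˡ 0ℚ))))) (trans (Σᵀ-* n 0ℚ (λ _ → 0ℚ)) (ℚₚ.*-zeroˡ (Σᵀ n (λ _ → 0ℚ))))

  -- In terms of T = α + βu and γ = αβ the shift u ↦ u + α becomes T ↦ T + γ.
  γ : ℚ
  γ = α * β

  T : ℚ → ℚ
  T u = α + β * u

  T-shift : ∀ u → T (u + α) ≡ T u + γ
  T-shift u = solve 3 (λ a b u → a :+ b :* (u :+ a) := (a :+ b :* u) :+ a :* b) refl α β u

  -- A required column moves from next to last to last and then disappears, so three rows lead back
  -- to `A`. The final term keeps `A₁ n`, which is β times a sum over size n - 1 only when n is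
  -- positive.
  A-suc³ : ∀ n u h → A (suc (suc (suc n))) u h
    ≡ T u * A (suc (suc n)) (u + α) h
      + T u * γ * (T (u + α) * A n (u + α + α) (Δ h) + γ * A n (u + α) (Δ h))
      + T u * γ * α * T (u + α) * A₁ n (u + α + α) (Δ (Δ h))
  A-suc³ n u h = begin
    A (suc (suc (suc n))) u h
      ≡⟨ A-suc (suc (suc n)) u h ⟩
    T u * (A (suc (suc n)) (u + α) h + α * A₂ (suc (suc n)) (u + α) (Δ h))
      ≡⟨ cong (λ z → T u * (A (suc (suc n)) (u + α) h + α * z)) (trans (A₂-suc (suc n) (u + α) (Δ h))
           (cong₂ _+_
             (cong₂ (λ y z → T (u + α) * (y + α * z)) (A₁-suc n (u + α + α) (Δ h)) (A₁₂-suc n (u + α + α) (Δ (Δ h))))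
             (cong (α * β *_) (A₁-suc n (u + α) (Δ h))))) ⟩
    T u * (A (suc (suc n)) (u + α) h + α * (T (u + α) * (β * A n (u + α + α) (Δ h) + α * (β * A₁ n (u + α + α) (Δ (Δ h))))
      + α * β * (β * A n (u + α) (Δ h))))
      ≡⟨ solve 8 (λ a b t t′ w x y z →
           t :* (w :+ a :* (t′ :* (b :* x :+ a :* (b :* z)) :+ a :* b :* (b :* y)))
           := t :* w :+ t :* (a :* b) :* (t′ :* x :+ (a :* b) :* y) :+ t :* (a :* b) :* a :* t′ :* z)
           refl α β (T u) (T (u + α)) (A (suc (suc n)) (u + α) h) (A n (u + α + α) (Δ h)) (A n (u + α) (Δ h))
             (A₁ n (u + α + α) (Δ (Δ h))) ⟩
    T u * A (suc (suc n)) (u + α) h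
      + T u * γ * (T (u + α) * A n (u + α + α) (Δ h) + γ * A n (u + α) (Δ h))
      + T u * γ * α * T (u + α) * A₁ n (u + α + α) (Δ (Δ h)) ∎
    where open ≡-Reasoning

  A-0 : ∀ u h → A 0 u h ≡ h 0
  A-0 u h = solve 1 (λ x → con 1ℚ :* (con 1ℚ :* x) :+ con 0ℚ := x) refl (h 0)

  -- Below size 3 the third diagonal has no box, so only the value of h at 0 enters.
  A-1 : ∀ u h → h 0 ≡ 0ℚ → A 1 u h ≡ 0ℚ
  A-1 u h e = trans (A-suc 0 u h) (trans (cong (λ z → T u * (z + α * A₂ 0 (u + α) (Δ h))) (trans (A-0 (u + α) h) e))
    (solve 3 (λ t a d → t :* (con 0ℚ :+ a :* (con 1ℚ :* (con 0ℚ :* d) :+ con 0ℚ)) := con 0ℚ) refl (T u) α (Δ h 0)))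

  A-2 : ∀ u h → h 0 ≡ 0ℚ → A 2 u h ≡ 0ℚ
  A-2 u h e = trans (A-suc 1 u h) (trans (cong₂ (λ y z → T u * (y + α * z)) (A-1 (u + α) h e) (A₂-suc 0 (u + α) (Δ h)))
    (solve 6 (λ t t′ a b d d′ → t :* (con 0ℚ :+ a :* (t′ :* ((con 1ℚ :* (con 0ℚ :* d) :+ con 0ℚ) :+ a :* (con 1ℚ :* (con 0ℚ :* d′) :+ con 0ℚ))
        :+ a :* b :* (con 1ℚ :* (con 0ℚ :* d) :+ con 0ℚ))) := con 0ℚ) refl
      (T u) (T (u + α)) α β (Δ h 0) (Δ (Δ h) 0)))

  mass : ℕ → ℚ → ℚ
  mass n u = A n u (λ _ → 1ℚ)

  mass-suc : ∀ n u → mass (suc n) u ≡ T u * mass n (u + α)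
  mass-suc n u = trans (A-suc n u (λ _ → 1ℚ))
    (trans (cong (λ z → T u * (mass n (u + α) + α * z)) (𝔸-zero (U₂ (u + α)) n (λ k → ℚₚ.+-inverseʳ 1ℚ)))
      (solve 3 (λ t m a → t :* (m :+ a :* con 0ℚ) := t :* m) refl (T u) (mass n (u + α)) α))

  -- `mass n u` is the product of T + iγ over i < n. `mass-suc` splits off the first factor, this
  -- lemma the last.
  mass-suc′ : ∀ n u → mass (suc n) u ≡ mass n u * (T u + ⟦ n ⟧ * γ)
  mass-suc′ zero u = trans (mass-suc 0 u) (trans (cong (T u *_) (A-0 (u + α) (λ _ → 1ℚ)))
    (trans (solve 2 (λ t g → t :* con 1ℚ := con 1ℚ :* (t :+ con 0ℚ :* g)) refl (T u) γ)
      (cong (_* (T u + 0ℚ * γ)) (sym (A-0 u (λ _ → 1ℚ))))))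
  mass-suc′ (suc n) u = begin
    mass (suc (suc n)) u                                     ≡⟨ mass-suc (suc n) u ⟩
    T u * mass (suc n) (u + α)                               ≡⟨ cong (T u *_) (mass-suc′ n (u + α)) ⟩
    T u * (mass n (u + α) * (T (u + α) + ⟦ n ⟧ * γ))         ≡⟨ cong (λ t → T u * (mass n (u + α) * (t + ⟦ n ⟧ * γ))) (T-shift u) ⟩
    T u * (mass n (u + α) * (T u + γ + ⟦ n ⟧ * γ))           ≡⟨ solve 4 (λ t m g k → t :* (m :* (t :+ g :+ k :* g))
                                                                 := t :* m :* (t :+ (con 1ℚ :+ k) :* g)) refl (T u) (mass n (u + α)) γ ⟦ n ⟧ ⟩
    T u * mass n (u + α) * (T u + ⟦ suc n ⟧ * γ)             ≡⟨ cong (_* (T u + ⟦ suc n ⟧ * γ)) (sym (mass-suc n u)) ⟩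
    mass (suc n) u * (T u + ⟦ suc n ⟧ * γ)                   ∎
    where open ≡-Reasoning

  0≤γ : 0ℚ ≤ γ
  0≤γ = 0≤-* 0≤α 0≤β

  0≤T : ∀ {u} → 0ℚ ≤ u → 0ℚ ≤ T u
  0≤T 0≤u = 0≤-+ 0≤α (0≤-* 0≤β 0≤u)

  0≤mass : ∀ n {u} → 0ℚ ≤ u → 0ℚ ≤ mass n u
  0≤mass n 0≤u = 0≤A n 0≤u (λ _ → 0≤1)

  moment : ℕ → ℕ → ℚ → ℚ
  moment n r u = A n u (choose r)

  0≤moment : ∀ n r {u} → 0ℚ ≤ u → 0ℚ ≤ moment n r u
  0≤moment n r 0≤u = 0≤A n 0≤u (λ k → 0≤⟦ k C r ⟧)

  moment-0 : ∀ n u → moment n 0 u ≡ mass n u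
  moment-0 n u = 𝔸-cong (U u) n choose-0

  moment-small : ∀ r u → moment 0 (suc r) u ≡ 0ℚ × moment 1 (suc r) u ≡ 0ℚ × moment 2 (suc r) u ≡ 0ℚ
  moment-small r u = A-0 u (choose (suc r)) , A-1 u (choose (suc r)) refl , A-2 u (choose (suc r)) refl

  -- The second-difference term of the moment recursion: β times the moment of size n - 1 and order
  -- r - 1, and 0 if n or r is 0.
  rest : ℕ → ℕ → ℚ → ℚ
  rest n r u = A₁ n u (Δ (choose r))

  rest-zero : ∀ r u → rest 0 r u ≡ 0ℚ
  rest-zero r u = solve 1 (λ x → con 1ℚ :* (con 0ℚ :* x) :+ con 0ℚ := con 0ℚ) refl (Δ (choose r) 0)

  rest-0 : ∀ n u → rest n 0 u ≡ 0ℚ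
  rest-0 n u = 𝔸-zero (U₁ u) n Δ-choose-0

  rest-suc : ∀ n r u → rest (suc n) (suc r) u ≡ β * moment n r u
  rest-suc n r u = trans (A₁-suc n u (Δ (choose (suc r)))) (cong (β *_) (𝔸-cong (U u) n (Δ-choose r)))

  0≤rest : ∀ n r {u} → 0ℚ ≤ u → 0ℚ ≤ rest n r u
  0≤rest zero    r       {u} 0≤u = ℚₚ.≤-reflexive (sym (rest-zero r u))
  0≤rest (suc n) zero    {u} 0≤u = ℚₚ.≤-reflexive (sym (rest-0 (suc n) u))
  0≤rest (suc n) (suc r) {u} 0≤u = subst (0ℚ ≤_) (sym (rest-suc n r u)) (0≤-* 0≤β (0≤moment n r 0≤u))

  moment-suc³ : ∀ n r u → moment (suc (suc (suc n))) (suc r) u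
    ≡ T u * moment (suc (suc n)) (suc r) (u + α)
      + T u * γ * (T (u + α) * moment n r (u + α + α) + γ * moment n r (u + α))
      + T u * γ * α * T (u + α) * rest n r (u + α + α)
  moment-suc³ n r u = trans (A-suc³ n u (choose (suc r)))
    (cong₂ (λ x y → T u * moment (suc (suc n)) (suc r) (u + α) + x + T u * γ * α * T (u + α) * y)
      (cong₂ (λ x y → T u * γ * (T (u + α) * x + γ * y)) (𝔸-cong (U (u + α + α)) n (Δ-choose r)) (𝔸-cong (U (u + α)) n (Δ-choose r)))
      (𝔸-cong (U₁ (u + α + α)) n (λ k → cong₂ _-_ (Δ-choose r (suc k)) (Δ-choose r k))))

  mass-suc³ : ∀ n u → mass (suc (suc (suc n))) u
                    ≡ T u * mass n (u + α) * (T (u + α) + ⟦ n ⟧ * γ) * (T (u + α) + ⟦ suc n ⟧ * γ)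
  mass-suc³ n u = trans (mass-suc (suc (suc n)) u) (trans
    (cong (T u *_) (trans (mass-suc′ (suc n) (u + α)) (cong (_* (T (u + α) + ⟦ suc n ⟧ * γ)) (mass-suc′ n (u + α)))))
    (solve 4 (λ t m x y → t :* (m :* x :* y) := t :* m :* x :* y) refl
      (T u) (mass n (u + α)) (T (u + α) + ⟦ n ⟧ * γ) (T (u + α) + ⟦ suc n ⟧ * γ)))

  mass-shift : ∀ n u → T (u + α) * mass n (u + α + α) ≡ mass n (u + α) * (T (u + α) + ⟦ n ⟧ * γ)
  mass-shift n u = trans (sym (mass-suc n (u + α))) (mass-suc′ n (u + α))

  -- The recursion goes from size n + 3 to n when the order drops by one. Subtracting 2 per unit of
  -- order therefore makes the three binomials fit Pascal's rule. If n < 2r, truncated subtraction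
  -- makes the left side 0.
  pascal-double : ∀ n r → (suc (suc (suc n)) ℕ.∸ suc r ℕ.* 2) C suc r
                          ℕ.≤ (suc (suc n) ℕ.∸ suc r ℕ.* 2) C suc r ℕ.+ (n ℕ.∸ r ℕ.* 2) C r
  pascal-double n r with ℕₚ.≤-<-connex (r ℕ.* 2) n
  ... | inj₁ 2r≤n = ℕₚ.≤-reflexive (begin
    (suc n ℕ.∸ r ℕ.* 2) C suc r                            ≡⟨ cong (_C suc r) (ℕₚ.+-∸-assoc 1 2r≤n) ⟩
    suc (n ℕ.∸ r ℕ.* 2) C suc r                            ≡⟨ sym (nCk+nC[k+1]≡[n+1]C[k+1] (n ℕ.∸ r ℕ.* 2) r) ⟩
    (n ℕ.∸ r ℕ.* 2) C r ℕ.+ (n ℕ.∸ r ℕ.* 2) C suc r        ≡⟨ ℕₚ.+-comm ((n ℕ.∸ r ℕ.* 2) C r) _ ⟩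
    (n ℕ.∸ r ℕ.* 2) C suc r ℕ.+ (n ℕ.∸ r ℕ.* 2) C r        ∎)
    where open ≡-Reasoning
  ... | inj₂ n<2r = subst (ℕ._≤ (n ℕ.∸ r ℕ.* 2) C suc r ℕ.+ (n ℕ.∸ r ℕ.* 2) C r)
    (sym (cong (_C suc r) (ℕₚ.m≤n⇒m∸n≡0 n<2r))) z≤n

  0≤shift : ∀ {u} → 0ℚ ≤ u → 0ℚ ≤ u + α
  0≤shift 0≤u = 0≤-+ 0≤u 0≤α

  -- Of the recursion only the terms `m₁` and `m₂` are used; `m₃` and `m₄` are dropped as
  -- nonnegative. The hypothesis says that the last factor T + (n - 1)γ of the mass is at most Nγ.
  -- It is inherited with the same N, since T + nγ is unchanged from (n + 3, u) to (n + 2, u + α)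
  -- and decreases to (n, u + 2α).
  moment-lower : ∀ N n r u → 0ℚ ≤ N → 0ℚ ≤ u → T u + ⟦ n ⟧ * γ ≤ (N + 1ℚ) * γ →
                 ⟦ (n ℕ.∸ r ℕ.* 2) C r ⟧ * mass n u ≤ moment n r u * N ^ r
  moment-lower N n zero u 0≤N 0≤u big = ℚₚ.≤-reflexive (trans (cong (_* mass n u) (choose-0 n))
    (trans (ℚₚ.*-comm 1ℚ (mass n u)) (cong (_* 1ℚ) (sym (moment-0 n u)))))
  moment-lower N 0 (suc r) u 0≤N 0≤u big = ℚₚ.≤-trans (ℚₚ.≤-reflexive (ℚₚ.*-zeroˡ (mass 0 u)))
    (0≤-* (0≤moment 0 (suc r) 0≤u) (0≤-^ (suc r) 0≤N))
  moment-lower N 1 (suc r) u 0≤N 0≤u big = ℚₚ.≤-trans (ℚₚ.≤-reflexive (ℚₚ.*-zeroˡ (mass 1 u)))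
    (0≤-* (0≤moment 1 (suc r) 0≤u) (0≤-^ (suc r) 0≤N))
  moment-lower N 2 (suc r) u 0≤N 0≤u big = ℚₚ.≤-trans
    (ℚₚ.≤-reflexive (trans (cong (λ k → ⟦ k C suc r ⟧ * mass 2 u) (ℕₚ.0∸n≡0 (r ℕ.* 2))) (ℚₚ.*-zeroˡ (mass 2 u))))
    (0≤-* (0≤moment 2 (suc r) 0≤u) (0≤-^ (suc r) 0≤N))
  moment-lower N (suc (suc (suc n))) (suc r) u 0≤N 0≤u big = begin
    ⟦ c ⟧ * mass (suc (suc (suc n))) u
      ≤⟨ *-monoʳ _ (0≤mass (suc (suc (suc n))) 0≤u) (ℚₚ.≤-trans (⟦⟧-mono (pascal-double n r)) (ℚₚ.≤-reflexive (⟦⟧-+ c₁ c₂))) ⟩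
    (⟦ c₁ ⟧ + ⟦ c₂ ⟧) * mass (suc (suc (suc n))) u
      ≡⟨ ℚₚ.*-distribʳ-+ (mass (suc (suc (suc n))) u) ⟦ c₁ ⟧ ⟦ c₂ ⟧ ⟩
    ⟦ c₁ ⟧ * mass (suc (suc (suc n))) u + ⟦ c₂ ⟧ * mass (suc (suc (suc n))) u
      ≡⟨ cong₂ (λ x y → ⟦ c₁ ⟧ * x + ⟦ c₂ ⟧ * y) (mass-suc (suc (suc n)) u) (mass-suc³ n u) ⟩
    ⟦ c₁ ⟧ * (T u * mass (suc (suc n)) (u + α)) + ⟦ c₂ ⟧ * (T u * mass n (u + α) * s * (T (u + α) + ⟦ suc n ⟧ * γ))
      ≤⟨ ℚₚ.+-monoʳ-≤ (⟦ c₁ ⟧ * (T u * mass (suc (suc n)) (u + α))) (*-monoˡ ⟦ c₂ ⟧ 0≤⟦ c₂ ⟧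
           (*-monoˡ (T u * mass n (u + α) * s) (0≤-* (0≤-* (0≤T 0≤u) (0≤mass n (0≤shift 0≤u))) 0≤s) s′≤Nγ)) ⟩
    ⟦ c₁ ⟧ * (T u * mass (suc (suc n)) (u + α)) + ⟦ c₂ ⟧ * (T u * mass n (u + α) * s * (N * γ))
      ≡⟨ solve 8 (λ a b t p m s n g → a :* (t :* p) :+ b :* (t :* m :* s :* (n :* g))
           := t :* (a :* p) :+ t :* g :* n :* (b :* (m :* s))) refl
           ⟦ c₁ ⟧ ⟦ c₂ ⟧ (T u) (mass (suc (suc n)) (u + α)) (mass n (u + α)) s N γ ⟩
    T u * (⟦ c₁ ⟧ * mass (suc (suc n)) (u + α)) + T u * γ * N * (⟦ c₂ ⟧ * (mass n (u + α) * s))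
      ≡⟨ cong (λ x → T u * (⟦ c₁ ⟧ * mass (suc (suc n)) (u + α)) + T u * γ * N * (⟦ c₂ ⟧ * x)) (sym (mass-shift n u)) ⟩
    T u * (⟦ c₁ ⟧ * mass (suc (suc n)) (u + α)) + T u * γ * N * (⟦ c₂ ⟧ * (T (u + α) * mass n (u + α + α)))
      ≡⟨ solve 8 (λ t x g n c t′ m z → t :* x :+ t :* g :* n :* (c :* (t′ :* m))
           := t :* x :+ t :* g :* n :* t′ :* (c :* m)) refl
           (T u) (⟦ c₁ ⟧ * mass (suc (suc n)) (u + α)) γ N ⟦ c₂ ⟧ (T (u + α)) (mass n (u + α + α)) 0ℚ ⟩
    T u * (⟦ c₁ ⟧ * mass (suc (suc n)) (u + α)) + T u * γ * N * T (u + α) * (⟦ c₂ ⟧ * mass n (u + α + α))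
      ≤⟨ ℚₚ.+-mono-≤ (*-monoˡ (T u) (0≤T 0≤u) (moment-lower N (suc (suc n)) (suc r) (u + α) 0≤N (0≤shift 0≤u) big₁))
           (*-monoˡ (T u * γ * N * T (u + α)) (0≤-* (0≤-* (0≤-* (0≤T 0≤u) 0≤γ) 0≤N) (0≤T (0≤shift 0≤u)))
             (moment-lower N n r (u + α + α) 0≤N (0≤shift (0≤shift 0≤u)) big₂)) ⟩
    T u * (m₁ * (N * N ^ r)) + T u * γ * N * T (u + α) * (m₂ * N ^ r)
      ≤⟨ ≤-by ((T u * γ * (γ * m₃) + T u * γ * α * T (u + α) * m₄) * (N * N ^ r))
           (0≤-* (0≤-+ (0≤-* (0≤-* (0≤T 0≤u) 0≤γ) (0≤-* 0≤γ (0≤moment n r (0≤shift 0≤u))))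
                       (0≤-* (0≤-* (0≤-* (0≤-* (0≤T 0≤u) 0≤γ) 0≤α) (0≤T (0≤shift 0≤u))) (0≤rest n r (0≤shift (0≤shift 0≤u)))))
             (0≤-^ (suc r) 0≤N))
           (solve 10 (λ t g a t′ m₁ m₂ m₃ m₄ n q →
               t :* (m₁ :* (n :* q)) :+ t :* g :* n :* t′ :* (m₂ :* q) :+ (t :* g :* (g :* m₃) :+ t :* g :* a :* t′ :* m₄) :* (n :* q)
               := (t :* m₁ :+ t :* g :* (t′ :* m₂ :+ g :* m₃) :+ t :* g :* a :* t′ :* m₄) :* (n :* q)) refl
             (T u) γ α (T (u + α)) m₁ m₂ m₃ m₄ N (N ^ r)) ⟩
    (T u * m₁ + T u * γ * (T (u + α) * m₂ + γ * m₃) + T u * γ * α * T (u + α) * m₄) * (N * N ^ r)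
      ≡⟨ cong (_* (N * N ^ r)) (sym (moment-suc³ n r u)) ⟩
    moment (suc (suc (suc n))) (suc r) u * N ^ suc r ∎
    where
    open ℚₚ.≤-Reasoning
    c  = (suc (suc (suc n)) ℕ.∸ suc r ℕ.* 2) C suc r
    c₁ = (suc (suc n) ℕ.∸ suc r ℕ.* 2) C suc r
    c₂ = (n ℕ.∸ r ℕ.* 2) C r
    s  = T (u + α) + ⟦ n ⟧ * γ
    m₁ = moment (suc (suc n)) (suc r) (u + α)
    m₂ = moment n r (u + α + α)
    m₃ = moment n r (u + α)
    m₄ = rest n r (u + α + α)
    0≤s : 0ℚ ≤ s
    0≤s = 0≤-+ (0≤T (0≤shift 0≤u)) (0≤-* 0≤⟦ n ⟧ 0≤γ)
    big₁ : T (u + α) + ⟦ suc (suc n) ⟧ * γ ≤ (N + 1ℚ) * γ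
    big₁ = ℚₚ.≤-trans (ℚₚ.≤-reflexive (trans (cong (_+ ⟦ suc (suc n) ⟧ * γ) (T-shift u))
      (solve 3 (λ t g k → t :+ g :+ (con 1ℚ :+ (con 1ℚ :+ k)) :* g := t :+ (con 1ℚ :+ (con 1ℚ :+ (con 1ℚ :+ k))) :* g)
            refl (T u) γ ⟦ n ⟧))) big
    big₂ : T (u + α + α) + ⟦ n ⟧ * γ ≤ (N + 1ℚ) * γ
    big₂ = ℚₚ.≤-trans (≤-by γ 0≤γ (trans (cong (λ t → t + ⟦ n ⟧ * γ + γ) (trans (T-shift (u + α)) (cong (_+ γ) (T-shift u))))
      (solve 3 (λ t g k → t :+ g :+ g :+ k :* g :+ g := t :+ (con 1ℚ :+ (con 1ℚ :+ (con 1ℚ :+ k))) :* g) refl (T u) γ ⟦ n ⟧))) big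
    s′≤Nγ : T (u + α) + ⟦ suc n ⟧ * γ ≤ N * γ
    s′≤Nγ = subst₂ _≤_
      (trans (solve 3 (λ t g k → t :+ (con 1ℚ :+ (con 1ℚ :+ (con 1ℚ :+ k))) :* g :- g := t :+ g :+ (con 1ℚ :+ k) :* g)
            refl (T u) γ ⟦ n ⟧)
        (cong (_+ ⟦ suc n ⟧ * γ) (sym (T-shift u))))
      (solve 2 (λ n g → (n :+ con 1ℚ) :* g :- g := n :* g) refl N γ)
      (ℚₚ.+-monoˡ-≤ (- γ) big)

  -- C(n + r - 1, r - 1), with value 0 at r = 0, where `rest` vanishes.
  extra : ℕ → ℕ → ℕ
  extra n zero    = 0
  extra n (suc r) = (n ℕ.+ r) C r

  -- The r added inside C(n + r, r) makes room for a third term. Pascal's rule leaves C(n + r + 3,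
  -- r), and for positive r it splits once more into one binomial for each of the two remaining
  -- terms.
  pascal-upper : ∀ n r → (suc (suc n) ℕ.+ suc r) C suc r ℕ.+ (n ℕ.+ r) C r ℕ.+ extra n r
                         ℕ.≤ (suc (suc (suc n)) ℕ.+ suc r) C suc r
  pascal-upper n r = begin
    m C suc r ℕ.+ (n ℕ.+ r) C r ℕ.+ extra n r     ≡⟨ ℕₚ.+-assoc (m C suc r) ((n ℕ.+ r) C r) (extra n r) ⟩
    m C suc r ℕ.+ ((n ℕ.+ r) C r ℕ.+ extra n r)   ≤⟨ ℕₚ.+-monoʳ-≤ (m C suc r) (lower r) ⟩
    m C suc r ℕ.+ m C r                           ≡⟨ ℕₚ.+-comm (m C suc r) (m C r) ⟩
    m C r ℕ.+ m C suc r                           ≡⟨ nCk+nC[k+1]≡[n+1]C[k+1] m r ⟩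
    suc m C suc r                                 ∎
    where
    open ℕₚ.≤-Reasoning
    m = suc (suc n) ℕ.+ suc r
    lower : ∀ r → (n ℕ.+ r) C r ℕ.+ extra n r ℕ.≤ (suc (suc n) ℕ.+ suc r) C r
    lower zero    = ℕₚ.≤-trans (ℕₚ.≤-reflexive (ℕₚ.+-identityʳ ((n ℕ.+ 0) C 0))) (C-mono 0 (ℕₚ.+-mono-≤ (ℕₚ.m≤n+m n 2) (z≤n {1})))
    lower (suc q) = begin
      (n ℕ.+ suc q) C suc q ℕ.+ (n ℕ.+ q) C q
        ≤⟨ ℕₚ.+-mono-≤ (C-mono (suc q) (ℕₚ.+-mono-≤ (ℕₚ.n≤1+n n) (ℕₚ.n≤1+n (suc q))))
             (C-mono q (ℕₚ.+-mono-≤ (ℕₚ.n≤1+n n) (ℕₚ.m≤n+m q 2))) ⟩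
      (suc n ℕ.+ suc (suc q)) C suc q ℕ.+ (suc n ℕ.+ suc (suc q)) C q
        ≡⟨ ℕₚ.+-comm ((suc n ℕ.+ suc (suc q)) C suc q) ((suc n ℕ.+ suc (suc q)) C q) ⟩
      (suc n ℕ.+ suc (suc q)) C q ℕ.+ (suc n ℕ.+ suc (suc q)) C suc q
        ≡⟨ nCk+nC[k+1]≡[n+1]C[k+1] (suc n ℕ.+ suc (suc q)) q ⟩
      (suc (suc n) ℕ.+ suc (suc q)) C suc q ∎

  -- The recursion lowers T u + nγ by at most 2γ whenever it lowers r by one, so
  -- this hypothesis of the upper bound is inherited.
  Room : ℚ → ℕ → ℕ → ℚ → Set
  Room L n r u = (L + (1ℚ + 1ℚ) + ⟦ r ℕ.* 2 ⟧) * γ ≤ T u + ⟦ n ⟧ * γ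

  module _ (L : ℚ) (n r : ℕ) (u : ℚ) where
    room-1 : Room L (suc (suc (suc n))) (suc r) u → Room L (suc (suc n)) (suc r) (u + α)
    room-1 big = ℚₚ.≤-trans big (ℚₚ.≤-reflexive (sym (trans (cong (_+ ⟦ suc (suc n) ⟧ * γ) (T-shift u))
      (solve 3 (λ t g k → t :+ g :+ (con 1ℚ :+ (con 1ℚ :+ k)) :* g := t :+ (con 1ℚ :+ (con 1ℚ :+ (con 1ℚ :+ k))) :* g)
            refl (T u) γ ⟦ n ⟧))))

    room-2 : Room L (suc (suc (suc n))) (suc r) u → Room L n r (u + α)
    room-2 big = subst₂ _≤_
      (solve 3 (λ l d g → (l :+ (con 1ℚ :+ con 1ℚ) :+ (con 1ℚ :+ (con 1ℚ :+ d))) :* g :- (g :+ g)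
        := (l :+ (con 1ℚ :+ con 1ℚ) :+ d) :* g) refl L ⟦ r ℕ.* 2 ⟧ γ)
      (trans (solve 3 (λ t g k → t :+ (con 1ℚ :+ (con 1ℚ :+ (con 1ℚ :+ k))) :* g :- (g :+ g) := t :+ g :+ k :* g)
            refl (T u) γ ⟦ n ⟧)
        (cong (_+ ⟦ n ⟧ * γ) (sym (T-shift u))))
      (ℚₚ.+-monoˡ-≤ (- (γ + γ)) big)

    room-3 : Room L n r u → Room L n r (u + α)
    room-3 big = ℚₚ.≤-trans big (≤-by γ 0≤γ (trans (solve 3 (λ t k g → t :+ k :* g :+ g := t :+ g :+ k :* g) refl (T u) ⟦ n ⟧ γ)
      (cong (_+ ⟦ n ⟧ * γ) (sym (T-shift u)))))

    room-4 : Room L (suc n) (suc r) u → Room L n r u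
    room-4 big = ℚₚ.≤-trans
      (≤-by γ 0≤γ (solve 3 (λ l d g → (l :+ (con 1ℚ :+ con 1ℚ) :+ d) :* g :+ g
        := (l :+ (con 1ℚ :+ con 1ℚ) :+ (con 1ℚ :+ (con 1ℚ :+ d))) :* g :- g) refl L ⟦ r ℕ.* 2 ⟧ γ))
      (ℚₚ.≤-trans (ℚₚ.+-monoˡ-≤ (- γ) big) (ℚₚ.≤-reflexive
        (solve 3 (λ t k g → t :+ (con 1ℚ :+ k) :* g :- g := t :+ k :* g) refl (T u) ⟦ n ⟧ γ)))

  -- In the mass of size n + 3 the last two factors are `s` and s + γ. Both are at least γL, so each
  -- absorbs one surplus factor L.
  upper-step : ∀ L n r u → 0ℚ ≤ L → 0ℚ ≤ u → γ * L ≤ T (u + α) + ⟦ n ⟧ * γ →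
    moment (suc (suc n)) (suc r) (u + α) * L ^ suc r ≤ ⟦ (suc (suc n) ℕ.+ suc r) C suc r ⟧ * mass (suc (suc n)) (u + α) →
    moment n r (u + α + α) * L ^ r ≤ ⟦ (n ℕ.+ r) C r ⟧ * mass n (u + α + α) →
    moment n r (u + α) * L ^ r ≤ ⟦ (n ℕ.+ r) C r ⟧ * mass n (u + α) →
    α * T (u + α) * L * (rest n r (u + α + α) * L ^ r) ≤ ⟦ extra n r ⟧ * (γ * L * L) * mass n (u + α) →
    moment (suc (suc (suc n))) (suc r) u * L ^ suc r ≤ ⟦ (suc (suc (suc n)) ℕ.+ suc r) C suc r ⟧ * mass (suc (suc (suc n))) u
  upper-step L n r u 0≤L 0≤u g≤s ih₁ ih₂ ih₃ ih₄ = begin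
    moment (suc (suc (suc n))) (suc r) u * (L * L ^ r)
      ≡⟨ cong (_* (L * L ^ r)) (moment-suc³ n r u) ⟩
    (T u * m₁ + T u * γ * (T (u + α) * m₂ + γ * m₃) + T u * γ * α * T (u + α) * m₄) * (L * L ^ r)
      ≡⟨ solve 10 (λ t g a t′ m₁ m₂ m₃ m₄ n q →
           (t :* m₁ :+ t :* g :* (t′ :* m₂ :+ g :* m₃) :+ t :* g :* a :* t′ :* m₄) :* (n :* q)
           := t :* (m₁ :* (n :* q)) :+ t :* g :* n :* (t′ :* (m₂ :* q) :+ g :* (m₃ :* q)) :+ t :* g :* a :* t′ :* n :* (m₄ :* q)) refl
           (T u) γ α (T (u + α)) m₁ m₂ m₃ m₄ L (L ^ r) ⟩
    T u * (m₁ * L ^ suc r) + T u * γ * L * (T (u + α) * (m₂ * L ^ r) + γ * (m₃ * L ^ r))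
      + T u * γ * α * T (u + α) * L * (m₄ * L ^ r)
      ≤⟨ ℚₚ.+-mono-≤ (ℚₚ.+-mono-≤ part₁ part₂) part₃ ⟩
    c₁ * P + c₂ * P + c₃ * P
      ≡⟨ solve 4 (λ a b c p → a :* p :+ b :* p :+ c :* p := (a :+ b :+ c) :* p) refl c₁ c₂ c₃ P ⟩
    (c₁ + c₂ + c₃) * P
      ≤⟨ *-monoʳ P (0≤mass (suc (suc (suc n))) 0≤u) (ℚₚ.≤-trans
           (ℚₚ.≤-reflexive (sym (trans (⟦⟧-+ (i₁ ℕ.+ (n ℕ.+ r) C r) (extra n r)) (cong (_+ c₃) (⟦⟧-+ i₁ ((n ℕ.+ r) C r))))))
           (⟦⟧-mono (pascal-upper n r))) ⟩
    ⟦ (suc (suc (suc n)) ℕ.+ suc r) C suc r ⟧ * P ∎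
    where
    open ℚₚ.≤-Reasoning
    P  = mass (suc (suc (suc n))) u
    i₁ = (suc (suc n) ℕ.+ suc r) C suc r
    c₁ = ⟦ i₁ ⟧
    c₂ = ⟦ (n ℕ.+ r) C r ⟧
    c₃ = ⟦ extra n r ⟧
    s  = T (u + α) + ⟦ n ⟧ * γ
    Y  = T u * mass n (u + α)
    m₁ = moment (suc (suc n)) (suc r) (u + α)
    m₂ = moment n r (u + α + α)
    m₃ = moment n r (u + α)
    m₄ = rest n r (u + α + α)
    0≤u′ = 0≤shift 0≤u
    0≤s : 0ℚ ≤ s
    0≤s = 0≤-+ (0≤T 0≤u′) (0≤-* 0≤⟦ n ⟧ 0≤γ)
    0≤Y : 0ℚ ≤ Y
    0≤Y = 0≤-* (0≤T 0≤u) (0≤mass n 0≤u′)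
    0≤g : 0ℚ ≤ γ * L
    0≤g = 0≤-* 0≤γ 0≤L
    P≡ : P ≡ Y * s * (s + γ)
    P≡ = trans (mass-suc³ n u) (cong (Y * s *_)
      (solve 3 (λ t g k → t :+ (con 1ℚ :+ k) :* g := t :+ k :* g :+ g) refl (T (u + α)) γ ⟦ n ⟧))
    g≤s+γ : γ * L ≤ s + γ
    g≤s+γ = ℚₚ.≤-trans g≤s (≤-by γ 0≤γ refl)
    part₁ : T u * (m₁ * L ^ suc r) ≤ c₁ * P
    part₁ = begin
      T u * (m₁ * L ^ suc r)                        ≤⟨ *-monoˡ (T u) (0≤T 0≤u) ih₁ ⟩
      T u * (c₁ * mass (suc (suc n)) (u + α))       ≡⟨ solve 3 (λ t c p → t :* (c :* p) := c :* (t :* p))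
            refl (T u) c₁ (mass (suc (suc n)) (u + α)) ⟩
      c₁ * (T u * mass (suc (suc n)) (u + α))       ≡⟨ cong (c₁ *_) (sym (mass-suc (suc (suc n)) u)) ⟩
      c₁ * P                                        ∎
    part₂ : T u * γ * L * (T (u + α) * (m₂ * L ^ r) + γ * (m₃ * L ^ r)) ≤ c₂ * P
    part₂ = begin
      T u * γ * L * (T (u + α) * (m₂ * L ^ r) + γ * (m₃ * L ^ r))
        ≤⟨ *-monoˡ (T u * γ * L) (0≤-* (0≤-* (0≤T 0≤u) 0≤γ) 0≤L) (ℚₚ.+-mono-≤
             (*-monoˡ (T (u + α)) (0≤T 0≤u′) ih₂)
             (*-monoˡ γ 0≤γ ih₃)) ⟩
      T u * γ * L * (T (u + α) * (c₂ * mass n (u + α + α)) + γ * (c₂ * mass n (u + α)))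
        ≡⟨ solve 7 (λ t g l t′ c p q → t :* g :* l :* (t′ :* (c :* p) :+ g :* (c :* q)) := t :* g :* l :* c :* (t′ :* p :+ g :* q)) refl
             (T u) γ L (T (u + α)) c₂ (mass n (u + α + α)) (mass n (u + α)) ⟩
      T u * γ * L * c₂ * (T (u + α) * mass n (u + α + α) + γ * mass n (u + α))
        -- The terms `m₂` and `m₃` together give `mass n (u + α)` times s + γ, which is exactly the
        -- last factor of P. The only loss is γL ≤ `s`.
        ≡⟨ cong (λ x → T u * γ * L * c₂ * (x + γ * mass n (u + α))) (mass-shift n u) ⟩
      T u * γ * L * c₂ * (mass n (u + α) * s + γ * mass n (u + α))
        ≡⟨ solve 6 (λ t g l c p s → t :* g :* l :* c :* (p :* s :+ g :* p) := c :* (t :* p :* (g :* l) :* (s :+ g))) refl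
             (T u) γ L c₂ (mass n (u + α)) s ⟩
      c₂ * (Y * (γ * L) * (s + γ))
        ≤⟨ *-monoˡ c₂ 0≤⟦ (n ℕ.+ r) C r ⟧ (*-monoʳ (s + γ) (0≤-+ 0≤s 0≤γ) (*-monoˡ Y 0≤Y g≤s)) ⟩
      c₂ * (Y * s * (s + γ))
        ≡⟨ cong (c₂ *_) (sym P≡) ⟩
      c₂ * P ∎
    part₃ : T u * γ * α * T (u + α) * L * (m₄ * L ^ r) ≤ c₃ * P
    part₃ = begin
      T u * γ * α * T (u + α) * L * (m₄ * L ^ r)
        ≡⟨ solve 6 (λ t g a t′ l x → t :* g :* a :* t′ :* l :* x := t :* g :* (a :* t′ :* l :* x)) refl
             (T u) γ α (T (u + α)) L (m₄ * L ^ r) ⟩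
      T u * γ * (α * T (u + α) * L * (m₄ * L ^ r))
        ≤⟨ *-monoˡ (T u * γ) (0≤-* (0≤T 0≤u) 0≤γ) ih₄ ⟩
      T u * γ * (c₃ * (γ * L * L) * mass n (u + α))
        ≡⟨ solve 5 (λ t g c l m → t :* g :* (c :* (g :* l :* l) :* m) := c :* (t :* m :* (g :* l) :* (g :* l))) refl
             (T u) γ c₃ L (mass n (u + α)) ⟩
      c₃ * (Y * (γ * L) * (γ * L))
        ≤⟨ *-monoˡ c₃ 0≤⟦ extra n r ⟧ (*-mono-≤-nonNeg 0≤g (0≤-* 0≤Y 0≤s) (*-monoˡ Y 0≤Y g≤s) g≤s+γ) ⟩
      c₃ * (Y * s * (s + γ))
        ≡⟨ cong (c₃ *_) (sym P≡) ⟩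
      c₃ * P ∎

  rest-upper-0 : ∀ L n r u → 0ℚ ≤ L → 0ℚ ≤ u → rest n r (u + α) ≡ 0ℚ →
                 α * T u * L * (rest n r (u + α) * L ^ r) ≤ ⟦ extra n r ⟧ * (γ * L * L) * mass n u
  rest-upper-0 L n r u 0≤L 0≤u e = subst (_≤ ⟦ extra n r ⟧ * (γ * L * L) * mass n u)
    (sym (trans (cong (λ z → α * T u * L * (z * L ^ r)) e)
      (solve 2 (λ a q → a :* (con 0ℚ :* q) := con 0ℚ) refl (α * T u * L) (L ^ r))))
    (0≤-* (0≤-* 0≤⟦ extra n r ⟧ (0≤-* (0≤-* 0≤γ 0≤L) 0≤L)) (0≤mass n 0≤u))

  moment-upper : ∀ L n r u → 0ℚ ≤ L → 0ℚ ≤ u → Room L n r u →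
                 moment n r u * L ^ r ≤ ⟦ (n ℕ.+ r) C r ⟧ * mass n u
  -- In the recursion for order r + 1 this term has order r - 1, so two factors L are left over. One
  -- is paired with the γ on the right, the other with the γ that multiplies the term in
  -- `upper-step`.
  rest-upper : ∀ L n r u → 0ℚ ≤ L → 0ℚ ≤ u → Room L n r (u + α) →
               α * T u * L * (rest n r (u + α) * L ^ r) ≤ ⟦ extra n r ⟧ * (γ * L * L) * mass n u

  moment-upper L n zero u 0≤L 0≤u big = ℚₚ.≤-reflexive (trans (cong (_* 1ℚ) (moment-0 n u))
    (trans (ℚₚ.*-comm (mass n u) 1ℚ) (cong (_* mass n u) (sym (choose-0 (n ℕ.+ 0))))))
  moment-upper L 0 (suc r) u 0≤L 0≤u big = subst (_≤ ⟦ suc r C suc r ⟧ * mass 0 u)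
    (sym (trans (cong (_* L ^ suc r) (proj₁ (moment-small r u))) (ℚₚ.*-zeroˡ (L ^ suc r))))
    (0≤-* 0≤⟦ suc r C suc r ⟧ (0≤mass 0 0≤u))
  moment-upper L 1 (suc r) u 0≤L 0≤u big = subst (_≤ ⟦ suc (suc r) C suc r ⟧ * mass 1 u)
    (sym (trans (cong (_* L ^ suc r) (proj₁ (proj₂ (moment-small r u)))) (ℚₚ.*-zeroˡ (L ^ suc r))))
    (0≤-* 0≤⟦ suc (suc r) C suc r ⟧ (0≤mass 1 0≤u))
  moment-upper L 2 (suc r) u 0≤L 0≤u big = subst (_≤ ⟦ suc (suc (suc r)) C suc r ⟧ * mass 2 u)
    (sym (trans (cong (_* L ^ suc r) (proj₂ (proj₂ (moment-small r u)))) (ℚₚ.*-zeroˡ (L ^ suc r))))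
    (0≤-* 0≤⟦ suc (suc (suc r)) C suc r ⟧ (0≤mass 2 0≤u))
  moment-upper L (suc (suc (suc n))) (suc r) u 0≤L 0≤u big = upper-step L n r u 0≤L 0≤u
    (ℚₚ.≤-trans (≤-by ((1ℚ + 1ℚ + ⟦ r ℕ.* 2 ⟧) * γ) (0≤-* (0≤-+ (0≤-+ 0≤1 0≤1) 0≤⟦ r ℕ.* 2 ⟧) 0≤γ)
      (solve 3 (λ g l d → g :* l :+ (con 1ℚ :+ con 1ℚ :+ d) :* g := (l :+ (con 1ℚ :+ con 1ℚ) :+ d) :* g) refl γ L ⟦ r ℕ.* 2 ⟧))
      room₂)
    (moment-upper L (suc (suc n)) (suc r) (u + α) 0≤L (0≤shift 0≤u) (room-1 L n r u big))
    (moment-upper L n r (u + α + α) 0≤L (0≤shift (0≤shift 0≤u)) (room-3 L n r (u + α) room₂))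
    (moment-upper L n r (u + α) 0≤L (0≤shift 0≤u) room₂)
    (rest-upper L n r (u + α) 0≤L (0≤shift 0≤u) (room-3 L n r (u + α) room₂))
    where room₂ = room-2 L n r u big

  rest-upper L zero    r       u 0≤L 0≤u _   = rest-upper-0 L zero r u 0≤L 0≤u (rest-zero r (u + α))
  rest-upper L (suc n) zero    u 0≤L 0≤u _   = rest-upper-0 L (suc n) zero u 0≤L 0≤u (rest-0 (suc n) (u + α))
  rest-upper L (suc n) (suc r) u 0≤L 0≤u big = begin
    α * T u * L * (rest (suc n) (suc r) (u + α) * (L * L ^ r))
      ≡⟨ cong (λ z → α * T u * L * (z * (L * L ^ r))) (rest-suc n r (u + α)) ⟩
    α * T u * L * (β * moment n r (u + α) * (L * L ^ r))
      ≡⟨ solve 6 (λ a t l b m q → a :* t :* l :* (b :* m :* (l :* q)) := a :* b :* l :* l :* t :* (m :* q)) refl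
           α (T u) L β (moment n r (u + α)) (L ^ r) ⟩
    γ * L * L * T u * (moment n r (u + α) * L ^ r)
      ≤⟨ *-monoˡ (γ * L * L * T u) (0≤-* 0≤γLL (0≤T 0≤u)) (moment-upper L n r (u + α) 0≤L (0≤shift 0≤u) (room-4 L n r (u + α) big)) ⟩
    γ * L * L * T u * (⟦ (n ℕ.+ r) C r ⟧ * mass n (u + α))
      ≡⟨ solve 4 (λ g t c m → g :* t :* (c :* m) := c :* g :* (t :* m))
            refl (γ * L * L) (T u) ⟦ (n ℕ.+ r) C r ⟧ (mass n (u + α)) ⟩
    ⟦ (n ℕ.+ r) C r ⟧ * (γ * L * L) * (T u * mass n (u + α))
      ≡⟨ cong (⟦ (n ℕ.+ r) C r ⟧ * (γ * L * L) *_) (sym (mass-suc n u)) ⟩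
    ⟦ (n ℕ.+ r) C r ⟧ * (γ * L * L) * mass (suc n) u
      ≤⟨ *-monoʳ (mass (suc n) u) (0≤mass (suc n) 0≤u) (*-monoʳ (γ * L * L) 0≤γLL (⟦⟧-mono (C-mono r (ℕₚ.n≤1+n (n ℕ.+ r))))) ⟩
    ⟦ (suc n ℕ.+ r) C r ⟧ * (γ * L * L) * mass (suc n) u ∎
    where
    open ℚₚ.≤-Reasoning
    0≤γLL : 0ℚ ≤ γ * L * L
    0≤γLL = 0≤-* (0≤-* 0≤γ 0≤L) 0≤L

-- Fractions

/1-toℚᵘ : ∀ z → ℚ.toℚᵘ (z ℚ./ 1) ℚᵘ.≃ ℚᵘ.mkℚᵘ z 0
/1-toℚᵘ z = ℚₚ.toℚᵘ-fromℚᵘ (ℚᵘ.mkℚᵘ z 0)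

/1-+ : ∀ y z → (y ℤ.+ z) ℚ./ 1 ≡ y ℚ./ 1 + z ℚ./ 1
/1-+ y z = ℚₚ.toℚᵘ-injective (begin-equality
  ℚ.toℚᵘ ((y ℤ.+ z) ℚ./ 1)                  ≃⟨ /1-toℚᵘ (y ℤ.+ z) ⟩
  ℚᵘ.mkℚᵘ (y ℤ.+ z) 0                       ≃⟨ ℚᵘ.*≡* (cong (ℤ._* pos 1) (sym (cong₂ ℤ._+_ (ℤₚ.*-identityʳ y) (ℤₚ.*-identityʳ z)))) ⟩
  ℚᵘ.mkℚᵘ y 0 ℚᵘ.+ ℚᵘ.mkℚᵘ z 0              ≃⟨ ℚᵘₚ.≃-sym (ℚᵘₚ.+-cong (/1-toℚᵘ y) (/1-toℚᵘ z)) ⟩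
  ℚ.toℚᵘ (y ℚ./ 1) ℚᵘ.+ ℚ.toℚᵘ (z ℚ./ 1)    ≃⟨ ℚᵘₚ.≃-sym (ℚₚ.toℚᵘ-homo-+ (y ℚ./ 1) (z ℚ./ 1)) ⟩
  ℚ.toℚᵘ (y ℚ./ 1 + z ℚ./ 1)                ∎)
  where open ℚᵘₚ.≤-Reasoning

/1-neg : ∀ z → (ℤ.- z) ℚ./ 1 ≡ - (z ℚ./ 1)
/1-neg z = ℚₚ.toℚᵘ-injective (begin-equality
  ℚ.toℚᵘ ((ℤ.- z) ℚ./ 1)    ≃⟨ /1-toℚᵘ (ℤ.- z) ⟩
  ℚᵘ.- ℚᵘ.mkℚᵘ z 0          ≃⟨ ℚᵘₚ.≃-sym (ℚᵘₚ.-‿cong (/1-toℚᵘ z)) ⟩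
  ℚᵘ.- ℚ.toℚᵘ (z ℚ./ 1)     ≃⟨ ℚᵘₚ.≃-sym (ℚₚ.toℚᵘ-homo‿- (z ℚ./ 1)) ⟩
  ℚ.toℚᵘ (- (z ℚ./ 1))      ∎)
  where open ℚᵘₚ.≤-Reasoning

⟦⟧≡/1 : ∀ n → ⟦ n ⟧ ≡ pos n ℚ./ 1
⟦⟧≡/1 zero    = refl
⟦⟧≡/1 (suc n) = trans (cong (1ℚ +_) (⟦⟧≡/1 n)) (sym (/1-+ (pos 1) (pos n)))

/-*-cancel : ∀ z n .{{_ : ℕ.NonZero n}} → (z ℚ./ n) * ⟦ n ⟧ ≡ z ℚ./ 1
/-*-cancel z n@(suc n-1) = trans (cong ((z ℚ./ n) *_) (⟦⟧≡/1 n)) (ℚₚ.toℚᵘ-injective (begin-equality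
  ℚ.toℚᵘ ((z ℚ./ n) * (pos n ℚ./ 1))                 ≃⟨ ℚₚ.toℚᵘ-homo-* (z ℚ./ n) (pos n ℚ./ 1) ⟩
  ℚ.toℚᵘ (z ℚ./ n) ℚᵘ.* ℚ.toℚᵘ (pos n ℚ./ 1)         ≃⟨ ℚᵘₚ.*-cong (ℚₚ.toℚᵘ-fromℚᵘ (ℚᵘ.mkℚᵘ z n-1)) (/1-toℚᵘ (pos n)) ⟩
  ℚᵘ.mkℚᵘ z n-1 ℚᵘ.* ℚᵘ.mkℚᵘ (pos n) 0               ≃⟨ ℚᵘ.*≡* (trans (ℤₚ.*-identityʳ (z ℤ.* pos n))
                                                        (cong (z ℤ.*_) (cong (λ k → pos (suc k)) (sym (ℕₚ.*-identityʳ n-1))))) ⟩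
  ℚᵘ.mkℚᵘ z 0                                      ≃⟨ ℚᵘₚ.≃-sym (/1-toℚᵘ z) ⟩
  ℚ.toℚᵘ (z ℚ./ 1)                                 ∎))
  where open ℚᵘₚ.≤-Reasoning

0<⟦1+_⟧ : ∀ n → 0ℚ < ⟦ suc n ⟧
0<⟦1+ n ⟧ = ℚₚ.+-mono-<-≤ (ℚₚ.positive⁻¹ 1ℚ) 0≤⟦ n ⟧

0<⟦_⟧ : ∀ n .{{_ : ℕ.NonZero n}} → 0ℚ < ⟦ n ⟧
0<⟦ suc n ⟧ = 0<⟦1+ n ⟧

*-cancelʳ : ∀ {p q} c → 0ℚ < c → p * c ≡ q * c → p ≡ q
*-cancelʳ {p} {q} c 0<c e = ℚₚ.≤-antisym
  (ℚₚ.*-cancelʳ-≤-pos c {{ℚ.positive 0<c}} (ℚₚ.≤-reflexive e))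
  (ℚₚ.*-cancelʳ-≤-pos c {{ℚ.positive 0<c}} (ℚₚ.≤-reflexive (sym e)))

1/! : ℕ → ℚ
1/! r = ℚ._/_ (pos 1) (r !) {{r ℕₚ.!≢0}}

1/!-* : ∀ r → 1/! r * ⟦ r ! ⟧ ≡ 1ℚ
1/!-* r = /-*-cancel (pos 1) (r !) {{r ℕₚ.!≢0}}

0<! : ∀ r → 0ℚ < ⟦ r ! ⟧
0<! r = 0<⟦ r ! ⟧ {{r ℕₚ.!≢0}}

1/!-suc : ∀ r → ⟦ suc r ⟧ * 1/! (suc r) ≡ 1/! r
1/!-suc r = *-cancelʳ ⟦ r ! ⟧ (0<! r) (begin
  ⟦ suc r ⟧ * 1/! (suc r) * ⟦ r ! ⟧       ≡⟨ solve 3 (λ a b c → a :* b :* c := b :* (a :* c))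
        refl ⟦ suc r ⟧ (1/! (suc r)) ⟦ r ! ⟧ ⟩
  1/! (suc r) * (⟦ suc r ⟧ * ⟦ r ! ⟧)     ≡⟨ cong (1/! (suc r) *_) (sym (⟦⟧-* (suc r) (r !))) ⟩
  1/! (suc r) * ⟦ suc r ! ⟧               ≡⟨ 1/!-* (suc r) ⟩
  1ℚ                                      ≡⟨ sym (1/!-* r) ⟩
  1/! r * ⟦ r ! ⟧                         ∎)
  where open ≡-Reasoning

0≤1/! : ∀ r → 0ℚ ≤ 1/! r
0≤1/! r = ℚₚ.*-cancelʳ-≤-pos ⟦ r ! ⟧ {{ℚ.positive (0<! r)}}
  (subst₂ _≤_ (sym (ℚₚ.*-zeroˡ ⟦ r ! ⟧)) (sym (1/!-* r)) 0≤1)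

1/!≤1 : ∀ r → 1/! r ≤ 1ℚ
1/!≤1 r = ℚₚ.*-cancelʳ-≤-pos ⟦ r ! ⟧ {{ℚ.positive (0<! r)}}
  (subst₂ _≤_ (trans (ℚₚ.+-identityʳ 1ℚ) (sym (1/!-* r))) (sym (ℚₚ.*-identityˡ ⟦ r ! ⟧)) (⟦⟧-mono (ℕₚ.1≤n! r)))

expTerm-! : ∀ i → expTerm i * ⟦ i ! ⟧ ≡ (-1ℤ ℤ.^ i) ℚ./ 1
expTerm-! i = /-*-cancel (-1ℤ ℤ.^ i) (i !) {{i ℕₚ.!≢0}}

expTerm-suc : ∀ i → ⟦ suc i ⟧ * expTerm (suc i) ≡ - expTerm i
expTerm-suc i = *-cancelʳ ⟦ i ! ⟧ (0<! i) (begin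
  ⟦ suc i ⟧ * expTerm (suc i) * ⟦ i ! ⟧       ≡⟨ solve 3 (λ a b c → a :* b :* c := b :* (a :* c))
        refl ⟦ suc i ⟧ (expTerm (suc i)) ⟦ i ! ⟧ ⟩
  expTerm (suc i) * (⟦ suc i ⟧ * ⟦ i ! ⟧)     ≡⟨ cong (expTerm (suc i) *_) (sym (⟦⟧-* (suc i) (i !))) ⟩
  expTerm (suc i) * ⟦ suc i ! ⟧               ≡⟨ expTerm-! (suc i) ⟩
  (-1ℤ ℤ.* -1ℤ ℤ.^ i) ℚ./ 1                   ≡⟨ cong (ℚ._/ 1) (ℤₚ.-1*i≡-i (-1ℤ ℤ.^ i)) ⟩
  (ℤ.- (-1ℤ ℤ.^ i)) ℚ./ 1                     ≡⟨ /1-neg (-1ℤ ℤ.^ i) ⟩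
  - ((-1ℤ ℤ.^ i) ℚ./ 1)                       ≡⟨ cong -_ (sym (expTerm-! i)) ⟩
  - (expTerm i * ⟦ i ! ⟧)                     ≡⟨ ℚₚ.neg-distribˡ-* (expTerm i) ⟦ i ! ⟧ ⟩
  - expTerm i * ⟦ i ! ⟧                       ∎)
  where open ≡-Reasoning

-- Factorials and powers

absorption : ∀ m r → suc r ℕ.* (suc m C suc r) ≡ suc m ℕ.* (m C r)
absorption zero    zero    = refl
absorption zero    (suc r) = trans (ℕₚ.*-zeroʳ (suc (suc r))) refl
absorption (suc m) zero    = begin
  1 ℕ.* (suc (suc m) C 1)                   ≡⟨ cong (1 ℕ.*_) (sym (nCk+nC[k+1]≡[n+1]C[k+1] (suc m) 0)) ⟩
  1 ℕ.* (suc m C 0 ℕ.+ suc m C 1)           ≡⟨ ℕₚ.*-distribˡ-+ 1 (suc m C 0) (suc m C 1) ⟩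
  1 ℕ.* (suc m C 0) ℕ.+ 1 ℕ.* (suc m C 1)   ≡⟨ cong₂ ℕ._+_ (trans (ℕₚ.*-identityˡ (suc m C 0)) (nC0≡1 (suc m)))
                                                (trans (absorption m 0) (trans (cong (suc m ℕ.*_) (nC0≡1 m)) (ℕₚ.*-identityʳ (suc m)))) ⟩
  suc (suc m)                               ≡⟨ sym (trans (cong (suc (suc m) ℕ.*_) (nC0≡1 (suc m))) (ℕₚ.*-identityʳ (suc (suc m)))) ⟩
  suc (suc m) ℕ.* (suc m C 0)               ∎
  where open ≡-Reasoning
absorption (suc m) (suc r) = begin
  suc (suc r) ℕ.* (suc (suc m) C suc (suc r))
    ≡⟨ cong (suc (suc r) ℕ.*_) (sym (nCk+nC[k+1]≡[n+1]C[k+1] (suc m) (suc r))) ⟩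
  suc (suc r) ℕ.* (suc m C suc r ℕ.+ suc m C suc (suc r))
    ≡⟨ ℕₚ.*-distribˡ-+ (suc (suc r)) (suc m C suc r) (suc m C suc (suc r)) ⟩
  (suc m C suc r ℕ.+ suc r ℕ.* (suc m C suc r)) ℕ.+ suc (suc r) ℕ.* (suc m C suc (suc r))
    ≡⟨ cong₂ (λ x y → (suc m C suc r ℕ.+ x) ℕ.+ y) (absorption m r) (absorption m (suc r)) ⟩
  (suc m C suc r ℕ.+ suc m ℕ.* (m C r)) ℕ.+ suc m ℕ.* (m C suc r)
    ≡⟨ ℕₚ.+-assoc (suc m C suc r) (suc m ℕ.* (m C r)) (suc m ℕ.* (m C suc r)) ⟩
  suc m C suc r ℕ.+ (suc m ℕ.* (m C r) ℕ.+ suc m ℕ.* (m C suc r))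
    ≡⟨ cong (suc m C suc r ℕ.+_) (sym (ℕₚ.*-distribˡ-+ (suc m) (m C r) (m C suc r))) ⟩
  suc m C suc r ℕ.+ suc m ℕ.* (m C r ℕ.+ m C suc r)
    ≡⟨ cong (λ x → suc m C suc r ℕ.+ suc m ℕ.* x) (nCk+nC[k+1]≡[n+1]C[k+1] m r) ⟩
  suc (suc m) ℕ.* (suc m C suc r) ∎
  where open ≡-Reasoning

!*C-suc : ∀ m r → suc r ! ℕ.* (suc m C suc r) ≡ suc m ℕ.* (r ! ℕ.* (m C r))
!*C-suc m r = begin
  suc r ℕ.* r ! ℕ.* (suc m C suc r)       ≡⟨ cong (ℕ._* (suc m C suc r)) (ℕₚ.*-comm (suc r) (r !)) ⟩
  r ! ℕ.* suc r ℕ.* (suc m C suc r)       ≡⟨ ℕₚ.*-assoc (r !) (suc r) (suc m C suc r) ⟩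
  r ! ℕ.* (suc r ℕ.* (suc m C suc r))     ≡⟨ cong (r ! ℕ.*_) (absorption m r) ⟩
  r ! ℕ.* (suc m ℕ.* (m C r))             ≡⟨ ℕ-Solver.solve 3 (λ a b c → a ℕ-Solver.:* (b ℕ-Solver.:* c) ℕ-Solver.:= b ℕ-Solver.:* (a ℕ-Solver.:* c))
        refl (r !) (suc m) (m C r) ⟩
  suc m ℕ.* (r ! ℕ.* (m C r))             ∎
  where open ≡-Reasoning

!*C≤^ : ∀ m r → r ! ℕ.* (m C r) ℕ.≤ m ℕ.^ r
!*C≤^ m       zero    = ℕₚ.≤-reflexive (trans (ℕₚ.*-identityˡ (m C 0)) (nC0≡1 m))
!*C≤^ zero    (suc r) = ℕₚ.≤-reflexive (ℕₚ.*-zeroʳ (suc r !))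
!*C≤^ (suc m) (suc r) = ℕₚ.≤-trans (ℕₚ.≤-reflexive (!*C-suc m r))
  (ℕₚ.*-monoʳ-≤ (suc m) (ℕₚ.≤-trans (!*C≤^ m r) (ℕₚ.^-monoˡ-≤ r (ℕₚ.n≤1+n m))))

-- The right side is the product of j + 1, ..., j + r.
^≤!*C : ∀ j r → j ℕ.^ r ℕ.≤ r ! ℕ.* ((j ℕ.+ r) C r)
^≤!*C j zero    = ℕₚ.≤-reflexive (sym (trans (ℕₚ.*-identityˡ ((j ℕ.+ 0) C 0)) (nC0≡1 (j ℕ.+ 0))))
^≤!*C j (suc r) = ℕₚ.≤-trans (ℕₚ.*-mono-≤ (ℕₚ.m≤n⇒m≤1+n (ℕₚ.m≤m+n j r)) (^≤!*C j r))
  (ℕₚ.≤-reflexive (sym (trans (cong (λ m → suc r ! ℕ.* (m C suc r)) (ℕₚ.+-suc j r)) (!*C-suc (j ℕ.+ r) r))))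

2⁻-* : ∀ e → 2⁻ e * ⟦ 2 ℕ.^ e ⟧ ≡ 1ℚ
2⁻-* e = /-*-cancel (pos 1) (2 ℕ.^ e) {{ℕₚ.m^n≢0 2 e}}

archimedean : ∀ ε → 0ℚ < ε → ∃ λ K → 1ℚ ≤ ε * ⟦ K ⟧
archimedean ε 0<ε = let e , small = 2⁻-small ε 0<ε in
  2 ℕ.^ e , subst (_≤ ε * ⟦ 2 ℕ.^ e ⟧) (2⁻-* e) (*-monoʳ ⟦ 2 ℕ.^ e ⟧ 0≤⟦ 2 ℕ.^ e ⟧ small)

1<1+ : ∀ {p} → 0ℚ < p → 0ℚ < 1ℚ + p
1<1+ 0<p = ℚₚ.+-mono-< (ℚₚ.positive⁻¹ 1ℚ) 0<p

^-ratio : ∀ D r ε → 0ℚ < ε → ∃ λ N → ∀ j → N ℕ.≤ j → ⟦ j ℕ.+ D ⟧ ^ r ≤ (1ℚ + ε) * ⟦ j ⟧ ^ r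
^-ratio D zero    ε 0<ε = 0 , λ j _ → ≤-by ε (ℚₚ.<⇒≤ 0<ε) (solve 1 (λ e → con 1ℚ :+ e := (con 1ℚ :+ e) :* con 1ℚ) refl ε)
^-ratio D (suc r) ε 0<ε =
  let η , 0<η , η+η≡ε = halve ε 0<ε
      -- Chosen so that (1 + y)(1 + η) = 1 + 2η = 1 + ε.
      y = η * inv (1ℚ + η)
      0<y = *-pos 0<η (inv-pos (1<1+ 0<η))
      N , p = ^-ratio D r η 0<η
      K , 1≤yK = archimedean y 0<y
  in N ℕ.⊔ D ℕ.* K , λ j h → step η 0<η η+η≡ε j K 1≤yK (ℕₚ.m⊔n≤o⇒n≤o N (D ℕ.* K) h) (p j (ℕₚ.m⊔n≤o⇒m≤o N (D ℕ.* K) h))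
  where
  open ℚₚ.≤-Reasoning
  step : ∀ η → 0ℚ < η → η + η ≡ ε → ∀ j K → 1ℚ ≤ η * inv (1ℚ + η) * ⟦ K ⟧ → D ℕ.* K ℕ.≤ j →
         ⟦ j ℕ.+ D ⟧ ^ r ≤ (1ℚ + η) * ⟦ j ⟧ ^ r → ⟦ j ℕ.+ D ⟧ ^ suc r ≤ (1ℚ + ε) * ⟦ j ⟧ ^ suc r
  step η 0<η η+η≡ε j K 1≤yK DK≤j ih = begin
    ⟦ j ℕ.+ D ⟧ * ⟦ j ℕ.+ D ⟧ ^ r
      ≤⟨ *-mono-≤-nonNeg (0≤-^ r 0≤⟦ j ℕ.+ D ⟧) (0≤-* (ℚₚ.<⇒≤ (1<1+ 0<y)) 0≤⟦ j ⟧) D≤yj ih ⟩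
    (1ℚ + y) * ⟦ j ⟧ * ((1ℚ + η) * ⟦ j ⟧ ^ r)
      ≡⟨ solve 4 (λ e i j q → (con 1ℚ :+ e :* i) :* j :* ((con 1ℚ :+ e) :* q)
           := (con 1ℚ :+ e :+ e :* ((con 1ℚ :+ e) :* i)) :* (j :* q)) refl η (inv (1ℚ + η)) ⟦ j ⟧ (⟦ j ⟧ ^ r) ⟩
    (1ℚ + η + η * ((1ℚ + η) * inv (1ℚ + η))) * ⟦ j ⟧ ^ suc r
      ≡⟨ cong (λ x → (1ℚ + η + η * x) * ⟦ j ⟧ ^ suc r) (*-inv (1<1+ 0<η)) ⟩
    (1ℚ + η + η * 1ℚ) * ⟦ j ⟧ ^ suc r
      ≡⟨ cong (_* ⟦ j ⟧ ^ suc r) (trans (solve 1 (λ e → con 1ℚ :+ e :+ e :* con 1ℚ := con 1ℚ :+ (e :+ e))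
            refl η) (cong (1ℚ +_) η+η≡ε)) ⟩
    (1ℚ + ε) * ⟦ j ⟧ ^ suc r ∎
    where
    y = η * inv (1ℚ + η)
    0<y : 0ℚ < y
    0<y = *-pos 0<η (inv-pos (1<1+ 0<η))
    D≤yj : ⟦ j ℕ.+ D ⟧ ≤ (1ℚ + y) * ⟦ j ⟧
    D≤yj = begin
      ⟦ j ℕ.+ D ⟧                     ≡⟨ trans (⟦⟧-+ j D) (cong (⟦ j ⟧ +_) (sym (ℚₚ.*-identityʳ ⟦ D ⟧))) ⟩
      ⟦ j ⟧ + ⟦ D ⟧ * 1ℚ              ≤⟨ ℚₚ.+-monoʳ-≤ ⟦ j ⟧ (*-monoˡ ⟦ D ⟧ 0≤⟦ D ⟧ 1≤yK) ⟩
      ⟦ j ⟧ + ⟦ D ⟧ * (y * ⟦ K ⟧)     ≡⟨ cong (⟦ j ⟧ +_) (trans (solve 3 (λ d y k → d :* (y :* k) := y :* (d :* k))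
            refl ⟦ D ⟧ y ⟦ K ⟧)
                                          (cong (y *_) (sym (⟦⟧-* D K)))) ⟩
      ⟦ j ⟧ + y * ⟦ D ℕ.* K ⟧         ≤⟨ ℚₚ.+-monoʳ-≤ ⟦ j ⟧ (*-monoˡ y (ℚₚ.<⇒≤ 0<y) (⟦⟧-mono DK≤j)) ⟩
      ⟦ j ⟧ + y * ⟦ j ⟧               ≡⟨ solve 2 (λ j y → j :+ y :* j := (con 1ℚ :+ y) :* j) refl ⟦ j ⟧ y ⟩
      (1ℚ + y) * ⟦ j ⟧                ∎

∣p-q∣≤ : ∀ {p q d} → p ≤ q + d → q ≤ p + d → ∣ p - q ∣ ≤ d
∣p-q∣≤ {p} {q} {d} p≤ q≤ with ℚₚ.∣p∣≡p∨∣p∣≡-p (p - q)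
... | inj₁ e = subst₂ _≤_ (sym e) (solve 2 (λ q d → q :+ d :- q := d) refl q d) (ℚₚ.+-monoˡ-≤ (- q) p≤)
... | inj₂ e = subst₂ _≤_ (trans (solve 2 (λ p q → q :- p := :- (p :- q)) refl p q) (sym e))
  (solve 2 (λ p d → p :+ d :- p := d) refl p d) (ℚₚ.+-monoˡ-≤ (- p) q≤)

-- Where x ≤ m, the error ηx allowed by the last hypothesis is at most ηm, so both directions are
-- measured against m.
close-ratio : ∀ {x m} η → 0ℚ ≤ η → 0ℚ ≤ m → x ≤ (1ℚ + η) * m → m ≤ (1ℚ + η) * x → ∣ x - m ∣ ≤ η * m
close-ratio {x} {m} η 0≤η 0≤m x≤ m≤ = ∣p-q∣≤ (ℚₚ.≤-trans x≤ (ℚₚ.≤-reflexive (expand m))) other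
  where
  expand : ∀ y → (1ℚ + η) * y ≡ y + η * y
  expand y = solve 2 (λ e y → (con 1ℚ :+ e) :* y := y :+ e :* y) refl η y
  other : m ≤ x + η * m
  other with ℚₚ.≤-total x m
  ... | inj₁ x≤m = ℚₚ.≤-trans m≤ (ℚₚ.≤-trans (ℚₚ.≤-reflexive (expand x)) (ℚₚ.+-monoʳ-≤ x (*-monoˡ η 0≤η x≤m)))
  ... | inj₂ m≤x = ℚₚ.≤-trans m≤x (≤-by (η * m) (0≤-* 0≤η 0≤m) refl)

0<^ : ∀ {p} r → 0ℚ < p → 0ℚ < p ^ r
0<^ zero    0<p = ℚₚ.positive⁻¹ 1ℚ
0<^ (suc r) 0<p = *-pos 0<p (0<^ r 0<p)

-- Convergence of the binomial moments to 1/r!.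

module MomentLimits (α β : ℚ) (0≤α : 0ℚ ≤ α) (0≤β : 0ℚ ≤ β) where
  open Positive α β 0≤α 0≤β

  -- Here L = ℓ + 1 = n - 2r - 2, the largest value for which `Room` follows from nγ ≤ T + nγ. The
  -- successor makes division by L^r possible.
  scaled-upper : ∀ r ℓ η → ⟦ suc ℓ ℕ.+ (suc (suc (r ℕ.* 2)) ℕ.+ r) ⟧ ^ r ≤ (1ℚ + η) * ⟦ suc ℓ ⟧ ^ r →
                 let n = suc ℓ ℕ.+ suc (suc (r ℕ.* 2)) in
                 ⟦ r ! ⟧ * moment n r 1ℚ ≤ (1ℚ + η) * mass n 1ℚ
  scaled-upper r ℓ η ratio = ℚₚ.*-cancelʳ-≤-pos (⟦ suc ℓ ⟧ ^ r) {{ℚ.positive (0<^ r 0<⟦1+ ℓ ⟧)}} (begin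
    ⟦ r ! ⟧ * moment n r 1ℚ * ⟦ suc ℓ ⟧ ^ r
      ≡⟨ ℚₚ.*-assoc ⟦ r ! ⟧ (moment n r 1ℚ) (⟦ suc ℓ ⟧ ^ r) ⟩
    ⟦ r ! ⟧ * (moment n r 1ℚ * ⟦ suc ℓ ⟧ ^ r)
      ≤⟨ *-monoˡ ⟦ r ! ⟧ 0≤⟦ r ! ⟧ (moment-upper ⟦ suc ℓ ⟧ n r 1ℚ 0≤⟦ suc ℓ ⟧ 0≤1 room) ⟩
    ⟦ r ! ⟧ * (⟦ (n ℕ.+ r) C r ⟧ * mass n 1ℚ)
      ≡⟨ trans (sym (ℚₚ.*-assoc ⟦ r ! ⟧ ⟦ (n ℕ.+ r) C r ⟧ (mass n 1ℚ))) (cong (_* mass n 1ℚ) (sym (⟦⟧-* (r !) ((n ℕ.+ r) C r)))) ⟩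
    ⟦ r ! ℕ.* ((n ℕ.+ r) C r) ⟧ * mass n 1ℚ
      ≤⟨ *-monoʳ (mass n 1ℚ) (0≤mass n 0≤1) (⟦⟧-mono (!*C≤^ (n ℕ.+ r) r)) ⟩
    ⟦ (n ℕ.+ r) ℕ.^ r ⟧ * mass n 1ℚ
      ≡⟨ cong (_* mass n 1ℚ) (trans (⟦⟧-^ (n ℕ.+ r) r) (cong (λ k → ⟦ k ⟧ ^ r) (ℕₚ.+-assoc (suc ℓ) (suc (suc (r ℕ.* 2))) r))) ⟩
    ⟦ suc ℓ ℕ.+ (suc (suc (r ℕ.* 2)) ℕ.+ r) ⟧ ^ r * mass n 1ℚ
      ≤⟨ *-monoʳ (mass n 1ℚ) (0≤mass n 0≤1) ratio ⟩
    (1ℚ + η) * ⟦ suc ℓ ⟧ ^ r * mass n 1ℚ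
      ≡⟨ solve 3 (λ a b c → a :* b :* c := a :* c :* b) refl (1ℚ + η) (⟦ suc ℓ ⟧ ^ r) (mass n 1ℚ) ⟩
    (1ℚ + η) * mass n 1ℚ * ⟦ suc ℓ ⟧ ^ r ∎)
    where
    open ℚₚ.≤-Reasoning
    n = suc ℓ ℕ.+ suc (suc (r ℕ.* 2))
    room : Room ⟦ suc ℓ ⟧ n r 1ℚ
    room = ≤-by (T 1ℚ) (0≤T 0≤1) (trans
      (solve 4 (λ l d t g → (l :+ (con 1ℚ :+ con 1ℚ) :+ d) :* g :+ t := t :+ (l :+ (con 1ℚ :+ (con 1ℚ :+ d))) :* g) refl
        ⟦ suc ℓ ⟧ ⟦ r ℕ.* 2 ⟧ (T 1ℚ) γ)
      (cong (λ z → T 1ℚ + z * γ) (sym (⟦⟧-+ (suc ℓ) (suc (suc (r ℕ.* 2)))))))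

  -- At u = 1 the parameter T is α + β ≤ Bγ, so N = n + B is admissible in `moment-lower`. Writing n
  -- = j + 1 + 3r makes n - 2r equal to (j + 1) + r, the form bounded by `^≤!*C`.
  scaled-lower : ∀ B r j η → α + β ≤ ⟦ B ⟧ * (α * β) →
                 ⟦ suc j ℕ.+ (r ℕ.+ r ℕ.* 2 ℕ.+ B) ⟧ ^ r ≤ (1ℚ + η) * ⟦ suc j ⟧ ^ r →
                 let n = suc j ℕ.+ (r ℕ.+ r ℕ.* 2) in
                 mass n 1ℚ ≤ (1ℚ + η) * (⟦ r ! ⟧ * moment n r 1ℚ)
  scaled-lower B r j η T≤ ratio = ℚₚ.*-cancelʳ-≤-pos (⟦ suc j ⟧ ^ r) {{ℚ.positive (0<^ r 0<⟦1+ j ⟧)}} (begin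
    mass n 1ℚ * ⟦ suc j ⟧ ^ r
      ≡⟨ trans (ℚₚ.*-comm (mass n 1ℚ) (⟦ suc j ⟧ ^ r)) (cong (_* mass n 1ℚ) (sym (⟦⟧-^ (suc j) r))) ⟩
    ⟦ suc j ℕ.^ r ⟧ * mass n 1ℚ
      ≤⟨ *-monoʳ (mass n 1ℚ) (0≤mass n 0≤1) (⟦⟧-mono (^≤!*C (suc j) r)) ⟩
    ⟦ r ! ℕ.* choices ⟧ * mass n 1ℚ
      ≡⟨ trans (cong (_* mass n 1ℚ) (⟦⟧-* (r !) choices)) (ℚₚ.*-assoc ⟦ r ! ⟧ ⟦ choices ⟧ (mass n 1ℚ)) ⟩
    ⟦ r ! ⟧ * (⟦ choices ⟧ * mass n 1ℚ)
      ≡⟨ cong (λ k → ⟦ r ! ⟧ * (⟦ k C r ⟧ * mass n 1ℚ)) (sym n∸2r) ⟩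
    ⟦ r ! ⟧ * (⟦ (n ℕ.∸ r ℕ.* 2) C r ⟧ * mass n 1ℚ)
      ≤⟨ *-monoˡ ⟦ r ! ⟧ 0≤⟦ r ! ⟧ (moment-lower ⟦ N ⟧ n r 1ℚ 0≤⟦ N ⟧ 0≤1 room) ⟩
    ⟦ r ! ⟧ * (moment n r 1ℚ * ⟦ N ⟧ ^ r)
      ≤⟨ *-monoˡ ⟦ r ! ⟧ 0≤⟦ r ! ⟧ (*-monoˡ (moment n r 1ℚ) (0≤moment n r 0≤1) ratio) ⟩
    ⟦ r ! ⟧ * (moment n r 1ℚ * ((1ℚ + η) * ⟦ suc j ⟧ ^ r))
      ≡⟨ solve 4 (λ a b c d → a :* (b :* (c :* d)) := c :* (a :* b) :* d) refl ⟦ r ! ⟧ (moment n r 1ℚ) (1ℚ + η) (⟦ suc j ⟧ ^ r) ⟩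
    (1ℚ + η) * (⟦ r ! ⟧ * moment n r 1ℚ) * ⟦ suc j ⟧ ^ r ∎)
    where
    open ℚₚ.≤-Reasoning
    n = suc j ℕ.+ (r ℕ.+ r ℕ.* 2)
    N = suc j ℕ.+ (r ℕ.+ r ℕ.* 2 ℕ.+ B)
    choices = (suc j ℕ.+ r) C r
    n∸2r : n ℕ.∸ r ℕ.* 2 ≡ suc j ℕ.+ r
    n∸2r = trans (cong (ℕ._∸ r ℕ.* 2) (sym (ℕₚ.+-assoc (suc j) r (r ℕ.* 2)))) (ℕₚ.m+n∸n≡m (suc j ℕ.+ r) (r ℕ.* 2))
    N≡ : ⟦ N ⟧ ≡ ⟦ n ⟧ + ⟦ B ⟧
    N≡ = trans (cong ⟦_⟧ (sym (ℕₚ.+-assoc (suc j) (r ℕ.+ r ℕ.* 2) B))) (⟦⟧-+ n B)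
    room : T 1ℚ + ⟦ n ⟧ * γ ≤ (⟦ N ⟧ + 1ℚ) * γ
    room = begin
      T 1ℚ + ⟦ n ⟧ * γ              ≡⟨ cong (λ x → α + x + ⟦ n ⟧ * γ) (ℚₚ.*-identityʳ β) ⟩
      α + β + ⟦ n ⟧ * γ             ≤⟨ ℚₚ.+-monoˡ-≤ (⟦ n ⟧ * γ) T≤ ⟩
      ⟦ B ⟧ * γ + ⟦ n ⟧ * γ         ≤⟨ ≤-by γ 0≤γ (solve 3 (λ c n g → c :* g :+ n :* g :+ g := (n :+ c :+ con 1ℚ) :* g)
            refl ⟦ B ⟧ ⟦ n ⟧ γ) ⟩
      (⟦ n ⟧ + ⟦ B ⟧ + 1ℚ) * γ      ≡⟨ cong (λ z → (z + 1ℚ) * γ) (sym N≡) ⟩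
      (⟦ N ⟧ + 1ℚ) * γ              ∎

open MomentLimits

-- The parameters are quantified inside, so that one threshold for n serves all the rationals that
-- approximate α and β. The error is relative to the mass, which anticipates the normalisation.
MomentClose : ℕ → ℚ → ℕ → ℕ → Set
MomentClose B η r n = ∀ α β (0≤α : 0ℚ ≤ α) (0≤β : 0ℚ ≤ β) → α + β ≤ ⟦ B ⟧ * (α * β) →
  let open Positive α β 0≤α 0≤β in
  ∣ moment n r 1ℚ - 1/! r * mass n 1ℚ ∣ ≤ η * mass n 1ℚ

moment-limit : ∀ B r η → 0ℚ < η → ∃ λ N → ∀ n → N ℕ.≤ n → MomentClose B η r n
moment-limit B r η 0<η =
  let N₁ , up = ^-ratio (suc (suc (r ℕ.* 2)) ℕ.+ r) r η 0<η
      N₂ , lo = ^-ratio (r ℕ.+ r ℕ.* 2 ℕ.+ B) r η 0<η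
  in (suc N₁ ℕ.+ suc (suc (r ℕ.* 2))) ℕ.⊔ (suc N₂ ℕ.+ (r ℕ.+ r ℕ.* 2)) , λ n h α β 0≤α 0≤β T≤ →
     let open Positive α β 0≤α 0≤β
         h₁ = ℕₚ.m⊔n≤o⇒m≤o (suc N₁ ℕ.+ suc (suc (r ℕ.* 2))) (suc N₂ ℕ.+ (r ℕ.+ r ℕ.* 2)) h
         h₂ = ℕₚ.m⊔n≤o⇒n≤o (suc N₁ ℕ.+ suc (suc (r ℕ.* 2))) (suc N₂ ℕ.+ (r ℕ.+ r ℕ.* 2)) h
     in combine (moment n r 1ℚ) (mass n 1ℚ) (0≤mass n 0≤1)
       (split (suc (suc (r ℕ.* 2))) N₁ n h₁
         (λ m → ⟦ r ! ⟧ * moment m r 1ℚ ≤ (1ℚ + η) * mass m 1ℚ)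
         (λ ℓ N₁≤ℓ → scaled-upper α β 0≤α 0≤β r ℓ η (up (suc ℓ) (ℕₚ.m≤n⇒m≤1+n N₁≤ℓ))))
       (split (r ℕ.+ r ℕ.* 2) N₂ n h₂
         (λ m → mass m 1ℚ ≤ (1ℚ + η) * (⟦ r ! ⟧ * moment m r 1ℚ))
         (λ j N₂≤j → scaled-lower α β 0≤α 0≤β B r j η T≤ (lo (suc j) (ℕₚ.m≤n⇒m≤1+n N₂≤j))))
  where
  split : ∀ d N n → suc N ℕ.+ d ℕ.≤ n → (P : ℕ → Set) → (∀ k → N ℕ.≤ k → P (suc k ℕ.+ d)) → P n
  split d N n h P p = subst P (ℕₚ.m∸n+n≡m d≤n) (subst (λ k → P (k ℕ.+ d)) (ℕₚ.m+[n∸m]≡n 1≤) (p (n ℕ.∸ d ℕ.∸ 1) (ℕₚ.m+n≤o⇒m≤o∸n N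
      (subst (ℕ._≤ n ℕ.∸ d) (ℕₚ.+-comm 1 N) N<))))
    where
    d≤n = ℕₚ.≤-trans (ℕₚ.m≤n+m d (suc N)) h
    N< : suc N ℕ.≤ n ℕ.∸ d
    N< = ℕₚ.m+n≤o⇒m≤o∸n (suc N) h
    1≤ : 1 ℕ.≤ n ℕ.∸ d
    1≤ = ℕₚ.≤-trans (s≤s z≤n) N<
  combine : ∀ x m → 0ℚ ≤ m → ⟦ r ! ⟧ * x ≤ (1ℚ + η) * m → m ≤ (1ℚ + η) * (⟦ r ! ⟧ * x) → ∣ x - 1/! r * m ∣ ≤ η * m
  combine x m 0≤m up lo = begin
    ∣ x - 1/! r * m ∣
      ≡⟨ cong (λ y → ∣ y - 1/! r * m ∣) (trans (sym (ℚₚ.*-identityˡ x)) (trans (cong (_* x) (sym (1/!-* r))) (ℚₚ.*-assoc (1/! r) ⟦ r ! ⟧ x))) ⟩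
    ∣ 1/! r * (⟦ r ! ⟧ * x) - 1/! r * m ∣
      ≡⟨ cong ∣_∣ (solve 3 (λ a b c → a :* b :- a :* c := a :* (b :- c)) refl (1/! r) (⟦ r ! ⟧ * x) m) ⟩
    ∣ 1/! r * (⟦ r ! ⟧ * x - m) ∣
      ≡⟨ trans (ℚₚ.∣p*q∣≡∣p∣*∣q∣ (1/! r) (⟦ r ! ⟧ * x - m)) (cong (_* ∣ ⟦ r ! ⟧ * x - m ∣) (ℚₚ.0≤p⇒∣p∣≡p (0≤1/! r))) ⟩
    1/! r * ∣ ⟦ r ! ⟧ * x - m ∣
      ≤⟨ *-mono-≤-nonNeg (ℚₚ.0≤∣p∣ (⟦ r ! ⟧ * x - m)) 0≤1 (1/!≤1 r) (close-ratio η (ℚₚ.<⇒≤ 0<η) 0≤m up lo) ⟩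
    1ℚ * (η * m)
      ≡⟨ ℚₚ.*-identityˡ (η * m) ⟩
    η * m ∎
    where open ℚₚ.≤-Reasoning

-- Sums over initial segments

sumTo : ℕ → (ℕ → ℚ) → ℚ
sumTo zero    f = 0ℚ
sumTo (suc R) f = f 0 + sumTo R (f ∘ suc)

sumTo-cong : ∀ R {f g} → (∀ k → f k ≡ g k) → sumTo R f ≡ sumTo R g
sumTo-cong zero    e = refl
sumTo-cong (suc R) e = cong₂ _+_ (e 0) (sumTo-cong R (e ∘ suc))

sumTo-+ : ∀ R f g → sumTo R (λ k → f k + g k) ≡ sumTo R f + sumTo R g
sumTo-+ zero    f g = refl
sumTo-+ (suc R) f g = trans (cong (f 0 + g 0 +_) (sumTo-+ R (f ∘ suc) (g ∘ suc)))
  (solve 4 (λ a b c d → a :+ b :+ (c :+ d) := a :+ c :+ (b :+ d)) refl (f 0) (g 0) (sumTo R (f ∘ suc)) (sumTo R (g ∘ suc)))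

sumTo-* : ∀ R c f → sumTo R (λ k → c * f k) ≡ c * sumTo R f
sumTo-* zero    c f = sym (ℚₚ.*-zeroʳ c)
sumTo-* (suc R) c f = trans (cong (c * f 0 +_) (sumTo-* R c (f ∘ suc))) (sym (ℚₚ.*-distribˡ-+ c (f 0) (sumTo R (f ∘ suc))))

sumTo-0 : ∀ R → sumTo R (λ _ → 0ℚ) ≡ 0ℚ
sumTo-0 zero    = refl
sumTo-0 (suc R) = trans (ℚₚ.+-identityˡ (sumTo R (λ _ → 0ℚ))) (sumTo-0 R)

sumTo-last : ∀ R f → sumTo (suc R) f ≡ sumTo R f + f R
sumTo-last zero    f = ℚₚ.+-comm (f 0) 0ℚ
sumTo-last (suc R) f = trans (cong (f 0 +_) (sumTo-last R (f ∘ suc))) (sym (ℚₚ.+-assoc (f 0) (sumTo R (f ∘ suc)) (f (suc R))))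

expSum≡sumTo : ∀ R → expSum R ≡ sumTo R expTerm
expSum≡sumTo zero    = refl
expSum≡sumTo (suc R) = trans (cong (_+ expTerm R) (expSum≡sumTo R)) (sym (sumTo-last R expTerm))

-- Newton series

Δ^ : ℕ → (ℕ → ℚ) → ℕ → ℚ
Δ^ zero    h = h
Δ^ (suc r) h = Δ^ r (Δ h)

newton : ℕ → (ℕ → ℚ) → ℕ → ℚ
newton R h k = sumTo R (λ r → Δ^ r h 0 * choose r k)

2ℚ : ℚ
2ℚ = ⟦ 2 ⟧

Δ-bounded : ∀ {M} h → (∀ k → ∣ h k ∣ ≤ M) → ∀ k → ∣ Δ h k ∣ ≤ 2ℚ * M
Δ-bounded {M} h bound k = begin
  ∣ h (suc k) - h k ∣        ≤⟨ ℚₚ.∣p-q∣≤∣p∣+∣q∣ (h (suc k)) (h k) ⟩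
  ∣ h (suc k) ∣ + ∣ h k ∣    ≤⟨ ℚₚ.+-mono-≤ (bound (suc k)) (bound k) ⟩
  M + M                      ≡⟨ solve 1 (λ m → m :+ m := con 2ℚ :* m) refl M ⟩
  2ℚ * M                     ∎
  where open ℚₚ.≤-Reasoning

Δ^-bounded : ∀ {M} r h → (∀ k → ∣ h k ∣ ≤ M) → ∀ k → ∣ Δ^ r h k ∣ ≤ 2ℚ ^ r * M
Δ^-bounded {M} zero    h bound k = ℚₚ.≤-trans (bound k) (ℚₚ.≤-reflexive (sym (ℚₚ.*-identityˡ M)))
Δ^-bounded {M} (suc r) h bound k = ℚₚ.≤-trans (Δ^-bounded r (Δ h) (Δ-bounded h bound) k)
  (ℚₚ.≤-reflexive (solve 3 (λ t p m → p :* (t :* m) := t :* p :* m) refl 2ℚ (2ℚ ^ r) M))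

choose-suc : ∀ r k → choose (suc r) (suc k) ≡ choose r k + choose (suc r) k
choose-suc r k = trans (cong ⟦_⟧ (sym (nCk+nC[k+1]≡[n+1]C[k+1] k r))) (⟦⟧-+ (k C r) (k C suc r))

newton-0 : ∀ R h → newton (suc R) h 0 ≡ h 0
newton-0 R h = begin
  h 0 * 1ℚ + sumTo R (λ r → Δ^ r (Δ h) 0 * 0ℚ)   ≡⟨ cong₂ _+_ (ℚₚ.*-identityʳ (h 0)) (trans (sumTo-cong R (λ r → ℚₚ.*-zeroʳ (Δ^ r (Δ h) 0))) (sumTo-0 R)) ⟩
  h 0 + 0ℚ                                       ≡⟨ ℚₚ.+-identityʳ (h 0) ⟩
  h 0                                            ∎
  where open ≡-Reasoning

newton-suc : ∀ R h k → newton (suc R) h (suc k) ≡ newton (suc R) h k + newton R (Δ h) k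
newton-suc R h k = begin
  h 0 * choose 0 (suc k) + sumTo R (λ r → Δ^ r (Δ h) 0 * choose (suc r) (suc k))
    ≡⟨ cong₂ (λ x y → h 0 * x + y) (trans (choose-0 (suc k)) (sym (choose-0 k)))
         (trans (sumTo-cong R (λ r → trans (cong (Δ^ r (Δ h) 0 *_) (choose-suc r k)) (ℚₚ.*-distribˡ-+ (Δ^ r (Δ h) 0) (choose r k) (choose (suc r) k))))
           (sumTo-+ R (λ r → Δ^ r (Δ h) 0 * choose r k) (λ r → Δ^ r (Δ h) 0 * choose (suc r) k))) ⟩
  h 0 * choose 0 k + (newton R (Δ h) k + sumTo R (λ r → Δ^ r (Δ h) 0 * choose (suc r) k))
    ≡⟨ solve 3 (λ a b c → a :+ (b :+ c) := a :+ c :+ b)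
          refl (h 0 * choose 0 k) (newton R (Δ h) k) (sumTo R (λ r → Δ^ r (Δ h) 0 * choose (suc r) k)) ⟩
  newton (suc R) h k + newton R (Δ h) k ∎
  where open ≡-Reasoning

-- Δ of the remainder of order R + 1 is the remainder of order R for Δh.
newton-remainder : ∀ {M} R h → 0ℚ ≤ M → (∀ k → ∣ h k ∣ ≤ M) → ∀ k → ∣ h k - newton R h k ∣ ≤ 2ℚ ^ R * M * choose R k
newton-remainder {M} zero h 0≤M bound k = ℚₚ.≤-trans
  (ℚₚ.≤-reflexive (cong ∣_∣ (ℚₚ.+-identityʳ (h k))))
  (ℚₚ.≤-trans (bound k) (ℚₚ.≤-reflexive (sym (trans (cong (1ℚ * M *_) (choose-0 k)) (solve 1 (λ m → con 1ℚ :* m :* con 1ℚ := m)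
        refl M)))))
newton-remainder {M} (suc R) h 0≤M bound zero = ℚₚ.≤-trans
  (ℚₚ.≤-reflexive (cong ∣_∣ (trans (cong (λ x → h 0 - x) (newton-0 R h)) (ℚₚ.+-inverseʳ (h 0)))))
  (0≤-* (0≤-* (0≤-^ (suc R) 0≤⟦ 2 ⟧) 0≤M) 0≤⟦ 0 C suc R ⟧)
newton-remainder {M} (suc R) h 0≤M bound (suc k) = begin
  ∣ h (suc k) - newton (suc R) h (suc k) ∣
    ≡⟨ cong ∣_∣ (trans (cong (λ x → h (suc k) - x) (newton-suc R h k))
         (solve 4 (λ a b c d → a :- (c :+ d) := (b :- c) :+ ((a :- b) :- d))
               refl (h (suc k)) (h k) (newton (suc R) h k) (newton R (Δ h) k))) ⟩
  ∣ (h k - newton (suc R) h k) + (Δ h k - newton R (Δ h) k) ∣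
    ≤⟨ ℚₚ.∣p+q∣≤∣p∣+∣q∣ (h k - newton (suc R) h k) (Δ h k - newton R (Δ h) k) ⟩
  ∣ h k - newton (suc R) h k ∣ + ∣ Δ h k - newton R (Δ h) k ∣
    ≤⟨ ℚₚ.+-mono-≤ (newton-remainder (suc R) h 0≤M bound k)
         (newton-remainder R (Δ h) (0≤-* 0≤⟦ 2 ⟧ 0≤M) (Δ-bounded h bound) k) ⟩
  2ℚ ^ suc R * M * choose (suc R) k + 2ℚ ^ R * (2ℚ * M) * choose R k
    ≡⟨ solve 5 (λ t p m a b → t :* p :* m :* a :+ p :* (t :* m) :* b := t :* p :* m :* (b :+ a))
          refl 2ℚ (2ℚ ^ R) M (choose (suc R) k) (choose R k) ⟩
  2ℚ ^ suc R * M * (choose R k + choose (suc R) k)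
    ≡⟨ cong (2ℚ ^ suc R * M *_) (sym (choose-suc R k)) ⟩
  2ℚ ^ suc R * M * choose (suc R) (suc k) ∎
  where open ℚₚ.≤-Reasoning

-- Cauchy products

conv : (ℕ → ℚ) → (ℕ → ℚ) → ℕ → ℚ
conv f g zero    = f 0 * g 0
conv f g (suc n) = f 0 * g (suc n) + conv (f ∘ suc) g n

conv-cong : ∀ {f f′ g g′} → (∀ k → f k ≡ f′ k) → (∀ k → g k ≡ g′ k) → ∀ n → conv f g n ≡ conv f′ g′ n
conv-cong p q zero    = cong₂ _*_ (p 0) (q 0)
conv-cong p q (suc n) = cong₂ _+_ (cong₂ _*_ (p 0) (q (suc n))) (conv-cong (p ∘ suc) q n)

conv-+ˡ : ∀ f f′ g n → conv (λ k → f k + f′ k) g n ≡ conv f g n + conv f′ g n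
conv-+ˡ f f′ g zero    = ℚₚ.*-distribʳ-+ (g 0) (f 0) (f′ 0)
conv-+ˡ f f′ g (suc n) = trans (cong ((f 0 + f′ 0) * g (suc n) +_) (conv-+ˡ (f ∘ suc) (f′ ∘ suc) g n))
  (solve 5 (λ a b c x y → (a :+ b) :* c :+ (x :+ y) := (a :* c :+ x) :+ (b :* c :+ y)) refl
    (f 0) (f′ 0) (g (suc n)) (conv (f ∘ suc) g n) (conv (f′ ∘ suc) g n))

conv-neg : ∀ f g n → conv f (λ k → - g k) n ≡ conv (λ k → - f k) g n
conv-neg f g zero    = solve 2 (λ a b → a :* (:- b) := (:- a) :* b) refl (f 0) (g 0)
conv-neg f g (suc n) = cong₂ _+_ (solve 2 (λ a b → a :* (:- b) := (:- a) :* b) refl (f 0) (g (suc n))) (conv-neg (f ∘ suc) g n)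

-- Coefficients of the derivative of a power series
D : (ℕ → ℚ) → ℕ → ℚ
D f k = ⟦ suc k ⟧ * f (suc k)

-- The product rule for power series, by induction on the degree.
conv-D : ∀ f g n → ⟦ suc n ⟧ * conv f g (suc n) ≡ conv (D f) g n + conv f (D g) n
conv-D f g zero = solve 4 (λ a b c d → con 1ℚ :* (a :* d :+ b :* c) := (con 1ℚ :* b) :* c :+ a :* (con 1ℚ :* d))
      refl (f 0) (f 1) (g 0) (g 1)
conv-D f g (suc n) = begin
  ⟦ suc (suc n) ⟧ * (f 0 * g (suc (suc n)) + conv f⁺ g (suc n))
    ≡⟨ solve 4 (λ k a b x → (con 1ℚ :+ k) :* (a :* b :+ x) := a :* ((con 1ℚ :+ k) :* b) :+ x :+ k :* x) refl
         ⟦ suc n ⟧ (f 0) (g (suc (suc n))) (conv f⁺ g (suc n)) ⟩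
  f 0 * D g (suc n) + conv f⁺ g (suc n) + ⟦ suc n ⟧ * conv f⁺ g (suc n)
    ≡⟨ cong (f 0 * D g (suc n) + conv f⁺ g (suc n) +_) (conv-D f⁺ g n) ⟩
  f 0 * D g (suc n) + (f 1 * g (suc n) + conv (f⁺ ∘ suc) g n) + (conv (D f⁺) g n + conv f⁺ (D g) n)
    ≡⟨ solve 6 (λ a b c x y z → a :+ (b :* c :+ x) :+ (y :+ z) := (con 1ℚ :* b) :* c :+ (x :+ y) :+ (a :+ z)) refl
         (f 0 * D g (suc n)) (f 1) (g (suc n)) (conv (f⁺ ∘ suc) g n) (conv (D f⁺) g n) (conv f⁺ (D g) n) ⟩
  1ℚ * f 1 * g (suc n) + (conv (f⁺ ∘ suc) g n + conv (D f⁺) g n) + (f 0 * D g (suc n) + conv f⁺ (D g) n)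
    ≡⟨ cong (λ x → 1ℚ * f 1 * g (suc n) + x + (f 0 * D g (suc n) + conv f⁺ (D g) n)) (trans
         (sym (conv-+ˡ (f⁺ ∘ suc) (D f⁺) g n))
         (conv-cong (λ k → solve 2 (λ k x → x :+ (con 1ℚ :+ k) :* x := (con 1ℚ :+ (con 1ℚ :+ k)) :* x)
               refl ⟦ k ⟧ (f (suc (suc k)))) (λ _ → refl) n)) ⟩
  conv (D f) g (suc n) + conv f (D g) (suc n) ∎
  where
  open ≡-Reasoning
  f⁺ = f ∘ suc

egf : (ℕ → ℚ) → ℕ → ℚ
egf h k = h k * 1/! k

-- The exponential generating function of Δ^ r h 0 is that of h times exp(-x):
-- both sides satisfy (r + 1) yᵣ₊₁(h) = yᵣ(Δh).
Δ^-conv : ∀ r h → Δ^ r h 0 * 1/! r ≡ conv (egf h) expTerm r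
Δ^-conv zero h = solve 1 (λ x → x :* con 1ℚ := x :* con 1ℚ :* con 1ℚ) refl (h 0)
Δ^-conv (suc r) h = *-cancelʳ ⟦ suc r ⟧ 0<⟦1+ r ⟧ (begin
  Δ^ r (Δ h) 0 * 1/! (suc r) * ⟦ suc r ⟧
    ≡⟨ solve 3 (λ a b c → a :* b :* c := a :* (c :* b)) refl (Δ^ r (Δ h) 0) (1/! (suc r)) ⟦ suc r ⟧ ⟩
  Δ^ r (Δ h) 0 * (⟦ suc r ⟧ * 1/! (suc r))
    ≡⟨ cong (Δ^ r (Δ h) 0 *_) (1/!-suc r) ⟩
  Δ^ r (Δ h) 0 * 1/! r
    ≡⟨ Δ^-conv r (Δ h) ⟩
  conv (egf (Δ h)) expTerm r
    ≡⟨ conv-cong (λ k → trans (solve 3 (λ a b c → (a :- b) :* c := a :* c :+ (:- (b :* c))) refl (h (suc k)) (h k) (1/! k))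
         (cong (λ x → x + - egf h k) (trans (cong (h (suc k) *_) (sym (1/!-suc k)))
           (solve 3 (λ a b c → a :* (b :* c) := b :* (a :* c)) refl (h (suc k)) ⟦ suc k ⟧ (1/! (suc k))))))
         (λ _ → refl) r ⟩
  conv (λ k → D (egf h) k + - egf h k) expTerm r
    ≡⟨ conv-+ˡ (D (egf h)) (λ k → - egf h k) expTerm r ⟩
  conv (D (egf h)) expTerm r + conv (λ k → - egf h k) expTerm r
    ≡⟨ cong (conv (D (egf h)) expTerm r +_) (trans (sym (conv-neg (egf h) expTerm r))
         (conv-cong (λ _ → refl) (λ k → sym (expTerm-suc k)) r)) ⟩
  conv (D (egf h)) expTerm r + conv (egf h) (D expTerm) r
    ≡⟨ sym (conv-D (egf h) expTerm r) ⟩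
  ⟦ suc r ⟧ * conv (egf h) expTerm (suc r)
    ≡⟨ ℚₚ.*-comm ⟦ suc r ⟧ (conv (egf h) expTerm (suc r)) ⟩
  conv (egf h) expTerm (suc r) * ⟦ suc r ⟧ ∎)
  where open ≡-Reasoning

sumTo-conv : ∀ R f g → sumTo (suc R) (conv f g) ≡ f 0 * sumTo (suc R) g + sumTo R (conv (f ∘ suc) g)
sumTo-conv R f g = begin
  f 0 * g 0 + sumTo R (λ n → f 0 * g (suc n) + conv (f ∘ suc) g n)
    ≡⟨ cong (f 0 * g 0 +_) (trans (sumTo-+ R (λ n → f 0 * g (suc n)) (conv (f ∘ suc) g))
         (cong (_+ sumTo R (conv (f ∘ suc) g)) (sumTo-* R (f 0) (g ∘ suc)))) ⟩
  f 0 * g 0 + (f 0 * sumTo R (g ∘ suc) + sumTo R (conv (f ∘ suc) g))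
    ≡⟨ solve 4 (λ a b c d → a :* b :+ (a :* c :+ d) := a :* (b :+ c) :+ d)
          refl (f 0) (g 0) (sumTo R (g ∘ suc)) (sumTo R (conv (f ∘ suc) g)) ⟩
  f 0 * sumTo (suc R) g + sumTo R (conv (f ∘ suc) g) ∎
  where open ≡-Reasoning

0≤2⁻ : ∀ k → 0ℚ ≤ 2⁻ k
0≤2⁻ k = ℚₚ.<⇒≤ (2⁻-pos k)

8ℚ : ℚ
8ℚ = ⟦ 8 ⟧

-- Replaces the partial sums of exp(-1) that occur in a Cauchy product with f
-- by a single long one.
conv-expSum : ∀ R m A f → 0ℚ ≤ A → R ℕ.≤ m → (∀ k → ∣ f k ∣ ≤ A * (2⁻ k * 2⁻ k)) →
              ∣ sumTo R (conv f expTerm) - expSum m * sumTo R f ∣ ≤ 8ℚ * A * 2⁻ R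
conv-expSum zero m A f 0≤A _ bound = ℚₚ.≤-trans
  (ℚₚ.≤-reflexive (cong ∣_∣ (solve 1 (λ e → con 0ℚ :- e :* con 0ℚ := con 0ℚ) refl (expSum m))))
  (0≤-* (0≤-* 0≤⟦ 8 ⟧ 0≤A) (0≤2⁻ 0))
conv-expSum (suc R) m A f 0≤A R<m bound = begin
  ∣ sumTo (suc R) (conv f expTerm) - expSum m * (f 0 + sumTo R (f ∘ suc)) ∣
    ≡⟨ cong ∣_∣ (trans
         (cong (_- expSum m * (f 0 + sumTo R (f ∘ suc))) (trans (sumTo-conv R f expTerm) (cong (λ s → f 0 * s + rest) (sym (expSum≡sumTo (suc R))))))
         (solve 5 (λ a s x e y → a :* s :+ x :- e :* (a :+ y) := :- (a :* (e :- s)) :+ (x :- e :* y)) refl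
           (f 0) (expSum (suc R)) rest (expSum m) (sumTo R (f ∘ suc)))) ⟩
  ∣ - (f 0 * (expSum m - expSum (suc R))) + (rest - expSum m * sumTo R (f ∘ suc)) ∣
    ≤⟨ ℚₚ.∣p+q∣≤∣p∣+∣q∣ (- (f 0 * (expSum m - expSum (suc R)))) (rest - expSum m * sumTo R (f ∘ suc)) ⟩
  ∣ - (f 0 * (expSum m - expSum (suc R))) ∣ + ∣ rest - expSum m * sumTo R (f ∘ suc) ∣
    -- Shifting f divides its bound A by 4. Head and tail then contribute 2A · 2⁻ R each, and 4A ·
    -- 2⁻ R = 8A · 2⁻ (R + 1), so the constant 8 reproduces itself.
    ≤⟨ ℚₚ.+-mono-≤ head (conv-expSum R m (¼ * A) (f ∘ suc) (0≤-* 0≤¼ 0≤A) (ℕₚ.<⇒≤ R<m) bound′) ⟩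
  A * (2⁻ R + 2⁻ R) + 8ℚ * (¼ * A) * 2⁻ R
    ≡⟨ solve 2 (λ a t → a :* (t :+ t) :+ con 8ℚ :* (con ¼ :* a) :* t := con ⟦ 4 ⟧ :* a :* t) refl A (2⁻ R) ⟩
  ⟦ 4 ⟧ * A * 2⁻ R
    ≡⟨ cong (⟦ 4 ⟧ * A *_) (sym (2⁻-double R)) ⟩
  ⟦ 4 ⟧ * A * (2⁻ (suc R) + 2⁻ (suc R))
    ≡⟨ solve 2 (λ a t → con ⟦ 4 ⟧ :* a :* (t :+ t) := con 8ℚ :* a :* t) refl A (2⁻ (suc R)) ⟩
  8ℚ * A * 2⁻ (suc R) ∎
  where
  open ℚₚ.≤-Reasoning
  ¼ = ½ * ½
  0≤¼ : 0ℚ ≤ ¼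
  0≤¼ = ℚₚ.<⇒≤ (ℚₚ.positive⁻¹ ¼)
  rest = sumTo R (conv (f ∘ suc) expTerm)
  tail : ∣ expSum m - expSum (suc R) ∣ ≤ 2⁻ R + 2⁻ R
  tail = begin
    ∣ expSum m - expSum (suc R) ∣
      ≡⟨ cong (λ i → ∣ expSum i - expSum (suc R) ∣) (sym (trans (sym (ℕₚ.+-suc (m ℕ.∸ suc R) R)) (ℕₚ.m∸n+n≡m R<m))) ⟩
    ∣ expSum (suc (m ℕ.∸ suc R ℕ.+ R)) - expSum (suc R) ∣
      ≤⟨ ≤-by (2⁻ (m ℕ.∸ suc R ℕ.+ R) + 2⁻ (m ℕ.∸ suc R ℕ.+ R)) (0≤-+ (0≤2⁻ (m ℕ.∸ suc R ℕ.+ R)) (0≤2⁻ (m ℕ.∸ suc R ℕ.+ R))) refl ⟩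
    ∣ expSum (suc (m ℕ.∸ suc R ℕ.+ R)) - expSum (suc R) ∣ + (2⁻ (m ℕ.∸ suc R ℕ.+ R) + 2⁻ (m ℕ.∸ suc R ℕ.+ R))
      ≤⟨ expTail R (m ℕ.∸ suc R) ⟩
    2⁻ R + 2⁻ R ∎
  head : ∣ - (f 0 * (expSum m - expSum (suc R))) ∣ ≤ A * (2⁻ R + 2⁻ R)
  head = begin
    ∣ - (f 0 * (expSum m - expSum (suc R))) ∣      ≡⟨ ℚₚ.∣-p∣≡∣p∣ (f 0 * (expSum m - expSum (suc R))) ⟩
    ∣ f 0 * (expSum m - expSum (suc R)) ∣          ≡⟨ ℚₚ.∣p*q∣≡∣p∣*∣q∣ (f 0) (expSum m - expSum (suc R)) ⟩
    ∣ f 0 ∣ * ∣ expSum m - expSum (suc R) ∣        ≤⟨ *-mono-≤-nonNeg (ℚₚ.0≤∣p∣ (expSum m - expSum (suc R))) 0≤A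
                                                      (ℚₚ.≤-trans (bound 0) (ℚₚ.≤-reflexive (ℚₚ.*-identityʳ A))) tail ⟩
    A * (2⁻ R + 2⁻ R)                              ∎
  half : ∀ k → 2⁻ (suc k) ≡ ½ * 2⁻ k
  half k = trans (solve 1 (λ t → t := con ½ :* (t :+ t)) refl (2⁻ (suc k))) (cong (½ *_) (2⁻-double k))
  bound′ : ∀ k → ∣ f (suc k) ∣ ≤ ¼ * A * (2⁻ k * 2⁻ k)
  bound′ k = ℚₚ.≤-trans (bound (suc k)) (ℚₚ.≤-reflexive (trans (cong (λ t → A * (t * t)) (half k))
    (solve 2 (λ a t → a :* (con ½ :* t :* (con ½ :* t)) := con ¼ :* a :* (t :* t)) refl A (2⁻ k))))

-- Serves the finitely many orders of moments below a truncation, and the finitely many values of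
-- `X³` at a fixed size.
eventually-all : ∀ (P : ℕ → ℕ → Set) → (∀ k → ∃ λ N → ∀ m → N ℕ.≤ m → P k m) →
                 ∀ K → ∃ λ N → ∀ m → N ℕ.≤ m → ∀ k → k ℕ.≤ K → P k m
eventually-all P ev zero    = let N , p = ev 0 in N , λ { m h zero _ → p m h }
eventually-all P ev (suc K) =
  let M , p = eventually-all P ev K
      N , q = ev (suc K)
  in M ℕ.⊔ N , λ m h k k≤ → pick m k (p m (ℕₚ.m⊔n≤o⇒m≤o M N h)) (q m (ℕₚ.m⊔n≤o⇒n≤o M N h)) (ℕₚ.m≤n⇒m<n∨m≡n k≤)
  where
  pick : ∀ m k → (∀ k → k ℕ.≤ K → P k m) → P (suc K) m → k ℕ.< suc K ⊎ k ≡ suc K → P k m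
  pick m k p q (inj₁ (s≤s k≤K)) = p k k≤K
  pick m k p q (inj₂ refl)      = q

-- The ratio 4/(k + 1) of successive quotients 4^k/k! is at most 1 from k = 3 on, and 64 = 4^3 also
-- covers the first cases.
2^2k≤64k! : ∀ k → 2 ℕ.^ k ℕ.* 2 ℕ.^ k ℕ.≤ 64 ℕ.* k !
2^2k≤64k! 0 = ℕₚ.m≤n+m 1 63
2^2k≤64k! 1 = ℕₚ.m≤n+m 4 60
2^2k≤64k! 2 = ℕₚ.m≤n+m 16 112
2^2k≤64k! 3 = ℕₚ.m≤n+m 64 320
2^2k≤64k! (suc k@(suc (suc (suc j)))) = begin
  2 ℕ.^ suc k ℕ.* 2 ℕ.^ suc k        ≡⟨ ℕ-Solver.solve 1 (λ p → (con′ 2 ⊗ p) ⊗ (con′ 2 ⊗ p) ⊜ con′ 4 ⊗ (p ⊗ p)) refl (2 ℕ.^ k) ⟩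
  4 ℕ.* (2 ℕ.^ k ℕ.* 2 ℕ.^ k)        ≤⟨ ℕₚ.*-mono-≤ {4} {suc k} (s≤s (s≤s (s≤s (s≤s z≤n)))) (2^2k≤64k! k) ⟩
  suc k ℕ.* (64 ℕ.* k !)             ≡⟨ ℕ-Solver.solve 2 (λ a b → a ⊗ (con′ 64 ⊗ b) ⊜ con′ 64 ⊗ (a ⊗ b)) refl (suc k) (k !) ⟩
  64 ℕ.* suc k !                     ∎
  where
  open ℕₚ.≤-Reasoning
  open ℕ-Solver using () renaming (con to con′; _:*_ to _⊗_; _:=_ to _⊜_)

64ℚ : ℚ
64ℚ = ⟦ 64 ⟧

-- Base 4 is needed because the R-th differences of a bounded function may grow like 2^R; a factor
-- 2⁻ R has to survive.
1/!≤64/4^ : ∀ k → 1/! k ≤ 64ℚ * (2⁻ k * 2⁻ k)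
1/!≤64/4^ k = begin
  1/! k
    ≡⟨ solve 1 (λ a → a := a :* (con 1ℚ :* con 1ℚ)) refl (1/! k) ⟩
  1/! k * (1ℚ * 1ℚ)
    ≡⟨ cong (λ x → 1/! k * (x * x)) (sym (2⁻-* k)) ⟩
  1/! k * ((2⁻ k * ⟦ 2 ℕ.^ k ⟧) * (2⁻ k * ⟦ 2 ℕ.^ k ⟧))
    ≡⟨ solve 3 (λ a t p → a :* ((t :* p) :* (t :* p)) := a :* (t :* t) :* (p :* p)) refl (1/! k) (2⁻ k) ⟦ 2 ℕ.^ k ⟧ ⟩
  1/! k * (2⁻ k * 2⁻ k) * (⟦ 2 ℕ.^ k ⟧ * ⟦ 2 ℕ.^ k ⟧)
    ≤⟨ *-monoˡ (1/! k * (2⁻ k * 2⁻ k)) (0≤-* (0≤1/! k) (0≤-* (0≤2⁻ k) (0≤2⁻ k)))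
         (subst₂ _≤_ (⟦⟧-* (2 ℕ.^ k) (2 ℕ.^ k)) (⟦⟧-* 64 (k !)) (⟦⟧-mono (2^2k≤64k! k))) ⟩
  1/! k * (2⁻ k * 2⁻ k) * (64ℚ * ⟦ k ! ⟧)
    ≡⟨ solve 4 (λ a t c f → a :* t :* (c :* f) := (a :* f) :* (c :* t)) refl (1/! k) (2⁻ k * 2⁻ k) 64ℚ ⟦ k ! ⟧ ⟩
  1/! k * ⟦ k ! ⟧ * (64ℚ * (2⁻ k * 2⁻ k))
    ≡⟨ trans (cong (_* (64ℚ * (2⁻ k * 2⁻ k))) (1/!-* k)) (ℚₚ.*-identityˡ (64ℚ * (2⁻ k * 2⁻ k))) ⟩
  64ℚ * (2⁻ k * 2⁻ k) ∎
  where open ℚₚ.≤-Reasoning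

egf-bounded : ∀ {M} h → 0ℚ ≤ M → (∀ k → ∣ h k ∣ ≤ M) → ∀ k → ∣ egf h k ∣ ≤ 64ℚ * M * (2⁻ k * 2⁻ k)
egf-bounded {M} h 0≤M bound k = begin
  ∣ h k * 1/! k ∣                 ≡⟨ trans (ℚₚ.∣p*q∣≡∣p∣*∣q∣ (h k) (1/! k)) (cong (∣ h k ∣ *_) (ℚₚ.0≤p⇒∣p∣≡p (0≤1/! k))) ⟩
  ∣ h k ∣ * 1/! k                 ≤⟨ *-mono-≤-nonNeg (0≤1/! k) 0≤M (bound k) (1/!≤64/4^ k) ⟩
  M * (64ℚ * (2⁻ k * 2⁻ k))       ≡⟨ solve 3 (λ m c t → m :* (c :* t) := c :* m :* t) refl M 64ℚ (2⁻ k * 2⁻ k) ⟩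
  64ℚ * M * (2⁻ k * 2⁻ k)         ∎
  where open ℚₚ.≤-Reasoning

2^*2⁻ : ∀ R → 2ℚ ^ R * 2⁻ R ≡ 1ℚ
2^*2⁻ R = trans (ℚₚ.*-comm (2ℚ ^ R) (2⁻ R)) (trans (cong (2⁻ R *_) (sym (⟦⟧-^ 2 R))) (2⁻-* R))

-- 2^R - 1 is the sum of 2^r over r < R, the total of the bounds on d up to the factor M.
sumTo-close : ∀ {M e} R (d x y : ℕ → ℚ) → 0ℚ ≤ M → (∀ r → ∣ d r ∣ ≤ 2ℚ ^ r * M) → (∀ r → r ℕ.< R → ∣ x r - y r ∣ ≤ e) →
              ∣ sumTo R (λ r → d r * x r) - sumTo R (λ r → d r * y r) ∣ ≤ (2ℚ ^ R - 1ℚ) * (M * e)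
sumTo-close {M} {e} zero d x y 0≤M _ _ = ℚₚ.≤-reflexive (sym (ℚₚ.*-zeroˡ (M * e)))
sumTo-close {M} {e} (suc R) d x y 0≤M d≤ x≈y = begin
  ∣ (d 0 * x 0 + X) - (d 0 * y 0 + Y) ∣
    ≡⟨ cong ∣_∣ (solve 5 (λ d x y a b → (d :* x :+ a) :- (d :* y :+ b) := d :* (x :- y) :+ (a :- b)) refl (d 0) (x 0) (y 0) X Y) ⟩
  ∣ d 0 * (x 0 - y 0) + (X - Y) ∣
    ≤⟨ ℚₚ.∣p+q∣≤∣p∣+∣q∣ (d 0 * (x 0 - y 0)) (X - Y) ⟩
  ∣ d 0 * (x 0 - y 0) ∣ + ∣ X - Y ∣
    ≡⟨ cong (_+ ∣ X - Y ∣) (ℚₚ.∣p*q∣≡∣p∣*∣q∣ (d 0) (x 0 - y 0)) ⟩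
  ∣ d 0 ∣ * ∣ x 0 - y 0 ∣ + ∣ X - Y ∣
    ≤⟨ ℚₚ.+-mono-≤
         (*-mono-≤-nonNeg (ℚₚ.0≤∣p∣ (x 0 - y 0)) 0≤M (ℚₚ.≤-trans (d≤ 0) (ℚₚ.≤-reflexive (ℚₚ.*-identityˡ M))) (x≈y 0 (s≤s z≤n)))
         (sumTo-close R (d ∘ suc) (x ∘ suc) (y ∘ suc) (0≤-* 0≤⟦ 2 ⟧ 0≤M)
           (λ r → ℚₚ.≤-trans (d≤ (suc r)) (ℚₚ.≤-reflexive (solve 3 (λ t p m → t :* p :* m := p :* (t :* m)) refl 2ℚ (2ℚ ^ r) M)))
           (λ r r<R → x≈y (suc r) (s≤s r<R))) ⟩
  M * e + (2ℚ ^ R - 1ℚ) * (2ℚ * M * e)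
    ≡⟨ solve 3 (λ m e p → m :* e :+ (p :- con 1ℚ) :* (con 2ℚ :* m :* e) := (con 2ℚ :* p :- con 1ℚ) :* (m :* e))
          refl M e (2ℚ ^ R) ⟩
  (2ℚ ^ suc R - 1ℚ) * (M * e) ∎
  where
  open ℚₚ.≤-Reasoning
  X = sumTo R (λ r → d (suc r) * x (suc r))
  Y = sumTo R (λ r → d (suc r) * y (suc r))

-- 64 + 1 comes from the Newton remainder, 1 from replacing the moments by their limits, 8 · 64 from
-- the Cauchy product with the series for e⁻¹.
errorℚ : ℕ → ℚ
errorℚ R = (64ℚ + 1ℚ + 1ℚ + 8ℚ * 64ℚ) * 2⁻ R

-- Expectations against truncated Poisson sums, at rational parameters.

module Expectation (α β : ℚ) (0≤α : 0ℚ ≤ α) (0≤β : 0ℚ ≤ β) where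
  open Weighted α β
  open Positive α β 0≤α 0≤β

  𝔸-+ : ∀ n u g h → A n u (λ k → g k + h k) ≡ A n u g + A n u h
  𝔸-+ n u g h = trans (Σᵀ-cong n (λ S → ℚₚ.*-distribˡ-+ (U u (free S)) (g (X³ S)) (h (X³ S))))
    (Σᵀ-+ n (λ S → U u (free S) * g (X³ S)) (λ S → U u (free S) * h (X³ S)))

  𝔸-scale : ∀ n u c h → A n u (λ k → c * h k) ≡ c * A n u h
  𝔸-scale n u c h = trans (Σᵀ-cong n (λ S → solve 3 (λ w c x → w :* (c :* x) := c :* (w :* x)) refl (U u (free S)) c (h (X³ S))))
    (Σᵀ-* n c (λ S → U u (free S) * h (X³ S)))

  A-mono : ∀ n {u} g h → 0ℚ ≤ u → (∀ k → g k ≤ h k) → A n u g ≤ A n u h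
  A-mono n {u} g h 0≤u le = Σᵀ-mono n (λ S → *-monoˡ (U u (free S)) (0≤U 0≤u (free S)) (le (X³ S)))

  A-sumTo : ∀ n u R (d : ℕ → ℚ) (h : ℕ → ℕ → ℚ) → A n u (λ k → sumTo R (λ r → d r * h r k)) ≡ sumTo R (λ r → d r * A n u (h r))
  A-sumTo n u zero    d h = 𝔸-zero (U u) n (λ _ → refl)
  A-sumTo n u (suc R) d h = trans (𝔸-+ n u (λ k → d 0 * h 0 k) (λ k → sumTo R (λ r → d (suc r) * h (suc r) k)))
    (cong₂ _+_ (𝔸-scale n u (d 0) (h 0)) (A-sumTo n u R (d ∘ suc) (h ∘ suc)))

  from-abs : ∀ p q {d} → ∣ p - q ∣ ≤ d → p ≤ q + d
  from-abs p q h = subst₂ _≤_ (solve 2 (λ p q → q :+ (p :- q) := p) refl p q) refl (ℚₚ.+-monoʳ-≤ q (ℚₚ.≤-trans (p≤∣p∣ (p - q)) h))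

  A-close : ∀ n u g h b → 0ℚ ≤ u → (∀ k → ∣ g k - h k ∣ ≤ b k) → ∣ A n u g - A n u h ∣ ≤ A n u b
  A-close n u g h b 0≤u close = ∣p-q∣≤
    (subst (A n u g ≤_) (𝔸-+ n u h b) (A-mono n g (λ k → h k + b k) 0≤u (λ k → from-abs (g k) (h k) (close k))))
    (subst (A n u h ≤_) (𝔸-+ n u g b) (A-mono n h (λ k → g k + b k) 0≤u (λ k → from-abs (h k) (g k) (subst (_≤ b k) (∣p-q∣-sym (g k) (h k)) (close k)))))

  -- The moments are required to be within 4^(-R) of their limits because the Newton coefficients
  -- add up to as much as (2^R - 1)M. Order R itself is included for the sake of the remainder.
  poisson-estimate : ∀ R m n {M} h → 0ℚ ≤ M → (∀ k → ∣ h k ∣ ≤ M) → R ℕ.≤ m →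
    (∀ r → r ℕ.≤ R → ∣ moment n r 1ℚ - 1/! r * mass n 1ℚ ∣ ≤ 2⁻ R * 2⁻ R * mass n 1ℚ) →
    ∣ A n 1ℚ h - mass n 1ℚ * (expSum m * sumTo R (egf h)) ∣ ≤ mass n 1ℚ * (M * errorℚ R)
  poisson-estimate R m n {M} h 0≤M bound R≤m close = begin
    ∣ A n 1ℚ h - P * (expSum m * sumTo R (egf h)) ∣
      ≡⟨ cong ∣_∣ (solve 4 (λ a b c d → a :- d := (a :- b) :+ ((b :- c) :+ (c :- d))) refl
           (A n 1ℚ h) Nₘ (sumTo R (λ r → Δ^ r h 0 * (1/! r * P))) (P * (expSum m * sumTo R (egf h)))) ⟩
    ∣ (A n 1ℚ h - Nₘ) + ((Nₘ - Pₘ) + (Pₘ - P * (expSum m * sumTo R (egf h)))) ∣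
      ≤⟨ ℚₚ.≤-trans (ℚₚ.∣p+q∣≤∣p∣+∣q∣ (A n 1ℚ h - Nₘ) ((Nₘ - Pₘ) + (Pₘ - P * (expSum m * sumTo R (egf h))))) (ℚₚ.+-monoʳ-≤ ∣ A n 1ℚ h - Nₘ ∣
           (ℚₚ.∣p+q∣≤∣p∣+∣q∣ (Nₘ - Pₘ) (Pₘ - P * (expSum m * sumTo R (egf h))))) ⟩
    ∣ A n 1ℚ h - Nₘ ∣ + (∣ Nₘ - Pₘ ∣ + ∣ Pₘ - P * (expSum m * sumTo R (egf h)) ∣)
      ≤⟨ ℚₚ.+-mono-≤ step₁ (ℚₚ.+-mono-≤ step₂ step₃) ⟩
    65ℚ * 2⁻ R * M * P + (2⁻ R * M * P + P * (8ℚ * (64ℚ * M) * 2⁻ R))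
      ≡⟨ solve 5 (λ a b t m p → (a :+ con 1ℚ) :* t :* m :* p :+ (t :* m :* p :+ p :* (b :* (a :* m) :* t))
           := p :* (m :* ((a :+ con 1ℚ :+ con 1ℚ :+ b :* a) :* t))) refl 64ℚ 8ℚ (2⁻ R) M P ⟩
    P * (M * errorℚ R) ∎
    where
    open ℚₚ.≤-Reasoning
    65ℚ = 64ℚ + 1ℚ
    P = mass n 1ℚ
    0≤P : 0ℚ ≤ P
    0≤P = 0≤mass n 0≤1
    Nₘ = sumTo R (λ r → Δ^ r h 0 * moment n r 1ℚ)
    Pₘ = sumTo R (λ r → Δ^ r h 0 * (1/! r * P))
    moment≤ : moment n R 1ℚ ≤ 65ℚ * (2⁻ R * 2⁻ R) * P
    moment≤ = begin
      moment n R 1ℚ                                   ≤⟨ from-abs (moment n R 1ℚ) (1/! R * P) (close R ℕₚ.≤-refl) ⟩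
      1/! R * P + 2⁻ R * 2⁻ R * P                     ≤⟨ ℚₚ.+-monoˡ-≤ (2⁻ R * 2⁻ R * P) (*-monoʳ P 0≤P (1/!≤64/4^ R)) ⟩
      64ℚ * (2⁻ R * 2⁻ R) * P + 2⁻ R * 2⁻ R * P       ≡⟨ solve 3 (λ a t p → a :* t :* p :+ t :* p := (a :+ con 1ℚ) :* t :* p)
            refl 64ℚ (2⁻ R * 2⁻ R) P ⟩
      65ℚ * (2⁻ R * 2⁻ R) * P                         ∎
    cancel : ∀ c → c * (2⁻ R * 2⁻ R) * (2ℚ ^ R) ≡ c * 2⁻ R
    cancel c = trans (solve 3 (λ c t p → c :* (t :* t) :* p := c :* t :* (p :* t)) refl c (2⁻ R) (2ℚ ^ R))
      (trans (cong (c * 2⁻ R *_) (2^*2⁻ R)) (ℚₚ.*-identityʳ (c * 2⁻ R)))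
    step₁ : ∣ A n 1ℚ h - Nₘ ∣ ≤ 65ℚ * 2⁻ R * M * P
    step₁ = begin
      ∣ A n 1ℚ h - Nₘ ∣
        ≡⟨ cong (λ x → ∣ A n 1ℚ h - x ∣) (sym (A-sumTo n 1ℚ R (λ r → Δ^ r h 0) choose)) ⟩
      ∣ A n 1ℚ h - A n 1ℚ (newton R h) ∣
        ≤⟨ A-close n 1ℚ h (newton R h) (λ k → 2ℚ ^ R * M * choose R k) 0≤1 (newton-remainder R h 0≤M bound) ⟩
      A n 1ℚ (λ k → 2ℚ ^ R * M * choose R k)
        ≡⟨ 𝔸-scale n 1ℚ (2ℚ ^ R * M) (choose R) ⟩
      2ℚ ^ R * M * moment n R 1ℚ
        ≤⟨ *-monoˡ (2ℚ ^ R * M) (0≤-* (0≤-^ R 0≤⟦ 2 ⟧) 0≤M) moment≤ ⟩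
      2ℚ ^ R * M * (65ℚ * (2⁻ R * 2⁻ R) * P)
        ≡⟨ solve 4 (λ q m c p → q :* m :* (c :* p) := c :* q :* m :* p) refl (2ℚ ^ R) M (65ℚ * (2⁻ R * 2⁻ R)) P ⟩
      65ℚ * (2⁻ R * 2⁻ R) * 2ℚ ^ R * M * P
        ≡⟨ cong (λ x → x * M * P) (cancel 65ℚ) ⟩
      65ℚ * 2⁻ R * M * P ∎
    step₂ : ∣ Nₘ - Pₘ ∣ ≤ 2⁻ R * M * P
    step₂ = begin
      ∣ Nₘ - Pₘ ∣
        ≤⟨ sumTo-close R (λ r → Δ^ r h 0) (λ r → moment n r 1ℚ) (λ r → 1/! r * P) 0≤M (λ r → Δ^-bounded r h bound 0)
             (λ r r<R → close r (ℕₚ.<⇒≤ r<R)) ⟩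
      (2ℚ ^ R - 1ℚ) * (M * (2⁻ R * 2⁻ R * P))
        ≤⟨ ≤-by (M * (2⁻ R * 2⁻ R * P)) (0≤-* 0≤M (0≤-* (0≤-* (0≤2⁻ R) (0≤2⁻ R)) 0≤P))
             (solve 4 (λ q m t p → (q :- con 1ℚ) :* (m :* (t :* p)) :+ m :* (t :* p) := con 1ℚ :* t :* q :* m :* p)
                   refl (2ℚ ^ R) M (2⁻ R * 2⁻ R) P) ⟩
      1ℚ * (2⁻ R * 2⁻ R) * 2ℚ ^ R * M * P
        ≡⟨ cong (λ x → x * M * P) (trans (cancel 1ℚ) (ℚₚ.*-identityˡ (2⁻ R))) ⟩
      2⁻ R * M * P ∎
    step₃ : ∣ Pₘ - P * (expSum m * sumTo R (egf h)) ∣ ≤ P * (8ℚ * (64ℚ * M) * 2⁻ R)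
    step₃ = begin
      ∣ Pₘ - P * (expSum m * sumTo R (egf h)) ∣
        ≡⟨ cong (λ x → ∣ x - P * (expSum m * sumTo R (egf h)) ∣) (trans
             (sumTo-cong R (λ r → trans (solve 3 (λ a b p → a :* (b :* p) := p :* (a :* b))
                   refl (Δ^ r h 0) (1/! r) P) (cong (P *_) (Δ^-conv r h))))
             (sumTo-* R P (conv (egf h) expTerm))) ⟩
      ∣ P * sumTo R (conv (egf h) expTerm) - P * (expSum m * sumTo R (egf h)) ∣
        ≡⟨ cong ∣_∣ (solve 3 (λ p a b → p :* a :- p :* b := p :* (a :- b))
              refl P (sumTo R (conv (egf h) expTerm)) (expSum m * sumTo R (egf h))) ⟩
      ∣ P * (sumTo R (conv (egf h) expTerm) - expSum m * sumTo R (egf h)) ∣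
        ≡⟨ trans (ℚₚ.∣p*q∣≡∣p∣*∣q∣ P (sumTo R (conv (egf h) expTerm) - expSum m * sumTo R (egf h)))
             (cong (_* ∣ sumTo R (conv (egf h) expTerm) - expSum m * sumTo R (egf h) ∣) (ℚₚ.0≤p⇒∣p∣≡p 0≤P)) ⟩
      P * ∣ sumTo R (conv (egf h) expTerm) - expSum m * sumTo R (egf h) ∣
        ≤⟨ *-monoˡ P 0≤P (conv-expSum R m (64ℚ * M) (egf h) (0≤-* 0≤⟦ 64 ⟧ 0≤M) R≤m (egf-bounded h 0≤M bound)) ⟩
      P * (8ℚ * (64ℚ * M) * 2⁻ R) ∎

  U-1 : ∀ {n} (φ : Vec Bool n) → U 1ℚ φ ≡ 1ℚ
  U-1 []          = refl
  U-1 (true ∷ φ)  = trans (ℚₚ.*-identityˡ (U 1ℚ φ)) (U-1 φ)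
  U-1 (false ∷ φ) = trans (ℚₚ.*-identityˡ (U 1ℚ φ)) (U-1 φ)

  A-tableaux : ∀ n h → Σᴸ (tableaux n) (λ S → (α ^ Nα S * β ^ Nβ S) * h (X³ S)) ≡ A n 1ℚ h
  A-tableaux n h = trans (Σ-tableaux n (λ S → h (X³ S)))
    (Σᵀ-cong n (λ S → trans (sym (ℚₚ.*-identityˡ (h (X³ S)))) (cong (_* h (X³ S)) (sym (U-1 (free S))))))

-- Limits of real sequences

∣p-r∣<-via : ∀ {d e} p q r → ∣ p - q ∣ < d → ∣ q - r ∣ < e → ∣ p - r ∣ < d + e
∣p-r∣<-via {d} {e} p q r pq qr = begin-strict
  ∣ p - r ∣                   ≡⟨ cong ∣_∣ (solve 3 (λ p q r → p :- r := (p :- q) :+ (q :- r)) refl p q r) ⟩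
  ∣ (p - q) + (q - r) ∣       ≤⟨ ℚₚ.∣p+q∣≤∣p∣+∣q∣ (p - q) (q - r) ⟩
  ∣ p - q ∣ + ∣ q - r ∣       <⟨ ℚₚ.+-mono-< pq qr ⟩
  d + e                       ∎
  where open ℚₚ.≤-Reasoning

-- Weaker than `∣ x -ᴿ y ∣ᴿ <ᴿ ι ε`, which asks for a positive gap below ε. Halving ε in `near⇒⟶`
-- supplies the gap.
Near : ℚ → ℝ → ℝ → Set
Near ε x y = ∃ λ N → ∀ m → N ℕ.≤ m → ∣ seq x m - seq y m ∣ < ε

near-sym : ∀ {ε} x y → Near ε x y → Near ε y x
near-sym {ε} x y (N , p) = N , λ m h → subst (_< ε) (∣p-q∣-sym (seq x m) (seq y m)) (p m h)

near-trans : ∀ {d e} x y z → Near d x y → Near e y z → Near (d + e) x z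
near-trans x y z (M , p) (N , q) = M ℕ.⊔ N , λ m h → ∣p-r∣<-via (seq x m) (seq y m) (seq z m)
  (p m (ℕₚ.m⊔n≤o⇒m≤o M N h)) (q m (ℕₚ.m⊔n≤o⇒n≤o M N h))

near⇒⟶ : ∀ (x : ℕ → ℝ) L → (∀ ε → 0ℚ < ε → ∃ λ N → ∀ n → N ℕ.≤ n → Near ε (x n) L) → x ⟶ L
near⇒⟶ x L near ε 0<ε =
  let η , 0<η , η+η≡ε = halve ε 0<ε
      N , p = near η 0<η
  in N , λ n h → η , 0<η , proj₁ (p n h) , λ m h′ →
     subst₂ _<_ (solve 2 (λ e a → e :+ a :- a := e) refl η ∣ seq (x n) m - seq L m ∣)
       (cong (_- ∣ seq (x n) m - seq L m ∣) η+η≡ε)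
       (ℚₚ.+-monoˡ-< (- ∣ seq (x n) m - seq L m ∣) (ℚₚ.+-monoʳ-< η (proj₂ (p n h) m h′)))

2⁻-antitone : ∀ {i j} → i ℕ.≤ j → 2⁻ j ≤ 2⁻ i
2⁻-antitone {i} {zero}  z≤n = ℚₚ.≤-refl
2⁻-antitone {i} {suc j} i≤1+j with ℕₚ.m≤n⇒m<n∨m≡n i≤1+j
... | inj₂ refl      = ℚₚ.≤-refl
... | inj₁ (s≤s i≤j) = ℚₚ.≤-trans (≤-by (2⁻ (suc j)) (0≤2⁻ (suc j)) (2⁻-double j)) (2⁻-antitone i≤j)

module _ (s : ℕ → ℝ) (s-cauchy : ∀ ε → 0ℚ < ε → ∃ λ N → ∀ i j → N ℕ.≤ i → N ℕ.≤ j → Near ε (s i) (s j)) where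

  modulus : ℕ → ℕ
  modulus j = proj₁ (cauchy (s j) (2⁻ j) (2⁻-pos j))

  diagonal-near : ∀ j → Near (2⁻ j) (s j) (ι (seq (s j) (modulus j)))
  diagonal-near j = modulus j , λ m h → proj₂ (cauchy (s j) (2⁻ j) (2⁻-pos j)) m (modulus j) h ℕₚ.≤-refl

  near-diagonal : ∀ ε → 0ℚ < ε → ∃ λ N → ∀ i j → N ℕ.≤ i → N ℕ.≤ j → Near ε (s i) (ι (seq (s j) (modulus j)))
  near-diagonal ε 0<ε =
    let η , 0<η , η+η≡ε = halve ε 0<ε
        e , 2⁻e≤η = 2⁻-small η 0<η
        N , p = s-cauchy η 0<η
    in e ℕ.⊔ N , λ i j hi hj →
       let M , q = near-trans (s i) (s j) (ι (seq (s j) (modulus j)))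
                     (p i j (ℕₚ.m⊔n≤o⇒n≤o e N hi) (ℕₚ.m⊔n≤o⇒n≤o e N hj)) (diagonal-near j)
       in M , λ m h → ℚₚ.<-≤-trans (q m h) (subst (η + 2⁻ j ≤_) η+η≡ε
            (ℚₚ.+-monoʳ-≤ η (ℚₚ.≤-trans (2⁻-antitone (ℕₚ.m⊔n≤o⇒m≤o e N hj)) 2⁻e≤η)))

  -- Completeness: the term taken from `s j` lies at its modulus for 2⁻ j, hence represents `s j` up
  -- to 2⁻ j.
  diagonal : ℝ
  seq    diagonal j = seq (s j) (modulus j)
  cauchy diagonal ε 0<ε =
    let η , 0<η , η+η≡ε = halve ε 0<ε
        N , p = near-diagonal η 0<η
    in N , λ i j hi hj →
       let M , q = near-trans (ι (seq (s i) (modulus i))) (s N) (ι (seq (s j) (modulus j)))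
                     (near-sym (s N) (ι (seq (s i) (modulus i))) (p N i ℕₚ.≤-refl hi)) (p N j ℕₚ.≤-refl hj)
       in subst (_ <_) η+η≡ε (q M ℕₚ.≤-refl)

  diagonal-limit : ∀ ε → 0ℚ < ε → ∃ λ N → ∀ i → N ℕ.≤ i → Near ε (s i) diagonal
  diagonal-limit ε 0<ε =
    let η , 0<η , η+η≡ε = halve ε 0<ε
        N , p = near-diagonal η 0<η
    in N , λ i hi →
       let M , q = cauchy (s i) η 0<η
       in M ℕ.⊔ N , λ m h →
          let M′ , q′ = p i m hi (ℕₚ.m⊔n≤o⇒n≤o M N h)
          in subst (_ <_) η+η≡ε (∣p-r∣<-via (seq (s i) m) (seq (s i) (M ℕ.⊔ M′)) (seq (s m) (modulus m))
               (q m (M ℕ.⊔ M′) (ℕₚ.m⊔n≤o⇒m≤o M N h) (ℕₚ.m≤m⊔n M M′)) (q′ (M ℕ.⊔ M′) (ℕₚ.m≤n⊔m M M′)))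

-- Two late members of s are both near the same `x n` for a large n. So s is Cauchy, and its limit
-- is also approached by x.
common-limit : (s x : ℕ → ℝ) →
               (∀ ε → 0ℚ < ε → ∃ λ R₀ → ∀ R → R₀ ℕ.≤ R → ∃ λ N → ∀ n → N ℕ.≤ n → Near ε (x n) (s R)) →
               ∃ λ L → s ⟶ L × x ⟶ L
common-limit s x approx = L , near⇒⟶ s L (diagonal-limit s s-cauchy) , near⇒⟶ x L x-near
  where
  s-cauchy : ∀ ε → 0ℚ < ε → ∃ λ N → ∀ i j → N ℕ.≤ i → N ℕ.≤ j → Near ε (s i) (s j)
  s-cauchy ε 0<ε =
    let η , 0<η , η+η≡ε = halve ε 0<ε
        R₀ , p = approx η 0<η
    in R₀ , λ i j hi hj →
       let M , q = p i hi
           N , r = p j hj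
       in subst (λ e → Near e (s i) (s j)) η+η≡ε (near-trans (s i) (x (M ℕ.⊔ N)) (s j)
            (near-sym (x (M ℕ.⊔ N)) (s i) (q (M ℕ.⊔ N) (ℕₚ.m≤m⊔n M N))) (r (M ℕ.⊔ N) (ℕₚ.m≤n⊔m M N)))
  L = diagonal s s-cauchy
  x-near : ∀ ε → 0ℚ < ε → ∃ λ N → ∀ n → N ℕ.≤ n → Near ε (x n) L
  x-near ε 0<ε =
    let η , 0<η , η+η≡ε = halve ε 0<ε
        R₀ , p = approx η 0<η
        R₁ , l = diagonal-limit s s-cauchy η 0<η
        R = R₀ ℕ.⊔ R₁
        N , q = p R (ℕₚ.m≤m⊔n R₀ R₁)
    in N , λ n h → subst (λ e → Near e (x n) L) η+η≡ε (near-trans (x n) (s R) L (q n h) (l R (ℕₚ.m≤n⊔m R₀ R₁)))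

-- Termwise form of the sequences in the theorem

seq-sum : ∀ {A : Set} (w : A → ℝ) xs m → seq (sumᴿ (List.map w xs)) m ≡ Σᴸ xs (λ x → seq (w x) m)
seq-sum w []       m = refl
seq-sum w (x ∷ xs) m = cong (seq (w x) m +_) (seq-sum w xs m)

seq-^ : ∀ x k m → seq (x ^ᴿ k) m ≡ seq x m ^ k
seq-^ x zero    m = refl
seq-^ x (suc k) m = cong (seq x m *_) (seq-^ x k m)

seq-sumTo : ∀ (w : ℕ → ℝ) (j : ℕ → ℕ) R m → seq (sumᴿ (List.map w (applyUpTo j R))) m ≡ sumTo R (λ k → seq (w (j k)) m)
seq-sumTo w j zero    m = refl
seq-sumTo w j (suc R) m = cong (seq (w (j 0)) m +_) (seq-sumTo w (j ∘ suc) R m)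

X³-bound : ∀ {n} (S : Filling n) → X³ S ℕ.≤ length (boxes n)
X³-bound {n} S = Listₚ.length-filter (λ b → (suc (row b ℕ.+ col b) ℕ.≟ n) ×-dec ¬? (at S b ≟ᶜ empty)) (boxes n)

sumTo-cong-< : ∀ R {f g} → (∀ k → k ℕ.< R → f k ≡ g k) → sumTo R f ≡ sumTo R g
sumTo-cong-< zero    e = refl
sumTo-cong-< (suc R) e = cong₂ _+_ (e 0 (s≤s z≤n)) (sumTo-cong-< R (λ k k<R → e (suc k) (s≤s k<R)))

-- The inequality is 1/α + 1/β ≤ B without division. I and J bound the two reciprocals, by the
-- eventual lower bounds contained in the positivity of α and β.
positive-parameters : ∀ α β → 0ᴿ <ᴿ α → 0ᴿ <ᴿ β → ∃ λ B → ∃ λ N → ∀ m → N ℕ.≤ m →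
  0ℚ < seq α m × 0ℚ < seq β m × seq α m + seq β m ≤ ⟦ B ⟧ * (seq α m * seq β m)
positive-parameters α β (δ , 0<δ , M , δ<α) (ε , 0<ε , N , ε<β) =
  let I , 1≤δI = archimedean δ 0<δ
      J , 1≤εJ = archimedean ε 0<ε
  in I ℕ.+ J , M ℕ.⊔ N , λ m h →
     let δ<a = 0<-bound (seq α m) (δ<α m (ℕₚ.m⊔n≤o⇒m≤o M N h))
         ε<b = 0<-bound (seq β m) (ε<β m (ℕₚ.m⊔n≤o⇒n≤o M N h))
         0<a = ℚₚ.<-trans 0<δ δ<a
         0<b = ℚₚ.<-trans 0<ε ε<b
     in 0<a , 0<b , bound (seq α m) (seq β m) I J (ℚₚ.<⇒≤ 0<a) (ℚₚ.<⇒≤ 0<b)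
          (ℚₚ.≤-trans 1≤δI (*-monoʳ ⟦ I ⟧ 0≤⟦ I ⟧ (ℚₚ.<⇒≤ δ<a)))
          (ℚₚ.≤-trans 1≤εJ (*-monoʳ ⟦ J ⟧ 0≤⟦ J ⟧ (ℚₚ.<⇒≤ ε<b)))
  where
  open ℚₚ.≤-Reasoning
  bound : ∀ a b I J → 0ℚ ≤ a → 0ℚ ≤ b → 1ℚ ≤ a * ⟦ I ⟧ → 1ℚ ≤ b * ⟦ J ⟧ → a + b ≤ ⟦ I ℕ.+ J ⟧ * (a * b)
  bound a b I J 0≤a 0≤b 1≤aI 1≤bJ = begin
    a + b                                     ≡⟨ sym (cong₂ _+_ (ℚₚ.*-identityʳ a) (ℚₚ.*-identityʳ b)) ⟩
    a * 1ℚ + b * 1ℚ                           ≤⟨ ℚₚ.+-mono-≤ (*-monoˡ a 0≤a 1≤bJ) (*-monoˡ b 0≤b 1≤aI) ⟩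
    a * (b * ⟦ J ⟧) + b * (a * ⟦ I ⟧)         ≡⟨ solve 4 (λ a b i j → a :* (b :* j) :+ b :* (a :* i) := (i :+ j) :* (a :* b))
          refl a b ⟦ I ⟧ ⟦ J ⟧ ⟩
    (⟦ I ⟧ + ⟦ J ⟧) * (a * b)                 ≡⟨ cong (_* (a * b)) (sym (⟦⟧-+ I J)) ⟩
    ⟦ I ℕ.+ J ⟧ * (a * b)                     ∎

-- The operations on reals are termwise, so at a fixed index m the law of X³ is
-- the one with the rational parameters seq α m and seq β m.
module AtIndex (α β : ℝ) (α>0 : 0ᴿ <ᴿ α) (β>0 : 0ᴿ <ᴿ β) (m : ℕ)
               (0<a : 0ℚ < seq α m) (0<b : 0ℚ < seq β m) where
  0≤a = ℚₚ.<⇒≤ 0<a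
  0≤b = ℚₚ.<⇒≤ 0<b
  open Weighted (seq α m) (seq β m)
  open Positive (seq α m) (seq β m) 0≤a 0≤b
  open Expectation (seq α m) (seq β m) 0≤a 0≤b

  0<mass : ∀ n {u} → 0ℚ ≤ u → 0ℚ < mass n u
  0<mass zero    {u} 0≤u = subst (0ℚ <_) (sym (A-0 u (λ _ → 1ℚ))) (ℚₚ.positive⁻¹ 1ℚ)
  0<mass (suc n) {u} 0≤u = subst (0ℚ <_) (sym (mass-suc n u))
    (*-pos (ℚₚ.+-mono-<-≤ 0<a (0≤-* 0≤b 0≤u)) (0<mass n (0≤shift 0≤u)))

  seq-wt : ∀ {n} (S : Filling n) → seq (wt α β S) m ≡ seq α m ^ Nα S * seq β m ^ Nβ S
  seq-wt S = cong₂ _*_ (seq-^ α (Nα S) m) (seq-^ β (Nβ S) m)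

  seq-total : ∀ n → seq (FiniteSpace.total (tableauSpace α β α>0 β>0 n)) m ≡ mass n 1ℚ
  seq-total n = begin
    seq (sumᴿ (List.map (wt α β) (tableaux n))) m
      ≡⟨ seq-sum (wt α β) (tableaux n) m ⟩
    Σᴸ (tableaux n) (λ S → seq (wt α β S) m)
      ≡⟨ Σᴸ-cong (tableaux n) (λ S → trans (seq-wt S) (sym (ℚₚ.*-identityʳ (seq α m ^ Nα S * seq β m ^ Nβ S)))) ⟩
    Σᴸ (tableaux n) (λ S → (seq α m ^ Nα S * seq β m ^ Nβ S) * 1ℚ)
      ≡⟨ A-tableaux n (λ _ → 1ℚ) ⟩
    mass n 1ℚ ∎
    where open ≡-Reasoning

  -- Agreement is asked only up to the number of boxes, which bounds `X³`, so that g may be replaced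
  -- by a truncated h.
  seq-𝔼 : ∀ n (g : ℕ → ℝ) h → (∀ k → k ℕ.≤ length (boxes n) → seq (g k) m ≡ h k) →
          seq (𝔼 (tableauSpace α β α>0 β>0 n) (λ S → g (X³ S))) m ≡ inv (mass n 1ℚ) * A n 1ℚ h
  seq-𝔼 n g h g≡h = begin
    seq (𝔼 (tableauSpace α β α>0 β>0 n) (λ S → g (X³ S))) m
      ≡⟨ seq-sum (λ S → FiniteSpace.ℙ (tableauSpace α β α>0 β>0 n) S *ᴿ g (X³ S)) (tableaux n) m ⟩
    Σᴸ (tableaux n) (λ S → seq (wt α β S) m * inv (seq (FiniteSpace.total (tableauSpace α β α>0 β>0 n)) m) * seq (g (X³ S)) m)
      ≡⟨ Σᴸ-cong (tableaux n) (λ S → trans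
           (cong₂ _*_ (cong₂ _*_ (seq-wt S) (cong inv (seq-total n))) (g≡h (X³ S) (X³-bound S)))
           (solve 3 (λ w i x → w :* i :* x := i :* (w :* x))
                 refl (seq α m ^ Nα S * seq β m ^ Nβ S) (inv (mass n 1ℚ)) (h (X³ S)))) ⟩
    Σᴸ (tableaux n) (λ S → inv (mass n 1ℚ) * ((seq α m ^ Nα S * seq β m ^ Nβ S) * h (X³ S)))
      ≡⟨ Σᴸ-* (tableaux n) (inv (mass n 1ℚ)) (λ S → (seq α m ^ Nα S * seq β m ^ Nβ S) * h (X³ S)) ⟩
    inv (mass n 1ℚ) * Σᴸ (tableaux n) (λ S → (seq α m ^ Nα S * seq β m ^ Nβ S) * h (X³ S))
      ≡⟨ cong (inv (mass n 1ℚ) *_) (A-tableaux n h) ⟩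
    inv (mass n 1ℚ) * A n 1ℚ h ∎
    where open ≡-Reasoning

  normalised-estimate : ∀ n {x p d} → ∣ x - mass n 1ℚ * p ∣ ≤ mass n 1ℚ * d → ∣ inv (mass n 1ℚ) * x - p ∣ ≤ d
  normalised-estimate n {x} {p} {d} close = begin
    ∣ I * x - p ∣
      ≡⟨ cong (λ y → ∣ I * x - y ∣) (sym (cancel p)) ⟩
    ∣ I * x - I * (P * p) ∣
      ≡⟨ cong ∣_∣ (solve 3 (λ i x y → i :* x :- i :* y := i :* (x :- y)) refl I x (P * p)) ⟩
    ∣ I * (x - P * p) ∣
      ≡⟨ trans (ℚₚ.∣p*q∣≡∣p∣*∣q∣ I (x - P * p)) (cong (_* ∣ x - P * p ∣) (ℚₚ.0≤p⇒∣p∣≡p 0≤I)) ⟩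
    I * ∣ x - P * p ∣
      ≤⟨ *-monoˡ I 0≤I close ⟩
    I * (P * d)
      ≡⟨ cancel d ⟩
    d ∎
    where
    open ℚₚ.≤-Reasoning
    P = mass n 1ℚ
    I = inv P
    0≤I = ℚₚ.<⇒≤ (inv-pos (0<mass n 0≤1))
    cancel : ∀ y → I * (P * y) ≡ y
    cancel y = trans (solve 3 (λ i p y → i :* (p :* y) := p :* i :* y) refl I P y)
      (trans (cong (_* y) (*-inv (0<mass n 0≤1))) (ℚₚ.*-identityˡ y))

seq-poisson : ∀ (g : ℕ → ℝ) h R m → (∀ k → k ℕ.< R → seq (g k) m ≡ h k) →
              seq (sumᴿ (List.map (λ k → poisson₁ k *ᴿ g k) (upTo R))) m ≡ expSum m * sumTo R (egf h)
seq-poisson g h R m g≡h = begin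
  seq (sumᴿ (List.map (λ k → poisson₁ k *ᴿ g k) (upTo R))) m
    ≡⟨ seq-sumTo (λ k → poisson₁ k *ᴿ g k) (λ k → k) R m ⟩
  sumTo R (λ k → expSum m * 1/! k * seq (g k) m)
    ≡⟨ sumTo-cong-< R (λ k k<R → trans (cong (expSum m * 1/! k *_) (g≡h k k<R))
         (solve 3 (λ e i x → e :* i :* x := e :* (x :* i)) refl (expSum m) (1/! k) (h k))) ⟩
  sumTo R (λ k → expSum m * egf h k)
    ≡⟨ sumTo-* R (expSum m) (egf h) ⟩
  expSum m * sumTo R (egf h) ∎
  where open ≡-Reasoning

error-small : ∀ M ε → 0ℚ ≤ M → 0ℚ < ε → ∃ λ R₀ → ∀ R → R₀ ℕ.≤ R → M * errorℚ R < ε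
error-small M ε 0≤M 0<ε =
  let η , 0<η , η+η≡ε = halve ε 0<ε
      e , 2⁻e≤ = 2⁻-small (η * inv c) (*-pos 0<η (inv-pos 0<c))
  in e , λ R e≤R → ℚₚ.≤-<-trans (small η R (ℚₚ.≤-trans (2⁻-antitone e≤R) 2⁻e≤))
       (subst₂ _<_ (ℚₚ.+-identityʳ η) η+η≡ε (ℚₚ.+-monoʳ-< η 0<η))
  where
  open ℚₚ.≤-Reasoning
  K c : ℚ
  K = 64ℚ + 1ℚ + 1ℚ + 8ℚ * 64ℚ
  -- The summand 1 keeps `c` invertible when M = 0.
  c = 1ℚ + M * K
  0≤MK : 0ℚ ≤ M * K
  0≤MK = 0≤-* 0≤M (0≤-+ (0≤-+ (0≤-+ 0≤⟦ 64 ⟧ 0≤1) 0≤1) (0≤-* 0≤⟦ 8 ⟧ 0≤⟦ 64 ⟧))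
  0<c : 0ℚ < c
  0<c = ℚₚ.+-mono-<-≤ (ℚₚ.positive⁻¹ 1ℚ) 0≤MK
  small : ∀ η R → 2⁻ R ≤ η * inv c → M * errorℚ R ≤ η
  small η R 2⁻R≤ = begin
    M * (K * 2⁻ R)        ≤⟨ ≤-by (2⁻ R) (0≤2⁻ R) (solve 3 (λ m k t → m :* (k :* t) :+ t := (con 1ℚ :+ m :* k) :* t)
          refl M K (2⁻ R)) ⟩
    c * 2⁻ R              ≤⟨ *-monoˡ c (ℚₚ.<⇒≤ 0<c) 2⁻R≤ ⟩
    c * (η * inv c)       ≡⟨ solve 3 (λ c e i → c :* (e :* i) := e :* (c :* i)) refl c η (inv c) ⟩
    η * (c * inv c)       ≡⟨ cong (η *_) (*-inv 0<c) ⟩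
    η * 1ℚ                ≡⟨ ℚₚ.*-identityʳ η ⟩
    η                     ∎

<ᴿ-ι : ∀ {x M} → x <ᴿ ι M → ∃ λ N → ∀ m → N ℕ.≤ m → seq x m ≤ M
<ᴿ-ι {x} {M} (δ , 0<δ , N , p) = N , λ m h → ℚₚ.<⇒≤ (subst₂ _<_ (ℚₚ.+-identityˡ (seq x m))
  (solve 2 (λ a b → b :- a :+ a := b) refl (seq x m) M)
  (ℚₚ.+-monoˡ-< (seq x m) (ℚₚ.<-trans 0<δ (p m h))))

-- Passage to real parameters and the limit.

module PoissonLimit (α β : ℝ) (α>0 : 0ᴿ <ᴿ α) (β>0 : 0ᴿ <ᴿ β) (g : ℕ → ℝ) (M : ℚ)
                    (bounded : ∀ k → ∃ λ N → ∀ m → N ℕ.≤ m → ∣ seq (g k) m ∣ ≤ M) where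
  s x : ℕ → ℝ
  s R = sumᴿ (List.map (λ k → poisson₁ k *ᴿ g k) (upTo R))
  x n = 𝔼 (tableauSpace α β α>0 β>0 n) (λ S → g (X³ S))

  0≤M : 0ℚ ≤ M
  0≤M = let N , p = bounded 0 in ℚₚ.≤-trans (ℚₚ.0≤∣p∣ (seq (g 0) N)) (p N ℕₚ.≤-refl)

  estimate : ∀ R n m (0<a : 0ℚ < seq α m) (0<b : 0ℚ < seq β m) → R ℕ.≤ m →
             (∀ k → k ℕ.≤ R ℕ.⊔ length (boxes n) → ∣ seq (g k) m ∣ ≤ M) →
             let open Positive (seq α m) (seq β m) (ℚₚ.<⇒≤ 0<a) (ℚₚ.<⇒≤ 0<b) in
             (∀ r → r ℕ.≤ R → ∣ moment n r 1ℚ - 1/! r * mass n 1ℚ ∣ ≤ 2⁻ R * 2⁻ R * mass n 1ℚ) →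
             ∣ seq (x n) m - seq (s R) m ∣ ≤ M * errorℚ R
  estimate R n m 0<a 0<b R≤m bounds close = subst₂ (λ x y → ∣ x - y ∣ ≤ M * errorℚ R)
    (sym (seq-𝔼 n g h (λ k k≤ → agree k (ℕₚ.≤-trans k≤ (ℕₚ.m≤n⊔m R (length (boxes n)))))))
    (sym (seq-poisson g h R m (λ k k<R → agree k (ℕₚ.≤-trans (ℕₚ.<⇒≤ k<R) (ℕₚ.m≤m⊔n R (length (boxes n)))))))
    (normalised-estimate n (poisson-estimate R m n h 0≤M (λ k → bounds (k ℕ.⊓ K) (ℕₚ.m⊓n≤n k K)) R≤m close))
    where
    open AtIndex α β α>0 β>0 m 0<a 0<b
    open Expectation (seq α m) (seq β m) (ℚₚ.<⇒≤ 0<a) (ℚₚ.<⇒≤ 0<b)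
    K = R ℕ.⊔ length (boxes n)
    -- Truncation makes the bound by M hold for all arguments at one index m.
    h : ℕ → ℚ
    h k = seq (g (k ℕ.⊓ K)) m
    agree : ∀ k → k ℕ.≤ K → seq (g k) m ≡ h k
    agree k k≤K = cong (λ i → seq (g i) m) (sym (ℕₚ.m≤n⇒m⊓n≡m k≤K))

  -- R depends on ε, the threshold for n on R and B, and the threshold for m on R and n, because the
  -- number of values k at which g must be bounded grows with n. `Near` permits this, as its index
  -- is chosen after n.
  approx : ∀ ε → 0ℚ < ε → ∃ λ R₀ → ∀ R → R₀ ℕ.≤ R → ∃ λ N → ∀ n → N ℕ.≤ n → Near ε (x n) (s R)
  approx ε 0<ε = choose-R (error-small M ε 0≤M 0<ε) (positive-parameters α β α>0 β>0)
    where
    Goal : ℕ → ℕ → Set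
    Goal R n = Near ε (x n) (s R)
    Parameters : ℕ → ℕ → Set
    Parameters B N = ∀ m → N ℕ.≤ m → 0ℚ < seq α m × 0ℚ < seq β m × seq α m + seq β m ≤ ⟦ B ⟧ * (seq α m * seq β m)
    choose-m : ∀ B N₁ R n → M * errorℚ R < ε → Parameters B N₁ →
               (∀ r → r ℕ.≤ R → MomentClose B (2⁻ R * 2⁻ R) r n) →
               (∃ λ N → ∀ m → N ℕ.≤ m → ∀ k → k ℕ.≤ R ℕ.⊔ length (boxes n) → ∣ seq (g k) m ∣ ≤ M) → Goal R n
    choose-m B N₁ R n small params limits (N₂ , bounds) = (N₁ ℕ.⊔ N₂) ℕ.⊔ R , λ m h →
      let h₁₂ = ℕₚ.m⊔n≤o⇒m≤o (N₁ ℕ.⊔ N₂) R h in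
      at-m m (ℕₚ.m⊔n≤o⇒n≤o (N₁ ℕ.⊔ N₂) R h) (bounds m (ℕₚ.m⊔n≤o⇒n≤o N₁ N₂ h₁₂)) (params m (ℕₚ.m⊔n≤o⇒m≤o N₁ N₂ h₁₂))
      where
      at-m : ∀ m → R ℕ.≤ m → (∀ k → k ℕ.≤ R ℕ.⊔ length (boxes n) → ∣ seq (g k) m ∣ ≤ M) →
             0ℚ < seq α m × 0ℚ < seq β m × seq α m + seq β m ≤ ⟦ B ⟧ * (seq α m * seq β m) →
             ∣ seq (x n) m - seq (s R) m ∣ < ε
      at-m m R≤m bounds (0<a , 0<b , T≤) = ℚₚ.≤-<-trans
        (estimate R n m 0<a 0<b R≤m bounds
          (λ r r≤R → limits r r≤R (seq α m) (seq β m) (ℚₚ.<⇒≤ 0<a) (ℚₚ.<⇒≤ 0<b) T≤))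
        small
    choose-n : ∀ B N₁ R → M * errorℚ R < ε → Parameters B N₁ →
               (∃ λ N → ∀ n → N ℕ.≤ n → ∀ r → r ℕ.≤ R → MomentClose B (2⁻ R * 2⁻ R) r n) → ∃ λ N → ∀ n → N ℕ.≤ n → Goal R n
    choose-n B N₁ R small params (N , limits) = N , λ n N≤n → choose-m B N₁ R n small params (limits n N≤n)
      (eventually-all (λ k m → ∣ seq (g k) m ∣ ≤ M) bounded (R ℕ.⊔ length (boxes n)))
    choose-R : (∃ λ R₀ → ∀ R → R₀ ℕ.≤ R → M * errorℚ R < ε) → (∃ λ B → ∃ λ N → Parameters B N) →
               ∃ λ R₀ → ∀ R → R₀ ℕ.≤ R → ∃ λ N → ∀ n → N ℕ.≤ n → Goal R n
    choose-R (R₀ , small) (B , N₁ , params) = R₀ , λ R R₀≤R → choose-n B N₁ R (small R R₀≤R) params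
      (eventually-all (λ r n → MomentClose B (2⁻ R * 2⁻ R) r n)
        (λ r → moment-limit B r (2⁻ R * 2⁻ R) (*-pos (2⁻-pos R) (2⁻-pos R))) R)

theorem4p6 : (α β : ℝ) (α>0 : 0ᴿ <ᴿ α) (β>0 : 0ᴿ <ᴿ β) →
    ConvergesInDistribution (tableauSpace α β α>0 β>0) (λ n S → fromℕ (X³ S)) poisson₁
theorem4p6 α β α>0 β>0 f _ (M , f-bounded) = common-limit s x approx
  where open PoissonLimit α β α>0 β>0 (λ k → f (fromℕ k)) M (λ k → <ᴿ-ι {∣ f (fromℕ k) ∣ᴿ} (f-bounded (fromℕ k)))
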